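{- Let $\mathcal{A}$ be a central and essential arrangement in $\mathbb{Q}^l$ as in the context, with $\lcm$-period $\rho_0$, let $\sigma$ be a term ordering and $p$ a prime. Then the following are equivalent: (1) $p$ is not good for $\mathcal{A}$ or $p$ is not $(\sigma,l)$-lucky for $\mathcal{A}$; (2) $p$ divides $\rho_0$.
   Context: $\mathcal{A}=\{H_1,\dots,H_n\}$: $n$ distinct linear hyperplanes in $\mathbb{Q}^l$ with $\bigcap H_i=\{0\}$, $H_i=\{\alpha_i=0\}$, $\alpha_i=\sum_{k=1}^lc_{ki}x_k$ with $c_{ki}\in\mathbb{Z}$ not all divisible by any prime. $p$ is good for $\mathcal{A}$ if the reduction mod $p$ of $\prod\alpha_i$ is reduced (no $(\alpha_i)_p$ is a scalar multiple of $(\alpha_j)_p$, $i<j$). Let $C=(c_{ki})\in\mathrm{Mat}_{l\times n}(\mathbb{Z})$ with columns $c_1,\dots,c_n$; for nonempty $J=\{i_1<\dots<i_k\}\subseteq[n]$, $C_J=(c_{i_1},\dots,c_{i_k})$, with Smith normal form having nonzero diagonal entries $e_{J,1}\mid\dots\mid e_{J,r}$ (positive), $r=\mathrm{rk}(C_J)$; $e(J)=e_{J,r}$ and $\rho_0=\lcm\{e(J): 1\le|J|\le l\}$. For a term ordering $\sigma$ and nonzero $f\in\mathbb{Z}[x_1,\dots,x_l]$, $\mathrm{LM}_\sigma(f)$ is the $\sigma$-leading term times its coefficient $\mathrm{LC}_\sigma(f)$. A minimal strong $\sigma$-Gröbner basis of an ideal $I\subseteq\mathbb{Z}[x_1,\dots,x_l]$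 is a finite generating set $G$ of nonzero elements of $I$ such that every nonzero $f\in I$ has $\mathrm{LM}_\sigma(f)$ divisible by some $\mathrm{LM}_\sigma(g)$, $g\in G$, and no $\mathrm{LM}_\sigma(g)$ divides $\mathrm{LM}_\sigma(g')$ for distinct $g,g'$; its set of leading coefficients is independent of the choice. $p$ is $\sigma$-lucky for $I$ if it divides none of them; $p$ is $(\sigma,l)$-lucky for $\mathcal{A}$ if it is $\sigma$-lucky for every ideal $\langle\alpha_{i_1},\dots,\alpha_{i_l}\rangle$ with $i_1<\dots<i_l$ and $\operatorname{codim}(H_{i_1}\cap\dots\cap H_{i_l})=l$. -}

module Defs where

open import Algebra.Properties.Semiring.Sum using (sum)
open import Data.Fin.Base as Fin using (Fin; toℕ)
import Data.Fin.Properties as Fin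
open import Data.Integer.Base as ℤ using (ℤ; +_; 0ℤ; 1ℤ)
import Data.Integer.Divisibility as ℤ
import Data.Integer.Properties as ℤ
open import Data.List.Base as List using (List; []; _∷_; concat; filter; cartesianProductWith)
import Data.List.Extrema as Extrema
open import Data.Nat.Base as ℕ using (ℕ)
open import Data.Nat.Divisibility using (_∣_)
open import Data.Nat.Primality using (Prime)
import Data.Nat.Properties as ℕ
open import Data.Product.Base using (_×_; _,_; ∃; ∃-syntax; proj₂)
open import Data.Rational.Base as ℚ using (ℚ; 0ℚ)
import Data.Rational.Properties as ℚ
open import Data.Vec.Base as Vec using (Vec; replicate; zipWith)
import Data.Vec.Properties as Vec
open import Data.Vec.Functional using (Vector)
open import Algebra.Bundles using (CommutativeRing)
open import Level using (0ℓ; suc)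
open import Relation.Binary.Bundles using (TotalOrder)
open import Relation.Binary.Core using (Rel)
open import Relation.Binary.Definitions using (DecidableEquality)
open import Relation.Binary.PropositionalEquality.Core using (_≡_; _≢_)
open import Relation.Binary.Structures using (IsTotalOrder)
open import Relation.Nullary.Decidable.Core using (¬?; does)
open import Relation.Nullary.Negation.Core using (¬_)
open import Relation.Unary using (Pred; ⋂; _∈_; _≐_)
open import Data.Bool.Base using (if_then_else_)

sumℤ : ∀ {n : ℕ} → Vector ℤ n → ℤ
sumℤ = sum ℤ.+-*-semiring

sumℚ : ∀ {n : ℕ} → Vector ℚ n → ℚ
sumℚ = sum (CommutativeRing.semiring ℚ.+-*-commutativeRing)

-- J = {i₁ < ⋯ < iₖ} ⊆ [n] is represented by its increasing enumeration.
StrictlyIncreasing : ∀ {k n} → (Fin k → Fin n) → Set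
StrictlyIncreasing J = ∀ a b → a Fin.< b → J a Fin.< J b

------------------------------------------------------------------------
-- Integer matrices and the Smith normal form

Matrix : ℕ → ℕ → Set
Matrix m n = Fin m → Fin n → ℤ

infixl 7 _⊗_

_⊗_ : ∀ {m k n} → Matrix m k → Matrix k n → Matrix m n
(A ⊗ B) i j = sumℤ (λ t → A i t ℤ.* B t j)

1ᴹ : ∀ {n} → Matrix n n
1ᴹ i j = if does (i Fin.≟ j) then 1ℤ else 0ℤ

Unimodular : ∀ {n} → Matrix n n → Set
Unimodular U = ∃[ U⁻¹ ] (∀ i j → (U ⊗ U⁻¹) i j ≡ 1ᴹ i j) × (∀ i j → (U⁻¹ ⊗ U) i j ≡ 1ᴹ i j)

-- The rank of A is the number of nonzero diagonal entries.
record SmithNormalForm {m n} (A : Matrix m n) : Set where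
  field
    U              : Matrix m m
    V              : Matrix n n
    U-unimodular   : Unimodular U
    V-unimodular   : Unimodular V
    rank           : ℕ
    rank≤m         : rank ℕ.≤ m
    rank≤n         : rank ℕ.≤ n
    e              : Fin rank → ℕ
    e-positive     : ∀ s → 0 ℕ.< e s
    e-chain        : ∀ s t → s Fin.≤ t → e s ∣ e t
    diagonal-entry : ∀ i j (s : Fin rank) → toℕ i ≡ toℕ s → toℕ j ≡ toℕ s → (U ⊗ A ⊗ V) i j ≡ + e s
    zero-entry     : ∀ i j → (∀ (s : Fin rank) → ¬ (toℕ i ≡ toℕ s × toℕ j ≡ toℕ s)) → (U ⊗ A ⊗ V) i j ≡ 0ℤ

IsLastInvariantFactor : ∀ {m n} → Matrix m n → ℕ → Set
IsLastInvariantFactor A d = ∃[ S ] let open SmithNormalForm {A = A} S in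
  ∃[ s ] ℕ.suc (toℕ s) ≡ rank × e s ≡ d

IsLcm : Pred ℕ 0ℓ → ℕ → Set
IsLcm P m = (∀ d → P d → d ∣ m) × (∀ m′ → (∀ d → P d → d ∣ m′) → m ∣ m′)

------------------------------------------------------------------------
-- Subspaces of ℚˡ

LinearlyIndependent : ∀ {d l} → (Fin d → Vector ℚ l) → Set
LinearlyIndependent {d} v = ∀ (a : Vector ℚ d) → (∀ k → sumℚ (λ j → a j ℚ.* v j k) ≡ 0ℚ) → ∀ j → a j ≡ 0ℚ

IsBasis : ∀ {d l} → Pred (Vector ℚ l) 0ℓ → (Fin d → Vector ℚ l) → Set
IsBasis {d} W v = (∀ j → v j ∈ W) × LinearlyIndependent v
  × (∀ x → x ∈ W → ∃ λ (a : Vector ℚ d) → ∀ k → x k ≡ sumℚ (λ j → a j ℚ.* v j k))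

Codim : ∀ {l} → Pred (Vector ℚ l) 0ℓ → ℕ → Set
Codim {l} W c = ∃[ d ] ∃ (IsBasis {d} W) × d ℕ.+ c ≡ l

------------------------------------------------------------------------
-- Monomials and polynomials over ℤ

-- Power products x₁^t₁ ⋯ xₗ^tₗ.
PP : ℕ → Set
PP l = Vec ℕ l

module _ {l : ℕ} where

  infixl 7 _∙_
  infix 4 _≟ᴾᴾ_

  _∙_ : PP l → PP l → PP l
  _∙_ = zipWith ℕ._+_

  𝟙 : PP l
  𝟙 = replicate l 0

  var : Fin l → PP l
  var k = Vec.tabulate (λ i → if does (i Fin.≟ k) then 1 else 0)

  _≟ᴾᴾ_ : DecidableEquality (PP l)
  _≟ᴾᴾ_ = Vec.≡-dec ℕ._≟_

Monomial : ℕ → Set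
Monomial l = ℤ × PP l

module _ {l : ℕ} where

  infixl 7 _·_
  infix 4 _∣ᴹ_

  _·_ : Monomial l → Monomial l → Monomial l
  (a , s) · (b , t) = a ℤ.* b , s ∙ t

  _∣ᴹ_ : Rel (Monomial l) 0ℓ
  m ∣ᴹ m′ = ∃[ q ] m′ ≡ q · m

-- Formal sums of monomials, possibly with repetitions or zero coefficients;
-- equality of polynomials is _≈_, not _≡_.
Poly : ℕ → Set
Poly l = List (Monomial l)

module _ {l : ℕ} where

  infix 4 _≈_
  infixl 6 _+ᴾ_
  infixl 7 _*ᴾ_

  coeff : Poly l → PP l → ℤ
  coeff []            t = 0ℤ
  coeff ((c , s) ∷ f) t = (if does (s ≟ᴾᴾ t) then c else 0ℤ) ℤ.+ coeff f t

  _≈_ : Rel (Poly l) 0ℓ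
  f ≈ g = ∀ t → coeff f t ≡ coeff g t

  0ᴾ : Poly l
  0ᴾ = []

  _+ᴾ_ : Poly l → Poly l → Poly l
  _+ᴾ_ = List._++_

  _*ᴾ_ : Poly l → Poly l → Poly l
  _*ᴾ_ = cartesianProductWith _·_

  sumᴾ : ∀ {k} → (Fin k → Poly l) → Poly l
  sumᴾ f = List.foldr _+ᴾ_ 0ᴾ (List.tabulate f)

  ⟨_⟩ : ∀ {k} → (Fin k → Poly l) → Pred (Poly l) 0ℓ
  ⟨_⟩ {k} F f = ∃ λ (h : Fin k → Poly l) → f ≈ sumᴾ (λ i → h i *ᴾ F i)

------------------------------------------------------------------------
-- Term orderings and strong Gröbner bases

record TermOrdering (l : ℕ) : Set (suc 0ℓ) where
  infix 4 _≤_
  field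
    _≤_          : Rel (PP l) 0ℓ
    isTotalOrder : IsTotalOrder _≡_ _≤_
    𝟙-minimum    : ∀ t → 𝟙 ≤ t
    ∙-mono       : ∀ s t u → s ≤ t → s ∙ u ≤ t ∙ u

  totalOrder : TotalOrder 0ℓ 0ℓ 0ℓ
  totalOrder = record { isTotalOrder = isTotalOrder }

module _ {l : ℕ} (σ : TermOrdering l) where

  open Extrema (TermOrdering.totalOrder σ) using (max)

  -- The power products with nonzero coefficient in f, possibly repeated.
  support : Poly l → List (PP l)
  support f = filter (λ t → ¬? (coeff f t ℤ.≟ 0ℤ)) (List.map proj₂ f)

  -- As 𝟙 is the σ-minimum, it is a neutral starting value for the maximum;
  -- it is also the value at f ≈ 0ᴾ, where LT, LC and LM carry no meaning.
  LT : Poly l → PP l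
  LT f = max 𝟙 (support f)

  LC : Poly l → ℤ
  LC f = coeff f (LT f)

  LM : Poly l → Monomial l
  LM f = LC f , LT f

  record IsMinimalStrongGröbnerBasis (I : Pred (Poly l) 0ℓ) {m} (G : Fin m → Poly l) : Set where
    field
      nonzero   : ∀ i → ¬ (G i ≈ 0ᴾ)
      generates : I ≐ ⟨ G ⟩
      strong    : ∀ f → f ∈ I → ¬ (f ≈ 0ᴾ) → ∃[ i ] LM (G i) ∣ᴹ LM f
      minimal   : ∀ i j → i ≢ j → ¬ (LM (G i) ∣ᴹ LM (G j))

  -- The leading coefficients do not depend (up to sign) on the basis G, and such
  -- a G exists for every ideal, so quantifying over all G amounts to fixing one.
  Lucky : ℕ → Pred (Poly l) 0ℓ → Set
  Lucky p I = ∀ {m} (G : Fin m → Poly l) → IsMinimalStrongGröbnerBasis I G →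
    ∀ i → ¬ (+ p ℤ.∣ LC (G i))

------------------------------------------------------------------------
-- Arrangements

-- The value at x of the linear form with integer coefficients c.
eval : ∀ {l} → Vector ℤ l → Vector ℚ l → ℚ
eval c x = sumℚ (λ k → (c k ℚ./ 1) ℚ.* x k)

-- Column i of C holds the coefficients of αᵢ; content-1 makes them coprime, in
-- particular not all zero, so that H i is a hyperplane.
record Arrangement (l n : ℕ) : Set where
  field
    C : Matrix l n

  H : Fin n → Pred (Vector ℚ l) 0ℓ
  H i x = eval (λ k → C k i) x ≡ 0ℚ

  field
    content-1 : ∀ i q → Prime q → ¬ (∀ k → + q ℤ.∣ C k i)
    distinct  : ∀ i j → i ≢ j → ¬ (H i ≐ H j)
    essential : ∀ x → x ∈ ⋂ (Fin n) H → ∀ k → x k ≡ 0ℚ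

  α : Fin n → Poly l
  α i = List.tabulate (λ k → C k i , var k)

  columns : ∀ {k} → (Fin k → Fin n) → Matrix l k
  columns J i j = C i (J j)

  -- The reduction of ∏ αᵢ mod p is reduced: no (αᵢ)ₚ is a scalar multiple of (αⱼ)ₚ
  -- for i < j.  Scalars in 𝔽ₚ are represented by integers.
  Good : ℕ → Set
  Good p = ∀ i j → i Fin.< j → ¬ (∃[ a ] ∀ k → + p ℤ.∣ C k i ℤ.- a ℤ.* C k j)

  -- (σ , l)-luckiness.
  LuckyFor : TermOrdering l → ℕ → Set
  LuckyFor σ p = (J : Fin l → Fin n) → StrictlyIncreasing J →
    Codim (⋂ (Fin l) (λ a → H (J a))) l → Lucky σ p ⟨ (λ a → α (J a)) ⟩

  IsLcmPeriod : ℕ → Set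
  IsLcmPeriod = IsLcm (λ d → ∃[ k ] 1 ℕ.≤ k × k ℕ.≤ l ×
    ∃[ J ] StrictlyIncreasing {k} J × IsLastInvariantFactor (columns J) d)

{-# OPTIONS --safe #-}

-- The last invariant factor e(J) is the exponent of the torsion of ℤˡ/⟨C_J⟩, so p ∣ e(J) means p-torsion there.
--
-- For a nonsingular l × l matrix C_J the ideal ⟨α_J⟩ contains d xₖ for all k, where d = e(J).  A leading
-- coefficient c of a minimal strong Gröbner basis is the least one at its leading term, hence divides d.
-- Conversely, the linear parts of the basis elements span ⟨C_J⟩ triangularly with respect to σ, so if p
-- divides no leading coefficient, the index of ⟨C_J⟩ in ℤˡ is prime to p.  Finally, p-torsion modulo the
-- span of an arbitrary J survives modulo a nonsingular J₁ that contains a maximal independent part of J.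
--
-- The conclusions are decidable or negative, so the existence of Smith normal forms, Gröbner bases and
-- least elements is needed only up to double negation.

module Submission where

open import Defs
open import Algebra.Bundles using (CommutativeRing)
import Algebra.Properties.Semiring.Sum as Sum
open import Data.Bool.Base using (Bool; true; false; if_then_else_)
open import Data.Fin.Base as Fin using (Fin; zero; suc; toℕ; fromℕ<; punchIn; punchOut)
open import Data.Fin.Permutation using (Permutation′; transpose; _⟨$⟩ʳ_; _⟨$⟩ˡ_; inverseˡ; inverseʳ)
import Data.Fin.Properties as Fin
open import Data.Integer.Base as ℤ using (ℤ; +_; -[1+_]; 0ℤ; 1ℤ; -1ℤ; -_; _+_; _*_; _-_; ∣_∣)
open import Data.Integer.DivMod as ℤ using (_/ℕ_; _%ℕ_; n%ℕd<d; a≡a%ℕn+[a/ℕn]*n; a≡a%n+[a/n]*n; n%d<d)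
open import Data.Integer.Divisibility.Signed as ℤ using (divides; ∣⇒∣ᵤ; ∣ᵤ⇒∣; ∣-trans; ∣m∣n⇒∣m+n; ∣n⇒∣m*n)
import Data.Integer.Properties as ℤ
open import Data.Integer.Tactic.RingSolver using (solve-∀)
open import Data.List.Base as List using (List; []; _∷_; _++_)
import Data.List.Extrema as Extrema
open import Data.List.Membership.Propositional using (_∈_)
open import Data.List.Membership.Propositional.Properties using (∈-filter⁺; ∈-filter⁻)
import Data.List.Properties as List
open import Data.List.Relation.Unary.All as All using (All; []; _∷_)
import Data.List.Relation.Unary.All.Properties as All
open import Data.List.Relation.Unary.Any as Any using (Any; here; there)
import Data.List.Relation.Unary.Any.Properties as Any
open import Data.Nat.Base as ℕ using (ℕ; zero; suc; z≤n; s≤s)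
open import Data.Nat.Divisibility as ℕ using (_∣_)
import Data.Nat.Induction as ℕ
open import Data.Nat.Primality using (Prime; prime⇒nonTrivial; prime⇒nonZero; euclidsLemma; prime[2])
import Data.Nat.Properties as ℕ
open import Data.Product.Base using (_×_; _,_; ∃; ∃-syntax; proj₁; proj₂)
open import Data.Rational.Base as ℚ using (ℚ; 0ℚ; toℚᵘ)
import Data.Rational.Properties as ℚ
open import Data.Rational.Unnormalised.Base as ℚᵘ using (mkℚᵘ; *≡*)
import Data.Rational.Unnormalised.Properties as ℚᵘ
open import Data.Sum.Base using (_⊎_; inj₁; inj₂)
open import Data.Vec.Base as Vec using (Vec; []; _∷_)
open import Data.Vec.Functional using (Vector; tail) renaming (_∷_ to infixr 5 _∷ⱽ_)
import Data.Vec.Properties as Vec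
open import Data.Vec.Relation.Binary.Pointwise.Inductive using (Pointwise; []; _∷_)
open import Function.Base using (_∘_; id)
open import Function.Bundles using (_⇔_; mk⇔)
open import Induction.WellFounded using (Acc; acc)
open import Level using (0ℓ)
open import Relation.Binary.Definitions using (tri<; tri≈; tri>)
open import Relation.Binary.PropositionalEquality hiding (J)
open import Relation.Binary.Structures using (IsTotalOrder)
open import Relation.Nullary.Decidable using (dec-true)
open import Relation.Nullary.Decidable.Core using (Dec; yes; no; does; ¬?; ¬¬-excluded-middle; decidable-stable)
open import Relation.Nullary.Negation.Core using (¬_; contradiction; negated-stable; Stable)
open import Relation.Unary using (Pred; ⋂)
open import Algebra.Properties.Semiring.Sum ℤ.+-*-semiring using (sum-cong-≗; ∑-distrib-+; ∑-comm; *-distribˡ-sum; *-distribʳ-sum)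

-- Failure of goodness is used in one direction only. If column i is congruent to a multiple of
-- column j mod `p`, the matrix with these two columns has rank 2 over ℚ, since the hyperplanes are
-- distinct, but has a kernel mod `p`; so `p` divides one of its invariant factors, and rank 2
-- forces 2 ≤ `l`, so the pair is among the sets that define the period. In the other direction it
-- is always luckiness that is refuted.
--
-- No determinant or index is formed. That the index of a span is prime to `p` is expressed as
-- saturation: every integral vector `y` has a multiple `D ⊙ y` in the span with `p` not dividing
-- `D`. In this form the property can be tested on one variable at a time, and it clashes directly
-- with a vector whose order modulo the span is divisible by `p`.
--
-- The period is given by the universal property of a least common multiple, which 0 satisfies when
-- the set has no nonzero common multiple. To divide `p` out of the period, 0 has to be excluded
-- first, by a bound over the finitely many J.

infixl 1 _>>=_

-- These names let `do` blocks run in the double negation monad.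
_>>=_ : ∀ {a b} {A : Set a} {B : Set b} → ¬ ¬ A → (A → ¬ ¬ B) → ¬ ¬ B
(m >>= k) ¬b = m λ a → k a ¬b

return : ∀ {a} {A : Set a} → A → ¬ ¬ A
return a ¬a = ¬a a

-- The minimum principle for a predicate that need not be decidable: without a least element,
-- well-founded induction refutes `P` everywhere.
¬¬-least : ∀ {a} (P : ℕ → Set a) → ∀ n → P n → ¬ ¬ (∃[ m ] P m × (∀ k → k ℕ.< m → ¬ P k))
¬¬-least P n Pn ¬least = go n (ℕ.<-wellFounded n) Pn
  where
  go : ∀ n → Acc ℕ._<_ n → ¬ P n
  go n (acc rs) Pn = ¬least (n , Pn , λ k k<n → go k (rs k<n))

-- Double negation can be moved across a finite product, here by induction on the number of factors;
-- hence the index type `Fin n`.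
¬¬-choice : ∀ {a} {n} {P : Fin n → Set a} → (∀ i → ¬ ¬ P i) → ¬ ¬ (∀ i → P i)
¬¬-choice {n = zero} f = return λ ()
¬¬-choice {n = suc n} f = do
  p ← f zero
  ps ← ¬¬-choice (f ∘ suc)
  return λ { zero → p ; (suc i) → ps i }

-- Linear algebra over ℤ: sums, submodules, linear maps, automorphisms.

sum-zero : ∀ {n} {f : Vector ℤ n} → (∀ i → f i ≡ 0ℤ) → sumℤ f ≡ 0ℤ
sum-zero {zero}  f≡0 = refl
sum-zero {suc n} f≡0 = cong₂ _+_ (f≡0 zero) (sum-zero (f≡0 ∘ suc))

sum-single : ∀ {n} (f : Vector ℤ n) j → (∀ i → i ≢ j → f i ≡ 0ℤ) → sumℤ f ≡ f j
sum-single f zero h = trans (cong₂ _+_ {x = f zero} refl (sum-zero λ i → h (suc i) λ ())) (ℤ.+-identityʳ (f zero))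
sum-single f (suc j) h = trans (cong₂ _+_ (h zero λ ()) (sum-single (f ∘ suc) j λ i i≢j → h (suc i) (i≢j ∘ Fin.suc-injective))) (ℤ.+-identityˡ _)

1ᴹ-diagonal : ∀ {n} (i : Fin n) → 1ᴹ i i ≡ 1ℤ
1ᴹ-diagonal zero    = refl
1ᴹ-diagonal (suc i) = 1ᴹ-diagonal i

1ᴹ-off-diagonal : ∀ {n} {i j : Fin n} → i ≢ j → 1ᴹ i j ≡ 0ℤ
1ᴹ-off-diagonal {i = i} {j} i≢j with i Fin.≟ j
... | yes i≡j = contradiction i≡j i≢j
... | no _    = refl

sum-1ᴹʳ : ∀ {n} (f : Vector ℤ n) j → sumℤ (λ t → f t * 1ᴹ t j) ≡ f j
sum-1ᴹʳ f j = trans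
  (sum-single _ j λ i i≢j → trans (cong (f i *_) (1ᴹ-off-diagonal i≢j)) (ℤ.*-zeroʳ (f i)))
  (trans (cong (f j *_) (1ᴹ-diagonal j)) (ℤ.*-identityʳ (f j)))

sum-1ᴹˡ : ∀ {n} (f : Vector ℤ n) j → sumℤ (λ t → 1ᴹ j t * f t) ≡ f j
sum-1ᴹˡ f j = trans
  (sum-single _ j λ i i≢j → trans (cong (_* f i) (1ᴹ-off-diagonal (i≢j ∘ sym))) (ℤ.*-zeroˡ (f i)))
  (trans (cong (_* f j) (1ᴹ-diagonal j)) (ℤ.*-identityˡ (f j)))

infixl 6 _⊕_
infixr 7 _⊙_
infixr 7 _⋆_

_⊕_ : ∀ {n} → Vector ℤ n → Vector ℤ n → Vector ℤ n
(x ⊕ y) i = x i + y i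

_⊙_ : ∀ {n} → ℤ → Vector ℤ n → Vector ℤ n
(c ⊙ x) i = c * x i

0ⱽ : ∀ {n} → Vector ℤ n
0ⱽ _ = 0ℤ

δ : ∀ {n} → Fin n → Vector ℤ n
δ j i = 1ᴹ i j

_⋆_ : ∀ {m n} → Matrix m n → Vector ℤ n → Vector ℤ m
(A ⋆ x) i = sumℤ λ j → A i j * x j

-- Vectors are functions compared pointwise, so invariance under `≗` has to be part of the
-- structure.
record IsSubmodule {l} (M : Pred (Vector ℤ l) 0ℓ) : Set where
  field
    ≗-resp : ∀ {x y} → x ≗ y → M x → M y
    zero∈ : M 0ⱽ
    ⊕∈ : ∀ {x y} → M x → M y → M (x ⊕ y)
    ⊙∈ : ∀ c {x} → M x → M (c ⊙ x)

  sum∈ : ∀ {n} (F : Fin n → Vector ℤ l) → (∀ t → M (F t)) → M (λ i → sumℤ λ t → F t i)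
  sum∈ {zero}  F h = zero∈
  sum∈ {suc n} F h = ⊕∈ (h zero) (sum∈ (F ∘ suc) (h ∘ suc))

  ⋆∈ : ∀ {n} {A : Matrix l n} → (∀ j → M (λ i → A i j)) → ∀ x → M (A ⋆ x)
  ⋆∈ {A = A} h x = ≗-resp (λ i → sum-cong-≗ λ j → ℤ.*-comm (x j) (A i j)) (sum∈ (λ t → x t ⊙ λ i → A i t) λ t → ⊙∈ (x t) (h t))

  -- Serves as an induction principle: a property that cuts out a submodule needs checking on the
  -- standard basis only.
  δ-generate : (∀ i → M (δ i)) → ∀ x → M x
  δ-generate h x = ≗-resp (λ i → sum-1ᴹˡ x i) (⋆∈ h x)

record IsLinear {m n} (f : Vector ℤ n → Vector ℤ m) : Set where
  field
    f-cong : ∀ {x y} → x ≗ y → f x ≗ f y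
    f-⊕ : ∀ x y → f (x ⊕ y) ≗ f x ⊕ f y
    f-⊙ : ∀ c x → f (c ⊙ x) ≗ c ⊙ f x

  f-0 : f 0ⱽ ≗ 0ⱽ
  f-0 i = trans (f-⊙ 0ℤ 0ⱽ i) (ℤ.*-zeroˡ (f 0ⱽ i))

  -- The vectors on which `f` agrees with its matrix form a submodule that contains the standard
  -- basis.
  expansion : ∀ x → f x ≗ (λ i j → f (δ j) i) ⋆ x
  expansion = IsSubmodule.δ-generate M λ k i → sym (sum-1ᴹʳ (λ j → f (δ j) i) k)
    where
    M : IsSubmodule (λ x → f x ≗ (λ i j → f (δ j) i) ⋆ x)
    M = record
      { ≗-resp = λ x≗y h i → trans (sym (f-cong x≗y i)) (trans (h i) (sum-cong-≗ λ j → cong (f (δ j) i *_) (x≗y j)))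
      ; zero∈ = λ i → trans (f-0 i) (sym (sum-zero λ j → ℤ.*-zeroʳ (f (δ j) i)))
      ; ⊕∈ = λ {x} {y} hx hy i → trans (f-⊕ x y i) (trans (cong₂ _+_ (hx i) (hy i))
          (trans (sym (∑-distrib-+ (λ j → f (δ j) i * x j) _)) (sum-cong-≗ λ j → sym (ℤ.*-distribˡ-+ (f (δ j) i) (x j) (y j)))))
      ; ⊙∈ = λ c {x} hx i → trans (f-⊙ c x i) (trans (cong (c *_) (hx i))
          (trans (*-distribˡ-sum c λ j → f (δ j) i * x j) (sum-cong-≗ λ j → swap c (f (δ j) i) (x j))))
      }
      where
      swap : ∀ c a x → c * (a * x) ≡ a * (c * x)
      swap = solve-∀

⋆-linear : ∀ {m n} (A : Matrix m n) → IsLinear (A ⋆_)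
⋆-linear A = record
  { f-cong = λ x≗y i → sum-cong-≗ λ j → cong (A i j *_) (x≗y j)
  ; f-⊕ = λ x y i → trans (sum-cong-≗ λ j → ℤ.*-distribˡ-+ (A i j) (x j) (y j)) (∑-distrib-+ (λ j → A i j * x j) _)
  ; f-⊙ = λ c x i → trans (sum-cong-≗ λ j → swap c (A i j) (x j)) (sym (*-distribˡ-sum c λ j → A i j * x j))
  }
  where
  swap : ∀ c a x → a * (c * x) ≡ c * (a * x)
  swap = solve-∀

module _ {m n} (A : Matrix m n) where
  open IsLinear (⋆-linear A) public using () renaming (f-cong to ⋆-cong; f-⊕ to ⋆-⊕; f-⊙ to ⋆-⊙; f-0 to ⋆-0)

⋆-δ : ∀ {m n} (A : Matrix m n) j → A ⋆ δ j ≗ λ i → A i j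
⋆-δ A j i = sum-1ᴹʳ (A i) j

1ᴹ-⋆ : ∀ {n} (x : Vector ℤ n) → 1ᴹ ⋆ x ≗ x
1ᴹ-⋆ x i = sum-1ᴹˡ x i

⋆-congˡ : ∀ {m n} {A B : Matrix m n} → (∀ i j → A i j ≡ B i j) → ∀ x → A ⋆ x ≗ B ⋆ x
⋆-congˡ A≡B x i = sum-cong-≗ λ j → cong (_* x j) (A≡B i j)

⊗-⋆ : ∀ {m k n} (A : Matrix m k) (B : Matrix k n) x → (A ⊗ B) ⋆ x ≗ A ⋆ B ⋆ x
⊗-⋆ A B x i = begin
  sumℤ (λ j → sumℤ (λ t → A i t * B t j) * x j)   ≡⟨ sum-cong-≗ (λ j → *-distribʳ-sum (x j) λ t → A i t * B t j) ⟩
  sumℤ (λ j → sumℤ (λ t → A i t * B t j * x j))   ≡⟨ ∑-comm (λ j t → A i t * B t j * x j) ⟩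
  sumℤ (λ t → sumℤ (λ j → A i t * B t j * x j))   ≡⟨ sum-cong-≗ (λ t → trans (sum-cong-≗ λ j → ℤ.*-assoc (A i t) (B t j) (x j)) (sym (*-distribˡ-sum (A i t) λ j → B t j * x j))) ⟩
  sumℤ (λ t → A i t * sumℤ (λ j → B t j * x j))   ∎
  where open ≡-Reasoning

∘-linear : ∀ {m k n} {f : Vector ℤ k → Vector ℤ m} {g : Vector ℤ n → Vector ℤ k} → IsLinear f → IsLinear g → IsLinear (f ∘ g)
∘-linear {f = f} {g} F G = record
  { f-cong = F.f-cong ∘ G.f-cong
  ; f-⊕ = λ x y i → trans (F.f-cong (G.f-⊕ x y) i) (F.f-⊕ (g x) (g y) i)
  ; f-⊙ = λ c x i → trans (F.f-cong (G.f-⊙ c x) i) (F.f-⊙ c (g x) i)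
  }
  where
  module F = IsLinear F
  module G = IsLinear G

-- Unimodular transformations are kept as pairs of inverse linear maps, so that composites and
-- inverses require no matrix identities; the matrices are read off once, at the end.
record Automorphism (n : ℕ) : Set where
  field
    to from : Vector ℤ n → Vector ℤ n
    to-linear : IsLinear to
    from-linear : IsLinear from
    to-from : ∀ x → to (from x) ≗ x
    from-to : ∀ x → from (to x) ≗ x

  inverse : Automorphism n
  inverse = record { to = from ; from = to ; to-linear = from-linear ; from-linear = to-linear ; to-from = from-to ; from-to = to-from }

  matrix : Matrix n n
  matrix i j = to (δ j) i

matrix-unimodular : ∀ {n} (P : Automorphism n) → Unimodular (Automorphism.matrix P)
matrix-unimodular P = Automorphism.matrix P⁻¹ , inv P , inv P⁻¹
  where
  P⁻¹ = Automorphism.inverse P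
  inv : ∀ {n} (P : Automorphism n) i j → (Automorphism.matrix P ⊗ Automorphism.matrix (Automorphism.inverse P)) i j ≡ 1ᴹ i j
  inv P i j = trans (sym (IsLinear.expansion to-linear (from (δ j)) i)) (to-from (δ j) i)
    where open Automorphism P

idᴬ : ∀ {n} → Automorphism n
idᴬ = record { to = id ; from = id ; to-linear = L ; from-linear = L ; to-from = λ _ _ → refl ; from-to = λ _ _ → refl }
  where
  L : IsLinear id
  L = record { f-cong = id ; f-⊕ = λ _ _ _ → refl ; f-⊙ = λ _ _ _ → refl }

infixr 9 _∘ᴬ_

_∘ᴬ_ : ∀ {n} → Automorphism n → Automorphism n → Automorphism n
P ∘ᴬ Q = record
  { to = P.to ∘ Q.to
  ; from = Q.from ∘ P.from
  ; to-linear = ∘-linear P.to-linear Q.to-linear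
  ; from-linear = ∘-linear Q.from-linear P.from-linear
  ; to-from = λ x i → trans (IsLinear.f-cong P.to-linear (Q.to-from (P.from x)) i) (P.to-from x i)
  ; from-to = λ x i → trans (IsLinear.f-cong Q.from-linear (P.from-to (Q.to x)) i) (Q.from-to x i)
  }
  where
  module P = Automorphism P
  module Q = Automorphism Q

-- Existence of the Smith normal form

dot : ∀ {n} → Vector ℤ n → Vector ℤ n → ℤ
dot v x = ((λ (_ : Fin 1) → v) ⋆ x) zero

dot-δ : ∀ {n} (v : Vector ℤ n) j → dot v (δ j) ≡ v j
dot-δ = sum-1ᴹʳ

-- The transvection sending x to x - (v·x)w. Because v·w = 0 it preserves v·x, so the opposite sign
-- gives the inverse. Row and column operations are both of this form, and one shear can clear a
-- whole row or column.
shear : ∀ {n} (v w : Vector ℤ n) → dot v w ≡ 0ℤ → Automorphism n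
shear {n} v w vw≡0 = record
  { to = shift -1ℤ
  ; from = shift 1ℤ
  ; to-linear = shift-linear -1ℤ
  ; from-linear = shift-linear 1ℤ
  ; to-from = λ x i → cancel -1ℤ 1ℤ refl x i
  ; from-to = λ x i → cancel 1ℤ -1ℤ refl x i
  }
  where
  shift : ℤ → Vector ℤ n → Vector ℤ n
  shift s x = x ⊕ (s * dot v x) ⊙ w

  open IsLinear (⋆-linear (λ (_ : Fin 1) → v))

  shift-linear : ∀ s → IsLinear (shift s)
  shift-linear s = record
    { f-cong = λ x≗y i → cong₂ (λ a b → a + s * b * w i) (x≗y i) (f-cong x≗y zero)
    ; f-⊕ = λ x y i → trans (cong (λ b → x i + y i + s * b * w i) (f-⊕ x y zero)) (add (x i) (y i) s (dot v x) (dot v y) (w i))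
    ; f-⊙ = λ c x i → trans (cong (λ b → c * x i + s * b * w i) (f-⊙ c x zero)) (scale c (x i) s (dot v x) (w i))
    }
    where
    add : ∀ x y s p q w → x + y + s * (p + q) * w ≡ (x + s * p * w) + (y + s * q * w)
    add = solve-∀
    scale : ∀ c x s p w → c * x + s * (c * p) * w ≡ c * (x + s * p * w)
    scale = solve-∀

  dot-shift : ∀ s x → dot v (shift s x) ≡ dot v x
  dot-shift s x = trans (f-⊕ x ((s * dot v x) ⊙ w) zero)
    (trans (cong₂ _+_ {x = dot v x} refl (trans (f-⊙ (s * dot v x) w zero) (trans (cong ((s * dot v x) *_) vw≡0) (ℤ.*-zeroʳ (s * dot v x)))))
      (ℤ.+-identityʳ (dot v x)))

  cancel : ∀ s t → s + t ≡ 0ℤ → ∀ x → shift s (shift t x) ≗ x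
  cancel s t s+t≡0 x i = begin
    x i + t * dot v x * w i + s * dot v (shift t x) * w i   ≡⟨ cong (λ b → x i + t * dot v x * w i + s * b * w i) (dot-shift t x) ⟩
    x i + t * dot v x * w i + s * dot v x * w i             ≡⟨ collect (x i) s t (dot v x) (w i) ⟩
    x i + (s + t) * (dot v x * w i)                         ≡⟨ cong (λ c → x i + c * (dot v x * w i)) s+t≡0 ⟩
    x i + 0ℤ                                                ≡⟨ ℤ.+-identityʳ (x i) ⟩
    x i                                                     ∎
    where
    open ≡-Reasoning
    collect : ∀ x s t d w → x + t * d * w + s * d * w ≡ x + (s + t) * (d * w)
    collect = solve-∀

permute : ∀ {n} → Permutation′ n → Automorphism n
permute π = record
  { to = λ x i → x (π ⟨$⟩ʳ i)
  ; from = λ x i → x (π ⟨$⟩ˡ i)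
  ; to-linear = record { f-cong = λ x≗y i → x≗y _ ; f-⊕ = λ _ _ _ → refl ; f-⊙ = λ _ _ _ → refl }
  ; from-linear = record { f-cong = λ x≗y i → x≗y _ ; f-⊕ = λ _ _ _ → refl ; f-⊙ = λ _ _ _ → refl }
  ; to-from = λ x i → cong x (inverseˡ π)
  ; from-to = λ x i → cong x (inverseʳ π)
  }

transpose-δ : ∀ {n} (j : Fin (suc n)) i → δ zero (transpose j zero ⟨$⟩ʳ i) ≡ δ j i
transpose-δ j i with i Fin.≟ j
... | yes _ = refl
... | no i≢j with i Fin.≟ zero
...   | yes refl = 1ᴹ-off-diagonal (i≢j ∘ sym)
...   | no i≢0 = 1ᴹ-off-diagonal i≢0

scaleᴬ : ∀ {n} u → u * u ≡ 1ℤ → Automorphism n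
scaleᴬ {n} u u²≡1 = record
  { to = u ⊙_ ; from = u ⊙_ ; to-linear = L ; from-linear = L ; to-from = inv ; from-to = inv }
  where
  L : IsLinear (u ⊙_)
  L = record
    { f-cong = λ x≗y i → cong (u *_) (x≗y i)
    ; f-⊕ = λ x y i → ℤ.*-distribˡ-+ u (x i) (y i)
    ; f-⊙ = λ c x i → swap u c (x i)
    }
    where
    swap : ∀ u c x → u * (c * x) ≡ c * (u * x)
    swap = solve-∀
  inv : ∀ (x : Vector ℤ n) → u ⊙ (u ⊙ x) ≗ x
  inv x i = trans (sym (ℤ.*-assoc u u (x i))) (trans (cong (_* x i) u²≡1) (ℤ.*-identityˡ (x i)))

lift : ∀ {n} → Automorphism n → Automorphism (suc n)
lift P = record
  { to = ext to ; from = ext from ; to-linear = ext-linear to-linear ; from-linear = ext-linear from-linear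
  ; to-from = λ { x zero → refl ; x (suc i) → to-from (tail x) i }
  ; from-to = λ { x zero → refl ; x (suc i) → from-to (tail x) i }
  }
  where
  open Automorphism P
  ext : ∀ {n} → (Vector ℤ n → Vector ℤ n) → Vector ℤ (suc n) → Vector ℤ (suc n)
  ext f x = x zero ∷ⱽ f (tail x)
  ext-linear : ∀ {n} {f : Vector ℤ n → Vector ℤ n} → IsLinear f → IsLinear (ext f)
  ext-linear L = record
    { f-cong = λ { x≗y zero → x≗y zero ; x≗y (suc i) → f-cong (x≗y ∘ suc) i }
    ; f-⊕ = λ { x y zero → refl ; x y (suc i) → f-⊕ (tail x) (tail y) i }
    ; f-⊙ = λ { c x zero → refl ; c x (suc i) → f-⊙ c (tail x) i }
    }
    where open IsLinear L

record Diagonalization {m n} (f : Vector ℤ n → Vector ℤ m) : Set where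
  field
    P : Automorphism m
    Q : Automorphism n
    rank : ℕ
    rank≤m : rank ℕ.≤ m
    rank≤n : rank ℕ.≤ n
    e : Fin rank → ℕ
    e-positive : ∀ s → 0 ℕ.< e s
    e-chain : ∀ s t → s Fin.≤ t → e s ∣ e t

  entry : Fin m → Fin n → ℤ
  entry i j = Automorphism.to P (f (Automorphism.to Q (δ j))) i

  field
    diagonal-entry : ∀ i j (s : Fin rank) → toℕ i ≡ toℕ s → toℕ j ≡ toℕ s → entry i j ≡ + e s
    zero-entry : ∀ i j → (∀ (s : Fin rank) → ¬ (toℕ i ≡ toℕ s × toℕ j ≡ toℕ s)) → entry i j ≡ 0ℤ

diagonalization⇒SNF : ∀ {m n} {A : Matrix m n} → Diagonalization (A ⋆_) → SmithNormalForm A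
diagonalization⇒SNF {A = A} D = record
  { U = Automorphism.matrix P
  ; V = Automorphism.matrix Q
  ; U-unimodular = matrix-unimodular P
  ; V-unimodular = matrix-unimodular Q
  ; rank = rank
  ; rank≤m = rank≤m
  ; rank≤n = rank≤n
  ; e = e
  ; e-positive = e-positive
  ; e-chain = e-chain
  ; diagonal-entry = λ i j s i≡s j≡s → trans (same i j) (diagonal-entry i j s i≡s j≡s)
  ; zero-entry = λ i j ≢s → trans (same i j) (zero-entry i j ≢s)
  }
  where
  open Diagonalization D
  same : ∀ i j → (Automorphism.matrix P ⊗ A ⊗ Automorphism.matrix Q) i j ≡ entry i j
  same i j = trans (⊗-⋆ (Automorphism.matrix P) A (Automorphism.to Q (δ j)) i)
    (sym (IsLinear.expansion (Automorphism.to-linear P) (A ⋆ Automorphism.to Q (δ j)) i))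

-- The block shape with corner `b`, zeros beside and below it, and all remaining entries multiples
-- of `b`.
record Reduced {m n} (h : Vector ℤ (suc n) → Vector ℤ (suc m)) (b : ℕ) : Set where
  field
    first-column : h (δ zero) ≗ + b ⊙ δ zero
    first-row : ∀ j → h (δ (suc j)) zero ≡ 0ℤ
    divides-all : ∀ i j → + b ℤ.∣ h (δ (suc j)) (suc i)

module _ {m n} {f : Vector ℤ (suc n) → Vector ℤ (suc m)} (f-linear : IsLinear f) where
  open Automorphism

  private
    transform : Automorphism (suc m) → Automorphism (suc n) → Vector ℤ (suc n) → Vector ℤ (suc m)
    transform P Q = to P ∘ f ∘ to Q

    transform-linear : ∀ P Q → IsLinear (transform P Q)
    transform-linear P Q = ∘-linear (to-linear P) (∘-linear f-linear (to-linear Q))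

    corner : Automorphism (suc m) → Automorphism (suc n) → ℤ
    corner P Q = transform P Q (δ zero) zero

    -- The successor excludes zero corners from the minimization.
    HasCorner : ℕ → Set
    HasCorner k = ∃[ P ] ∃[ Q ] ∣ corner P Q ∣ ≡ suc k

    module _ (P : Automorphism (suc m)) (Q : Automorphism (suc n)) where
      open IsLinear (transform-linear P Q)

      transform-shearʳ : ∀ v w vw≡0 x i → transform P (Q ∘ᴬ shear v w vw≡0) x i ≡ transform P Q x i + -1ℤ * dot v x * transform P Q w i
      transform-shearʳ v w _ x i = trans (f-⊕ x ((-1ℤ * dot v x) ⊙ w) i) (cong₂ _+_ {x = transform P Q x i} refl (f-⊙ (-1ℤ * dot v x) w i))

    to-corner : Fin (suc m) → Automorphism (suc m)
    to-corner i = permute (transpose zero i)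

    from-corner : Fin (suc n) → Automorphism (suc n)
    from-corner j = permute (transpose j zero)

    corner-moved : ∀ P Q i j → corner (to-corner i ∘ᴬ P) (Q ∘ᴬ from-corner j) ≡ transform P Q (δ j) i
    corner-moved P Q i j = IsLinear.f-cong (transform-linear P Q) (transpose-δ j) i

    module _ {k} (least : ∀ k′ → k′ ℕ.< k → ¬ HasCorner k′) where
      b = suc k

      -- Any entry of any transform can be swapped into the corner, so a nonzero entry smaller than
      -- `b` contradicts the choice of `b` as least.
      small⇒0 : ∀ P Q i j → ∣ transform P Q (δ j) i ∣ ℕ.< b → transform P Q (δ j) i ≡ 0ℤ
      small⇒0 P Q i j lt with ∣ transform P Q (δ j) i ∣ in eq
      ... | zero = ℤ.∣i∣≡0⇒i≡0 eq
      ... | suc k′ = contradiction (to-corner i ∘ᴬ P , Q ∘ᴬ from-corner j , trans (cong ∣_∣ (corner-moved P Q i j)) eq) (least k′ (ℕ.s≤s⁻¹ lt))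

      private
        -- The hypothesis says that the entry is the remainder of `a` modulo `b`. Being less than
        -- `b`, it vanishes.
        remainder : ∀ P Q i j a → transform P Q (δ j) i ≡ a + - (a /ℕ b) * + b → + b ℤ.∣ a
        remainder P Q i j a eq = divides (a /ℕ b) (trans a≡ (trans (cong (_+ a /ℕ b * + b) r≡0) (ℤ.+-identityˡ _)))
          where
          a≡ = a≡a%ℕn+[a/ℕn]*n a b
          cancel : ∀ r q b → r + q * b + - q * b ≡ r
          cancel = solve-∀
          entry≡r : transform P Q (δ j) i ≡ + (a %ℕ b)
          entry≡r = trans eq (trans (cong (_+ - (a /ℕ b) * + b) a≡) (cancel (+ (a %ℕ b)) (a /ℕ b) (+ b)))
          r≡0 : + (a %ℕ b) ≡ 0ℤ
          r≡0 = trans (sym entry≡r) (small⇒0 P Q i j (subst (λ z → ∣ z ∣ ℕ.< b) (sym entry≡r) (n%ℕd<d a b)))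

      row-divisible : ∀ P Q → corner P Q ≡ + b → ∀ j → + b ℤ.∣ transform P Q (δ (suc j)) zero
      row-divisible P Q c≡b j = remainder P (Q ∘ᴬ shear v (δ zero) v0) zero (suc j) a
        (trans (transform-shearʳ P Q v (δ zero) v0 (δ (suc j)) zero) (cong₂ _+_ {x = a} refl (cong₂ _*_ (trans (cong (-1ℤ *_) vj) (ℤ.-1*i≡-i q)) c≡b)))
        where
        a = transform P Q (δ (suc j)) zero
        q = a /ℕ b
        -- This shear subtracts `q` times column 0 from column `suc j`, which leaves the remainder
        -- in row 0.
        v = q ⊙ 1ᴹ (suc j)
        v0 : dot v (δ zero) ≡ 0ℤ
        v0 = trans (dot-δ v zero) (ℤ.*-zeroʳ q)
        vj : dot v (δ (suc j)) ≡ q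
        vj = trans (dot-δ v (suc j)) (trans (cong (q *_) (1ᴹ-diagonal j)) (ℤ.*-identityʳ q))

      column-divisible : ∀ P Q → corner P Q ≡ + b → ∀ i → + b ℤ.∣ transform P Q (δ zero) (suc i)
      column-divisible P Q c≡b i = remainder (shear (1ᴹ zero) w w0 ∘ᴬ P) Q (suc i) zero a
        (cong₂ _+_ {x = a} refl (trans (cong₂ _*_ (cong (-1ℤ *_) (trans (1ᴹ-⋆ (transform P Q (δ zero)) zero) c≡b)) wi) (swap (+ b) q)))
        where
        a = transform P Q (δ zero) (suc i)
        q = a /ℕ b
        -- Composed on the left, this shear subtracts `q` times row 0 from row `suc i`.
        w = q ⊙ δ (suc i)
        w0 : dot (1ᴹ zero) w ≡ 0ℤ
        w0 = trans (1ᴹ-⋆ w zero) (ℤ.*-zeroʳ q)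
        wi : w (suc i) ≡ q
        wi = trans (cong (q *_) (1ᴹ-diagonal i)) (ℤ.*-identityʳ q)
        swap : ∀ b q → -1ℤ * b * q ≡ - q * b
        swap = solve-∀

      positive-corner : ∀ P Q → ∣ corner P Q ∣ ≡ suc k → ∃[ P′ ] corner P′ Q ≡ + b
      positive-corner P Q eq with corner P Q in c
      ... | + n = P , trans c (cong +_ eq)
      ... | -[1+ n ] = scaleᴬ -1ℤ refl ∘ᴬ P , trans (cong (-1ℤ *_) c) (trans (ℤ.-1*i≡-i -[1+ n ]) (cong +_ eq))

      clear-column : ∀ P Q → corner P Q ≡ + b → ∃[ P′ ] transform P′ Q (δ zero) ≗ + b ⊙ δ zero
      clear-column P Q c≡b = shear (1ᴹ zero) w w0 ∘ᴬ P , cleared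
        where
        w : Vector ℤ (suc m)
        w = 0ℤ ∷ⱽ λ i → ℤ._∣_.quotient (column-divisible P Q c≡b i)
        w0 : dot (1ᴹ zero) w ≡ 0ℤ
        w0 = 1ᴹ-⋆ w zero
        top : dot (1ᴹ zero) (transform P Q (δ zero)) ≡ + b
        top = trans (1ᴹ-⋆ (transform P Q (δ zero)) zero) c≡b
        cancel : ∀ q b → q * b + -1ℤ * b * q ≡ b * 0ℤ
        cancel = solve-∀
        keep : ∀ b d → b + -1ℤ * d * 0ℤ ≡ b * 1ℤ
        keep = solve-∀
        cleared : transform (shear (1ᴹ zero) w w0 ∘ᴬ P) Q (δ zero) ≗ + b ⊙ δ zero
        cleared zero = trans (cong₂ _+_ {v = -1ℤ * dot (1ᴹ zero) (transform P Q (δ zero)) * 0ℤ} c≡b refl) (keep (+ b) (dot (1ᴹ zero) (transform P Q (δ zero))))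
        cleared (suc i) = trans (cong₂ (λ x d → x + -1ℤ * d * w (suc i)) (ℤ._∣_.equality (column-divisible P Q c≡b i)) top) (cancel (w (suc i)) (+ b))

      clear-row : ∀ P Q → transform P Q (δ zero) ≗ + b ⊙ δ zero → ∃[ Q′ ] transform P Q′ (δ zero) ≗ + b ⊙ δ zero × (∀ j → transform P Q′ (δ (suc j)) zero ≡ 0ℤ)
      clear-row P Q col = Q ∘ᴬ shear v (δ zero) v0 ,
        (λ i → trans (transform-shearʳ P Q v (δ zero) v0 (δ zero) i)
          (trans (cong (λ d → transform P Q (δ zero) i + -1ℤ * d * transform P Q (δ zero) i) v0) (trans (ℤ.+-identityʳ _) (col i)))) ,
        λ j → trans (transform-shearʳ P Q v (δ zero) v0 (δ (suc j)) zero)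
          (trans (cong₂ _+_ (ℤ._∣_.equality (row-divisible P Q c≡b j)) (cong₂ (λ d c → -1ℤ * d * c) (dot-δ v (suc j)) c≡b))
            (cancel (v (suc j)) (+ b)))
        where
        c≡b : corner P Q ≡ + b
        c≡b = trans (col zero) (ℤ.*-identityʳ (+ b))
        v : Vector ℤ (suc n)
        v = 0ℤ ∷ⱽ λ j → ℤ._∣_.quotient (row-divisible P Q c≡b j)
        v0 : dot v (δ zero) ≡ 0ℤ
        v0 = dot-δ v zero
        cancel : ∀ q b → q * b + -1ℤ * q * b ≡ 0ℤ
        cancel = solve-∀

      -- Adding row i to row 0 turns divisibility in the rest into divisibility in row 0.
      reduced : ∀ P Q → transform P Q (δ zero) ≗ + b ⊙ δ zero → (∀ j → transform P Q (δ (suc j)) zero ≡ 0ℤ) → Reduced (transform P Q) b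
      reduced P Q col row = record
        { first-column = col
        ; first-row = row
        ; divides-all = λ i j → subst (+ b ℤ.∣_) (moved i j) (row-divisible (P′ i) Q (corner′ i) j)
        }
        where
        v : Fin m → Vector ℤ (suc m)
        v i = -1ℤ ⊙ 1ᴹ (suc i)
        dot-v : ∀ i x → dot (v i) x ≡ -1ℤ * x (suc i)
        dot-v i x = sym (IsLinear.expansion {1} (record
          { f-cong = λ x≗y _ → cong (-1ℤ *_) (x≗y (suc i))
          ; f-⊕ = λ x y _ → ℤ.*-distribˡ-+ -1ℤ (x (suc i)) (y (suc i))
          ; f-⊙ = λ c x _ → swap c (x (suc i))
          }) x zero)
          where
          swap : ∀ c x → -1ℤ * (c * x) ≡ c * (-1ℤ * x)
          swap = solve-∀
        P′ : Fin m → Automorphism (suc m)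
        P′ i = shear (v i) (δ zero) (dot-v i (δ zero)) ∘ᴬ P
        add : ∀ i x → transform (P′ i) Q x zero ≡ transform P Q x zero + transform P Q x (suc i)
        add i x = trans (cong (λ d → transform P Q x zero + -1ℤ * d * 1ℤ) (dot-v i (transform P Q x))) (simplify (transform P Q x zero) (transform P Q x (suc i)))
          where
          simplify : ∀ x y → x + -1ℤ * (-1ℤ * y) * 1ℤ ≡ x + y
          simplify = solve-∀
        corner′ : ∀ i → corner (P′ i) Q ≡ + b
        corner′ i = trans (add i (δ zero)) (trans (cong₂ _+_ (col zero) (col (suc i))) (simplify (+ b)))
          where
          simplify : ∀ b → b * 1ℤ + b * 0ℤ ≡ b
          simplify = solve-∀
        moved : ∀ i j → transform (P′ i) Q (δ (suc j)) zero ≡ transform P Q (δ (suc j)) (suc i)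
        moved i j = trans (add i (δ (suc j))) (trans (cong (_+ transform P Q (δ (suc j)) (suc i)) (row j)) (ℤ.+-identityˡ _))

  -- The least nonzero corner over all pairs of automorphisms replaces the termination argument of
  -- the elimination algorithm. The given nonzero entry only shows that some nonzero corner exists.
  ¬¬-reduce : ∀ i j → f (δ j) i ≢ 0ℤ → ¬ ¬ (∃[ P ] ∃[ Q ] ∃[ k ] Reduced (to P ∘ f ∘ to Q) (suc k))
  ¬¬-reduce i j fji≢0 = do
    (k , (P , Q , c) , least) ← ¬¬-least HasCorner (ℕ.pred ∣ f (δ j) i ∣)
      (to-corner i ∘ᴬ idᴬ , idᴬ ∘ᴬ from-corner j , trans (cong ∣_∣ (corner-moved idᴬ idᴬ i j)) (sym (ℕ.suc-pred _ {{ℕ.≢-nonZero (fji≢0 ∘ ℤ.∣i∣≡0⇒i≡0)}})))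
    let (P₁ , c₁) = positive-corner least P Q c
        (P₂ , c₂) = clear-column least P₁ Q c₁
        (Q₃ , col , row) = clear-row least P₂ Q c₂
    return (P₂ , Q₃ , k , reduced least P₂ Q₃ col row)

rank-zero : ∀ {m n} {f : Vector ℤ n → Vector ℤ m} → (∀ i j → f (δ j) i ≡ 0ℤ) → Diagonalization f
rank-zero f≡0 = record
  { P = idᴬ ; Q = idᴬ ; rank = 0 ; rank≤m = z≤n ; rank≤n = z≤n ; e = λ () ; e-positive = λ () ; e-chain = λ ()
  ; diagonal-entry = λ _ _ () ; zero-entry = λ i j _ → f≡0 i j }

restrict : ∀ {m n} → (Vector ℤ (suc n) → Vector ℤ (suc m)) → Vector ℤ n → Vector ℤ m
restrict h x = tail (h (0ℤ ∷ⱽ x))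

restrict-linear : ∀ {m n} {h : Vector ℤ (suc n) → Vector ℤ (suc m)} → IsLinear h → IsLinear (restrict h)
restrict-linear L = record
  { f-cong = λ x≗y i → f-cong (λ { zero → refl ; (suc j) → x≗y j }) (suc i)
  ; f-⊕ = λ x y i → trans (f-cong (λ { zero → refl ; (suc j) → refl }) (suc i)) (f-⊕ (0ℤ ∷ⱽ x) (0ℤ ∷ⱽ y) (suc i))
  ; f-⊙ = λ c x i → trans (f-cong (λ { zero → sym (ℤ.*-zeroʳ c) ; (suc j) → refl }) (suc i)) (f-⊙ c (0ℤ ∷ⱽ x) (suc i))
  }
  where open IsLinear L

∣-submodule : ∀ {m n} {f : Vector ℤ n → Vector ℤ m} → IsLinear f → ∀ b i → IsSubmodule (λ x → b ℤ.∣ f x i)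
∣-submodule L b i = record
  { ≗-resp = λ x≗y → subst (b ℤ.∣_) (f-cong x≗y i)
  ; zero∈ = divides 0ℤ (f-0 i)
  ; ⊕∈ = λ {x} {y} h h′ → subst (b ℤ.∣_) (sym (f-⊕ x y i)) (∣m∣n⇒∣m+n h h′)
  ; ⊙∈ = λ c {x} h → subst (b ℤ.∣_) (sym (f-⊙ c x i)) (∣n⇒∣m*n c h)
  }
  where open IsLinear L

δ-∷ⱽ : ∀ {n} (j : Fin n) → 0ℤ ∷ⱽ δ j ≗ δ (suc j)
δ-∷ⱽ j zero    = refl
δ-∷ⱽ j (suc i) = refl

module _ {m n} {f : Vector ℤ (suc n) → Vector ℤ (suc m)} (f-linear : IsLinear f)
  (P : Automorphism (suc m)) (Q : Automorphism (suc n)) {k} (R : Reduced (Automorphism.to P ∘ f ∘ Automorphism.to Q) (suc k)) where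
  open Automorphism
  open Reduced R

  private
    h : Vector ℤ (suc n) → Vector ℤ (suc m)
    h = to P ∘ f ∘ to Q

    h-linear : IsLinear h
    h-linear = ∘-linear (to-linear P) (∘-linear f-linear (to-linear Q))

    restrict-divisible : ∀ i x → + suc k ℤ.∣ restrict h x i
    restrict-divisible i = IsSubmodule.δ-generate (∣-submodule (restrict-linear h-linear) (+ suc k) i)
      λ j → subst (+ suc k ℤ.∣_) (sym (IsLinear.f-cong h-linear (δ-∷ⱽ j) (suc i))) (divides-all i j)

    top-zero : ∀ x → h (0ℤ ∷ⱽ x) zero ≡ 0ℤ
    top-zero x = trans (IsLinear.expansion h-linear (0ℤ ∷ⱽ x) zero)
      (sum-zero {f = λ j → h (δ j) zero * (0ℤ ∷ⱽ x) j} λ { zero → ℤ.*-zeroʳ (h (δ zero) zero) ; (suc j) → trans (cong (_* x j) (first-row j)) (ℤ.*-zeroˡ (x j)) })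

  extend-diagonalization : Diagonalization (restrict h) → Diagonalization f
  extend-diagonalization D = record
    { P = lift D.P ∘ᴬ P
    ; Q = Q ∘ᴬ lift D.Q
    ; rank = suc D.rank
    ; rank≤m = s≤s D.rank≤m
    ; rank≤n = s≤s D.rank≤n
    ; e = e
    ; e-positive = λ { zero → s≤s z≤n ; (suc s) → D.e-positive s }
    ; e-chain = e-chain
    ; diagonal-entry = diagonal
    ; zero-entry = off-diagonal
    }
    where
    module D = Diagonalization D

    e : Fin (suc D.rank) → ℕ
    e zero    = suc k
    e (suc s) = D.e s

    -- Every value of `restrict h` is a multiple of the corner, and applying a linear map preserves
    -- this, so the corner divides the whole diagonalized block.
    first∣ : ∀ s → suc k ∣ D.e s
    first∣ s = ∣⇒∣ᵤ (subst (+ suc k ℤ.∣_) (D.diagonal-entry i j s (Fin.toℕ-fromℕ< _) (Fin.toℕ-fromℕ< _)) entry-divisible)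
      where
      i = fromℕ< (ℕ.<-≤-trans (Fin.toℕ<n s) D.rank≤m)
      j = fromℕ< (ℕ.<-≤-trans (Fin.toℕ<n s) D.rank≤n)
      x = to D.Q (δ j)
      q : Vector ℤ m
      q t = ℤ._∣_.quotient (restrict-divisible t x)
      entry-divisible : + suc k ℤ.∣ D.entry i j
      entry-divisible = divides (to D.P q i) (trans
        (IsLinear.f-cong (to-linear D.P) (λ t → trans (ℤ._∣_.equality (restrict-divisible t x)) (ℤ.*-comm (q t) (+ suc k))) i)
        (trans (IsLinear.f-⊙ (to-linear D.P) (+ suc k) q i) (ℤ.*-comm (+ suc k) (to D.P q i))))

    e-chain : ∀ s t → s Fin.≤ t → e s ∣ e t
    e-chain zero zero _ = ∣⇒∣ᵤ (divides {+ suc k} {+ suc k} 1ℤ (sym (ℤ.*-identityˡ (+ suc k))))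
    e-chain zero (suc t) _ = first∣ t
    e-chain (suc s) (suc t) (s≤s s≤t) = D.e-chain s t s≤t

    entry : Fin (suc m) → Fin (suc n) → ℤ
    entry i j = to (lift D.P) (h (to (lift D.Q) (δ j))) i

    lift-δ-zero : to (lift D.Q) (δ zero) ≗ δ zero
    lift-δ-zero zero = refl
    lift-δ-zero (suc j) = IsLinear.f-0 (to-linear D.Q) j

    column-zero : ∀ i → h (to (lift D.Q) (δ zero)) i ≡ + suc k * δ zero i
    column-zero i = trans (IsLinear.f-cong h-linear lift-δ-zero i) (first-column i)

    lift-δ-suc : ∀ j → to (lift D.Q) (δ (suc j)) ≗ 0ℤ ∷ⱽ to D.Q (δ j)
    lift-δ-suc j zero    = refl
    lift-δ-suc j (suc i) = refl

    entry-zero-zero : entry zero zero ≡ + suc k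
    entry-zero-zero = trans (column-zero zero) (ℤ.*-identityʳ (+ suc k))

    entry-suc-zero : ∀ i → entry (suc i) zero ≡ 0ℤ
    entry-suc-zero i = trans (IsLinear.f-cong (to-linear D.P) (λ t → trans (column-zero (suc t)) (ℤ.*-zeroʳ (+ suc k))) i) (IsLinear.f-0 (to-linear D.P) i)

    entry-zero-suc : ∀ j → entry zero (suc j) ≡ 0ℤ
    entry-zero-suc j = trans (IsLinear.f-cong h-linear (lift-δ-suc j) zero) (top-zero (to D.Q (δ j)))

    entry-suc-suc : ∀ i j → entry (suc i) (suc j) ≡ D.entry i j
    entry-suc-suc i j = IsLinear.f-cong (to-linear D.P) (λ t → IsLinear.f-cong h-linear (lift-δ-suc j) (suc t)) i

    diagonal : ∀ i j (s : Fin (suc D.rank)) → toℕ i ≡ toℕ s → toℕ j ≡ toℕ s → entry i j ≡ + e s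
    diagonal zero zero zero _ _ = entry-zero-zero
    diagonal (suc i) (suc j) (suc s) i≡s j≡s = trans (entry-suc-suc i j) (D.diagonal-entry i j s (ℕ.suc-injective i≡s) (ℕ.suc-injective j≡s))

    off-diagonal : ∀ i j → (∀ (s : Fin (suc D.rank)) → ¬ (toℕ i ≡ toℕ s × toℕ j ≡ toℕ s)) → entry i j ≡ 0ℤ
    off-diagonal zero zero ≢s = contradiction (refl , refl) (≢s zero)
    off-diagonal zero (suc j) _ = entry-zero-suc j
    off-diagonal (suc i) zero _ = entry-suc-zero i
    off-diagonal (suc i) (suc j) ≢s = trans (entry-suc-suc i j) (D.zero-entry i j λ s (i≡s , j≡s) → ≢s (suc s) (cong suc i≡s , cong suc j≡s))

¬¬-diagonalization : ∀ {m n} {f : Vector ℤ n → Vector ℤ m} → IsLinear f → ¬ ¬ Diagonalization f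
¬¬-diagonalization {zero} f-linear = return (rank-zero λ ())
¬¬-diagonalization {suc m} {zero} f-linear = return (rank-zero λ _ ())
¬¬-diagonalization {suc m} {suc n} {f} f-linear = do
  nonzero? ← ¬¬-excluded-middle {A = ∃[ i ] ∃[ j ] f (δ j) i ≢ 0ℤ}
  case-nonzero nonzero?
  where
  case-nonzero : Dec (∃[ i ] ∃[ j ] f (δ j) i ≢ 0ℤ) → ¬ ¬ Diagonalization f
  case-nonzero (no all-zero) = return (rank-zero λ i j → decidable-stable (f (δ j) i ℤ.≟ 0ℤ) λ ≢0 → all-zero (i , j , ≢0))
  case-nonzero (yes (i , j , ≢0)) = do
    (P , Q , k , R) ← ¬¬-reduce f-linear i j ≢0
    D ← ¬¬-diagonalization (restrict-linear (∘-linear (Automorphism.to-linear P) (∘-linear f-linear (Automorphism.to-linear Q))))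
    return (extend-diagonalization f-linear P Q R D)

¬¬-smithNormalForm : ∀ {m n} (A : Matrix m n) → ¬ ¬ SmithNormalForm A
¬¬-smithNormalForm A = do
  D ← ¬¬-diagonalization (⋆-linear A)
  return (diagonalization⇒SNF D)

-- Torsion and kernels from the Smith normal form

Image : ∀ {m n} → Matrix m n → Pred (Vector ℤ m) 0ℓ
Image A y = ∃[ x ] A ⋆ x ≗ y

Image-submodule : ∀ {m n} (A : Matrix m n) → IsSubmodule (Image A)
Image-submodule A = record
  { ≗-resp = λ y≗z (x , Ax≗y) → x , λ i → trans (Ax≗y i) (y≗z i)
  ; zero∈ = 0ⱽ , ⋆-0 A
  ; ⊕∈ = λ (x , hx) (y , hy) → x ⊕ y , λ i → trans (⋆-⊕ A x y i) (cong₂ _+_ (hx i) (hy i))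
  ; ⊙∈ = λ c (x , hx) → c ⊙ x , λ i → trans (⋆-⊙ A c x i) (cong (c *_) (hx i))
  }

⋆-inverse : ∀ {n} (A B : Matrix n n) → (∀ i j → (A ⊗ B) i j ≡ 1ᴹ i j) → ∀ x → A ⋆ B ⋆ x ≗ x
⋆-inverse A B AB≡1 x i = trans (sym (⊗-⋆ A B x i)) (trans (⋆-congˡ AB≡1 x i) (1ᴹ-⋆ x i))

*-cancelˡ-0 : ∀ {a b} → a ≢ 0ℤ → a * b ≡ 0ℤ → b ≡ 0ℤ
*-cancelˡ-0 {a} a≢0 ab≡0 with ℤ.i*j≡0⇒i≡0∨j≡0 a ab≡0
... | inj₁ a≡0 = contradiction a≡0 a≢0
... | inj₂ b≡0 = b≡0

∣-sum : ∀ {n b} {f : Vector ℤ n} → (∀ t → b ℤ.∣ f t) → b ℤ.∣ sumℤ f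
∣-sum {zero}  b∣f = divides 0ℤ refl
∣-sum {suc n} b∣f = ∣m∣n⇒∣m+n (b∣f zero) (∣-sum (b∣f ∘ suc))

∣-⋆ : ∀ {m n b} (A : Matrix m n) x → (∀ j → b ℤ.∣ x j) → ∀ i → b ℤ.∣ (A ⋆ x) i
∣-⋆ A x b∣x i = ∣-sum λ j → ∣n⇒∣m*n (A i j) (b∣x j)

prime-∣-* : ∀ {p} → Prime p → ∀ a {b} → + p ℤ.∣ a * b → (+ p ℤ.∣ a) ⊎ (+ p ℤ.∣ b)
prime-∣-* {p} p-prime a {b} p∣ab with euclidsLemma ∣ a ∣ ∣ b ∣ p-prime (subst (p ∣_) (ℤ.abs-* a b) (∣⇒∣ᵤ p∣ab))
... | inj₁ p∣a = inj₁ (∣ᵤ⇒∣ p∣a)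
... | inj₂ p∣b = inj₂ (∣ᵤ⇒∣ p∣b)

module SNF {m n} {A : Matrix m n} (S : SmithNormalForm A) where
  open SmithNormalForm S public

  private
    U⁻¹ : Matrix m m
    U⁻¹ = proj₁ U-unimodular

    V⁻¹ : Matrix n n
    V⁻¹ = proj₁ V-unimodular

    U-U⁻¹ : ∀ x → U ⋆ U⁻¹ ⋆ x ≗ x
    U-U⁻¹ = ⋆-inverse U U⁻¹ (proj₁ (proj₂ U-unimodular))

    U⁻¹-U : ∀ x → U⁻¹ ⋆ U ⋆ x ≗ x
    U⁻¹-U = ⋆-inverse U⁻¹ U (proj₂ (proj₂ U-unimodular))

    V-V⁻¹ : ∀ x → V ⋆ V⁻¹ ⋆ x ≗ x
    V-V⁻¹ = ⋆-inverse V V⁻¹ (proj₁ (proj₂ V-unimodular))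

    V⁻¹-V : ∀ x → V⁻¹ ⋆ V ⋆ x ≗ x
    V⁻¹-V = ⋆-inverse V⁻¹ V (proj₂ (proj₂ V-unimodular))

    D : Matrix m n
    D = U ⊗ A ⊗ V

    row : Fin rank → Fin m
    row s = fromℕ< (ℕ.<-≤-trans (Fin.toℕ<n s) rank≤m)

    column : Fin rank → Fin n
    column s = fromℕ< (ℕ.<-≤-trans (Fin.toℕ<n s) rank≤n)

    toℕ-row : ∀ s → toℕ (row s) ≡ toℕ s
    toℕ-row s = Fin.toℕ-fromℕ< _

    toℕ-column : ∀ s → toℕ (column s) ≡ toℕ s
    toℕ-column s = Fin.toℕ-fromℕ< _

    D-⋆ : ∀ x → U ⋆ A ⋆ V ⋆ x ≗ D ⋆ x
    D-⋆ x i = trans (sym (⊗-⋆ U A (V ⋆ x) i)) (sym (⊗-⋆ (U ⊗ A) V x i))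

    D-diagonal : ∀ {i j s} → toℕ i ≡ toℕ s → toℕ j ≡ toℕ s → ∀ x → (D ⋆ x) i ≡ + e s * x j
    D-diagonal {i} {j} {s} i≡s j≡s x = trans
      (sum-single _ j λ j′ j′≢j → trans
        (cong (_* x j′) (zero-entry i j′ λ s′ (i≡s′ , j′≡s′) → j′≢j (Fin.toℕ-injective (trans j′≡s′ (trans (sym i≡s′) (trans i≡s (sym j≡s)))))))
        (ℤ.*-zeroˡ (x j′)))
      (cong (_* x j) (diagonal-entry i j s i≡s j≡s))

    D-zero : ∀ {i} → (∀ s → toℕ i ≢ toℕ s) → ∀ x → (D ⋆ x) i ≡ 0ℤ
    D-zero {i} i≢ x = sum-zero λ j → trans (cong (_* x j) (zero-entry i j λ s (i≡s , _) → i≢ s i≡s)) (ℤ.*-zeroˡ (x j))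

    U-A : ∀ x → U ⋆ A ⋆ x ≗ D ⋆ V⁻¹ ⋆ x
    U-A x i = trans (⋆-cong U (⋆-cong A (λ j → sym (V-V⁻¹ x j))) i) (D-⋆ (V⁻¹ ⋆ x) i)

    A-V : ∀ x → A ⋆ V ⋆ x ≗ U⁻¹ ⋆ D ⋆ x
    A-V x i = trans (sym (U⁻¹-U (A ⋆ V ⋆ x) i)) (⋆-cong U⁻¹ (D-⋆ x) i)

    U-image : ∀ {y x} → A ⋆ x ≗ y → U ⋆ y ≗ D ⋆ V⁻¹ ⋆ x
    U-image {x = x} Ax≗y i = trans (⋆-cong U (λ j → sym (Ax≗y j)) i) (U-A x i)

  -- A vector whose class modulo the image has order exactly `e s`: it is a standard vector in the
  -- coordinates in which `A` is diagonal. The next two lemmas give the two halves of this.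
  torsion : Fin rank → Vector ℤ m
  torsion s = U⁻¹ ⋆ δ (row s)

  torsion-multiple∈ : ∀ s → Image A (+ e s ⊙ torsion s)
  torsion-multiple∈ s = V ⋆ δ (column s) , λ i → trans (A-V (δ (column s)) i)
    (trans (⋆-cong U⁻¹ col i) (⋆-⊙ U⁻¹ (+ e s) (δ (row s)) i))
    where
    col : D ⋆ δ (column s) ≗ + e s ⊙ δ (row s)
    col i with i Fin.≟ row s
    ... | yes refl = trans (D-diagonal (toℕ-row s) (toℕ-column s) (δ (column s))) (cong (+ e s *_) (1ᴹ-diagonal (column s)))
    ... | no i≢row = trans (⋆-δ D (column s) i)
      (trans (zero-entry i (column s) λ s′ (i≡s′ , j≡s′) → i≢row (Fin.toℕ-injective (trans i≡s′ (trans (sym j≡s′) (trans (toℕ-column s) (sym (toℕ-row s)))))))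
        (sym (ℤ.*-zeroʳ (+ e s))))

  torsion-order : ∀ s N → Image A (N ⊙ torsion s) → + e s ℤ.∣ N
  torsion-order s N (x , Ax≗Ny) = divides ((V⁻¹ ⋆ x) (column s)) (begin
    N                                         ≡⟨ ℤ.*-identityʳ N ⟨
    N * 1ℤ                                    ≡⟨ cong (N *_) (1ᴹ-diagonal (row s)) ⟨
    N * δ (row s) (row s)                     ≡⟨ cong (N *_) (U-U⁻¹ (δ (row s)) (row s)) ⟨
    N * (U ⋆ torsion s) (row s)               ≡⟨ ⋆-⊙ U N (torsion s) (row s) ⟨
    (U ⋆ N ⊙ torsion s) (row s)               ≡⟨ U-image Ax≗Ny (row s) ⟩
    (D ⋆ V⁻¹ ⋆ x) (row s)                     ≡⟨ D-diagonal (toℕ-row s) (toℕ-column s) (V⁻¹ ⋆ x) ⟩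
    + e s * (V⁻¹ ⋆ x) (column s)              ≡⟨ ℤ.*-comm (+ e s) _ ⟩
    (V⁻¹ ⋆ x) (column s) * + e s              ∎)
    where open ≡-Reasoning

  private
    -- Solves the diagonal system D x = d (U y) coordinate by coordinate: below the rank, `e s`
    -- divides `d`; beyond it, both sides vanish.
    exponent-kills : ∀ d → (∀ s → + e s ℤ.∣ d) → ∀ y → (∀ i → (∀ s → toℕ i ≢ toℕ s) → (U ⋆ y) i ≡ 0ℤ) → Image A (d ⊙ y)
    exponent-kills d e∣d y above≡0 = V ⋆ x , λ i → begin
      (A ⋆ V ⋆ x) i             ≡⟨ A-V x i ⟩
      (U⁻¹ ⋆ D ⋆ x) i           ≡⟨ ⋆-cong U⁻¹ D-x i ⟩
      (U⁻¹ ⋆ d ⊙ (U ⋆ y)) i     ≡⟨ ⋆-⊙ U⁻¹ d (U ⋆ y) i ⟩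
      d * (U⁻¹ ⋆ U ⋆ y) i       ≡⟨ cong (d *_) (U⁻¹-U y i) ⟩
      d * y i                   ∎
      where
      open ≡-Reasoning
      coordinate : ∀ {k} → Dec (k ℕ.< rank) → ℤ
      coordinate (yes k<r) = ℤ._∣_.quotient (e∣d (fromℕ< k<r)) * (U ⋆ y) (row (fromℕ< k<r))
      coordinate (no _)    = 0ℤ
      x : Vector ℤ n
      x j = coordinate (toℕ j ℕ.<? rank)
      x-column : ∀ {j s} → toℕ j ≡ toℕ s → x j ≡ ℤ._∣_.quotient (e∣d s) * (U ⋆ y) (row s)
      x-column {j} {s} j≡s with toℕ j ℕ.<? rank
      ... | yes j<r = cong (λ t → ℤ._∣_.quotient (e∣d t) * (U ⋆ y) (row t)) (Fin.toℕ-injective (trans (Fin.toℕ-fromℕ< j<r) j≡s))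
      ... | no j≮r = contradiction (subst (ℕ._< rank) (sym j≡s) (Fin.toℕ<n s)) j≮r
      swap : ∀ a q u → a * (q * u) ≡ q * a * u
      swap = solve-∀
      D-x : D ⋆ x ≗ d ⊙ (U ⋆ y)
      D-x i with toℕ i ℕ.<? rank
      ... | yes i<r = begin
        (D ⋆ x) i                                                 ≡⟨ D-diagonal (sym (Fin.toℕ-fromℕ< i<r)) (toℕ-column s) x ⟩
        + e s * x (column s)                                      ≡⟨ cong (+ e s *_) (x-column (toℕ-column s)) ⟩
        + e s * (ℤ._∣_.quotient (e∣d s) * (U ⋆ y) (row s))           ≡⟨ swap (+ e s) (ℤ._∣_.quotient (e∣d s)) ((U ⋆ y) (row s)) ⟩
        ℤ._∣_.quotient (e∣d s) * + e s * (U ⋆ y) (row s)             ≡⟨ cong₂ _*_ (sym (ℤ._∣_.equality (e∣d s))) (cong (U ⋆ y) (Fin.toℕ-injective (trans (toℕ-row s) (Fin.toℕ-fromℕ< i<r)))) ⟩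
        d * (U ⋆ y) i                                             ∎
        where s = fromℕ< i<r
      ... | no i≮r = trans (D-zero i≢ x) (sym (trans (cong (d *_) (above≡0 i i≢)) (ℤ.*-zeroʳ d)))
        where
        i≢ : ∀ s → toℕ i ≢ toℕ s
        i≢ s i≡s = i≮r (subst (ℕ._< rank) (sym i≡s) (Fin.toℕ<n s))

  -- If `N ⊙ y` is in the image, U (N y) vanishes in the rows beyond the rank, and the nonzero `N`
  -- cancels.
  torsion-exponent : ∀ d → (∀ s → + e s ℤ.∣ d) → ∀ {N y} → N ≢ 0ℤ → Image A (N ⊙ y) → Image A (d ⊙ y)
  torsion-exponent d e∣d {N} {y} N≢0 (x , Ax≗Ny) = exponent-kills d e∣d y λ i i≢ →
    *-cancelˡ-0 N≢0 (trans (sym (⋆-⊙ U N y i)) (trans (U-image Ax≗Ny i) (D-zero i≢ (V⁻¹ ⋆ x))))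

  full-rank-exponent : rank ≡ m → ∀ d → (∀ s → + e s ℤ.∣ d) → ∀ y → Image A (d ⊙ y)
  full-rank-exponent rank≡m d e∣d y = exponent-kills d e∣d y λ i i≢ →
    contradiction (sym (Fin.toℕ-fromℕ< (subst (toℕ i ℕ.<_) (sym rank≡m) (Fin.toℕ<n i)))) (i≢ _)

  -- If the rank were smaller than `m`, the row of `U` with index `rank` would annihilate `A` and
  -- hence be zero, which an invertible matrix does not allow.
  left-kernel⇒rank≡m : (∀ u → (∀ j → sumℤ (λ i → u i * A i j) ≡ 0ℤ) → u ≗ 0ⱽ) → rank ≡ m
  left-kernel⇒rank≡m kernel≡0 = ℕ.≤∧≮⇒≡ rank≤m λ r<m →
    let i = fromℕ< r<m
        i≢ : ∀ s → toℕ i ≢ toℕ s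
        i≢ s i≡s = ℕ.<⇒≢ (Fin.toℕ<n s) (trans (sym i≡s) (Fin.toℕ-fromℕ< r<m))
        U-i≡0 : U i ≗ 0ⱽ
        U-i≡0 = kernel≡0 (U i) λ j → trans (sym (trans (sym (⊗-⋆ U A (δ j) i)) (⋆-δ (U ⊗ A) j i)))
          (trans (U-A (δ j) i) (D-zero i≢ (V⁻¹ ⋆ δ j)))
    in 1≢0 (trans (sym (1ᴹ-diagonal i)) (trans (sym (proj₁ (proj₂ U-unimodular) i i))
         (sum-zero λ t → trans (cong (_* U⁻¹ t i) (U-i≡0 t)) (ℤ.*-zeroˡ (U⁻¹ t i)))))
    where
    1≢0 : 1ℤ ≢ 0ℤ
    1≢0 ()

  right-kernel⇒rank≡n : (∀ x → A ⋆ x ≗ 0ⱽ → x ≗ 0ⱽ) → rank ≡ n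
  right-kernel⇒rank≡n kernel≡0 = ℕ.≤∧≮⇒≡ rank≤n λ r<n →
    let j = fromℕ< r<n
        D-j≡0 : D ⋆ δ j ≗ 0ⱽ
        D-j≡0 i = trans (⋆-δ D j i) (zero-entry i j λ s (_ , j≡s) → ℕ.<⇒≢ (Fin.toℕ<n s) (trans (sym j≡s) (Fin.toℕ-fromℕ< r<n)))
        V-j≡0 : V ⋆ δ j ≗ 0ⱽ
        V-j≡0 = kernel≡0 (V ⋆ δ j) λ i → trans (A-V (δ j) i) (trans (⋆-cong U⁻¹ D-j≡0 i) (⋆-0 U⁻¹ i))
    in 1≢0 (trans (sym (1ᴹ-diagonal j)) (trans (sym (V⁻¹-V (δ j) j)) (trans (⋆-cong V⁻¹ V-j≡0 j) (⋆-0 V⁻¹ j))))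
    where
    1≢0 : 1ℤ ≢ 0ℤ
    1≢0 ()

  -- Full column rank with all invariant factors prime to `p` makes `A` injective mod `p`, as is
  -- visible in the diagonal form.
  mod-p-kernel : ∀ {p} → Prime p → rank ≡ n → (∀ s → ¬ p ∣ e s) → ∀ x → (∀ i → + p ℤ.∣ (A ⋆ x) i) → ∀ j → + p ℤ.∣ x j
  mod-p-kernel {p} p-prime rank≡n p∤e x p∣Ax j = subst (+ p ℤ.∣_) (V-V⁻¹ x j) (∣-⋆ V (V⁻¹ ⋆ x) divisible j)
    where
    divisible : ∀ t → + p ℤ.∣ (V⁻¹ ⋆ x) t
    divisible t with prime-∣-* p-prime (+ e s) (subst (+ p ℤ.∣_) (trans (U-A x (row s)) (D-diagonal (toℕ-row s) (sym (Fin.toℕ-fromℕ< t<r)) (V⁻¹ ⋆ x))) (∣-⋆ U (A ⋆ x) p∣Ax (row s)))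
      where
      t<r = subst (toℕ t ℕ.<_) (sym rank≡n) (Fin.toℕ<n t)
      s = fromℕ< t<r
    ... | inj₁ p∣e = contradiction (∣⇒∣ᵤ p∣e) (p∤e _)
    ... | inj₂ p∣zt = p∣zt

  e∣last : ∀ {s} → suc (toℕ s) ≡ rank → ∀ t → e t ∣ e s
  e∣last {s} s-last t = e-chain t s (ℕ.s≤s⁻¹ (subst (toℕ t ℕ.<_) (sym s-last) (Fin.toℕ<n t)))

-- Both numbers are the exponent of the torsion modulo the image: a torsion vector of order `d`
-- taken from one form is killed by the last factor `d′` of the other. Exchanging the roles gives
-- the converse divisibility.
last-unique : ∀ {m n} {A : Matrix m n} {d d′} → IsLastInvariantFactor A d → IsLastInvariantFactor A d′ → d ∣ d′
last-unique {A = A} (S , s , s-last , refl) (S′ , s′ , s′-last , refl) = ∣⇒∣ᵤ (S.torsion-order s (+ S′.e s′)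
  (S′.torsion-exponent (+ S′.e s′) (λ t → ∣ᵤ⇒∣ (S′.e∣last s′-last t)) (positive⇒≢0 (S.e-positive s)) (S.torsion-multiple∈ s)))
  where
  module S = SNF S
  module S′ = SNF S′
  positive⇒≢0 : ∀ {k} → 0 ℕ.< k → + k ≢ 0ℤ
  positive⇒≢0 0<k refl = ℕ.n≮n 0 0<k

infix 4 _≼_

_≼_ : ∀ {k} → Vec ℕ k → Vec ℕ k → Set
_≼_ = Pointwise ℕ._≤_

-- Dickson's lemma.
¬¬-finite-basis : ∀ {k} (P : Pred (Vec ℕ k) 0ℓ) → ¬ ¬ (∃[ ss ] All P ss × (∀ t → P t → ¬ ¬ Any (_≼ t) ss))
¬¬-finite-basis {zero} P = do
  P[]? ← ¬¬-excluded-middle {A = P []}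
  return (basis P[]?)
  where
  basis : Dec (P []) → ∃[ ss ] All P ss × (∀ t → P t → ¬ ¬ Any (_≼ t) ss)
  basis (yes P[]) = [] ∷ [] , P[] ∷ [] , λ { [] _ → return (here []) }
  basis (no ¬P[]) = [] , [] , λ { [] P[] → contradiction P[] ¬P[] }
¬¬-finite-basis {suc k} P = do
  (ts , P-ts , cover) ← ¬¬-finite-basis (λ t → ∃[ n ] P (n ∷ t))
  let (N , ss , P-ss , above) = heights ts P-ts
  (us , P-us , below) ← slices N
  return (ss ++ us , All.++⁺ P-ss P-us , λ { (n ∷ t) Pnt → combine N ss us cover above below n t Pnt (n ℕ.<? N) })
  where
  -- `N` is the largest of the chosen first coordinates over the finite basis of tails. From height
  -- `N` on, comparing tails is enough.
  heights : ∀ ts → All (λ t → ∃[ n ] P (n ∷ t)) ts →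
    ∃[ N ] ∃[ ss ] All P ss × (∀ n t → N ℕ.≤ n → Any (_≼ t) ts → Any (_≼ n ∷ t) ss)
  heights [] [] = 0 , [] , [] , λ _ _ _ ()
  heights (t ∷ ts) ((n , Pnt) ∷ P-ts) =
    let (N , ss , P-ss , above) = heights ts P-ts in
    n ℕ.⊔ N , (n ∷ t) ∷ ss , Pnt ∷ P-ss , λ
      { m u N≤m (here t≼u) → here (ℕ.≤-trans (ℕ.m≤m⊔n n N) N≤m ∷ t≼u)
      ; m u N≤m (there ≼u) → there (above m u (ℕ.≤-trans (ℕ.m≤n⊔m n N) N≤m) ≼u) }

  -- Below `N` there are finitely many first coordinates, and each slice has a finite basis by the
  -- induction on `k`.
  slices : ∀ N → ¬ ¬ (∃[ us ] All P us × (∀ n t → n ℕ.< N → P (n ∷ t) → ¬ ¬ Any (_≼ n ∷ t) us))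
  slices zero = return ([] , [] , λ _ _ ())
  slices (suc N) = do
    (us , P-us , below) ← slices N
    (ts , P-ts , cover) ← ¬¬-finite-basis (λ t → P (N ∷ t))
    return (us ++ List.map (N ∷_) ts , All.++⁺ P-us (All.map⁺ P-ts) , λ n t n<1+N Pnt → slice us ts below cover n t (ℕ.m≤n⇒m<n∨m≡n (ℕ.s≤s⁻¹ n<1+N)) Pnt)
    where
    slice : ∀ us ts → (∀ n t → n ℕ.< N → P (n ∷ t) → ¬ ¬ Any (_≼ n ∷ t) us) → (∀ t → P (N ∷ t) → ¬ ¬ Any (_≼ t) ts) →
      ∀ n t → n ℕ.< N ⊎ n ≡ N → P (n ∷ t) → ¬ ¬ Any (_≼ n ∷ t) (us ++ List.map (N ∷_) ts)
    slice us ts below cover n t (inj₁ n<N) Pnt = do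
      ≼t ← below n t n<N Pnt
      return (Any.++⁺ˡ ≼t)
    slice us ts below cover n t (inj₂ refl) Pnt = do
      ≼t ← cover t Pnt
      return (Any.++⁺ʳ us (Any.map⁺ (Any.map (ℕ.≤-refl ∷_) ≼t)))

  combine : ∀ N ss us {ts} → (∀ t → ∃[ n ] P (n ∷ t) → ¬ ¬ Any (_≼ t) ts) → (∀ n t → N ℕ.≤ n → Any (_≼ t) ts → Any (_≼ n ∷ t) ss) →
    (∀ n t → n ℕ.< N → P (n ∷ t) → ¬ ¬ Any (_≼ n ∷ t) us) → ∀ n t → P (n ∷ t) → Dec (n ℕ.< N) → ¬ ¬ Any (_≼ n ∷ t) (ss ++ us)
  combine N ss us cover above below n t Pnt (yes n<N) = do
    ≼t ← below n t n<N Pnt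
    return (Any.++⁺ʳ ss ≼t)
  combine N ss us cover above below n t Pnt (no n≮N) = do
    ≼t ← cover t (n , Pnt)
    return (Any.++⁺ˡ (above n t (ℕ.≮⇒≥ n≮N) ≼t))

-- Power products, polynomials and ideals.

∙-assoc : ∀ {l} (s t u : PP l) → (s ∙ t) ∙ u ≡ s ∙ (t ∙ u)
∙-assoc = Vec.zipWith-assoc ℕ.+-assoc

∙-comm : ∀ {l} (s t : PP l) → s ∙ t ≡ t ∙ s
∙-comm = Vec.zipWith-comm ℕ.+-comm

∙-identityˡ : ∀ {l} (t : PP l) → 𝟙 ∙ t ≡ t
∙-identityˡ = Vec.zipWith-identityˡ ℕ.+-identityˡ

∙-cancelˡ : ∀ {l} (s : PP l) {t u} → s ∙ t ≡ s ∙ u → t ≡ u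
∙-cancelˡ [] {[]} {[]} _ = refl
∙-cancelˡ (a ∷ s) {b ∷ t} {c ∷ u} eq with Vec.∷-injective eq
... | a+b≡a+c , st≡su = cong₂ _∷_ (ℕ.+-cancelˡ-≡ a b c a+b≡a+c) (∙-cancelˡ s st≡su)

≼⇒∙ : ∀ {l} {s t : PP l} → s ≼ t → ∃[ u ] t ≡ u ∙ s
≼⇒∙ [] = [] , refl
≼⇒∙ (a≤b ∷ s≼t) with ≼⇒∙ s≼t
... | u , t≡us = _ ∷ u , cong₂ _∷_ (sym (ℕ.m∸n+n≡m a≤b)) t≡us

divisor? : ∀ {l} (s t : PP l) → Dec (∃[ u ] t ≡ s ∙ u)
divisor? [] [] = yes ([] , refl)
divisor? (a ∷ s) (b ∷ t) with a ℕ.≤? b | divisor? s t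
... | yes a≤b | yes (u , t≡su) = yes (b ℕ.∸ a ∷ u , cong₂ _∷_ (sym (ℕ.m+[n∸m]≡n a≤b)) t≡su)
... | no a≰b  | _ = no λ { (c ∷ _ , refl) → a≰b (ℕ.m≤m+n a c) }
... | yes _   | no ∤t = no λ { (_ ∷ u , eq) → ∤t (u , proj₂ (Vec.∷-injective eq)) }

module _ {l : ℕ} where

  shift : Monomial l → Poly l → Poly l
  shift m = List.map (m ·_)

  coeff-++ : ∀ (f g : Poly l) t → coeff (f ++ g) t ≡ coeff f t + coeff g t
  coeff-++ [] g t = sym (ℤ.+-identityˡ (coeff g t))
  coeff-++ ((c , s) ∷ f) g t with s ≟ᴾᴾ t
  ... | yes _ = trans (cong₂ _+_ {x = c} refl (coeff-++ f g t)) (sym (ℤ.+-assoc c (coeff f t) (coeff g t)))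
  ... | no _  = trans (cong₂ _+_ {x = 0ℤ} refl (coeff-++ f g t)) (sym (ℤ.+-assoc 0ℤ (coeff f t) (coeff g t)))

  coeff-shift : ∀ a s f t → coeff (shift (a , s) f) (s ∙ t) ≡ a * coeff f t
  coeff-shift a s [] t = sym (ℤ.*-zeroʳ a)
  coeff-shift a s ((c , u) ∷ f) t with s ∙ u ≟ᴾᴾ s ∙ t | u ≟ᴾᴾ t
  ... | yes _ | yes _ = trans (cong₂ _+_ {x = a * c} refl (coeff-shift a s f t)) (sym (ℤ.*-distribˡ-+ a c (coeff f t)))
  ... | no _ | no _ = trans (cong₂ _+_ {x = 0ℤ} refl (coeff-shift a s f t)) (trans (ℤ.+-identityˡ _) (cong (a *_) (sym (ℤ.+-identityˡ (coeff f t)))))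
  ... | yes su≡st | no u≢t = contradiction (∙-cancelˡ s su≡st) u≢t
  ... | no su≢st | yes refl = contradiction refl su≢st

  coeff-shift-zero : ∀ a s f t → ¬ (∃[ u ] t ≡ s ∙ u) → coeff (shift (a , s) f) t ≡ 0ℤ
  coeff-shift-zero a s [] t s∤t = refl
  coeff-shift-zero a s ((c , u) ∷ f) t s∤t with s ∙ u ≟ᴾᴾ t
  ... | yes su≡t = contradiction (u , sym su≡t) s∤t
  ... | no _ = trans (ℤ.+-identityˡ _) (coeff-shift-zero a s f t s∤t)

  coeff-scale : ∀ a f t → coeff (shift (a , 𝟙) f) t ≡ a * coeff f t
  coeff-scale a f t = trans (cong (coeff (shift (a , 𝟙) f)) (sym (∙-identityˡ t))) (coeff-shift a 𝟙 f t)

  shift-cong : ∀ m f g → f ≈ g → shift m f ≈ shift m g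
  shift-cong (a , s) f g f≈g t with divisor? s t
  ... | yes (u , refl) = trans (coeff-shift a s f u) (trans (cong (a *_) (f≈g u)) (sym (coeff-shift a s g u)))
  ... | no s∤t = trans (coeff-shift-zero a s f t s∤t) (sym (coeff-shift-zero a s g t s∤t))

  ·-assoc : ∀ (m m′ m″ : Monomial l) → (m · m′) · m″ ≡ m · (m′ · m″)
  ·-assoc (a , s) (b , t) (c , u) = cong₂ _,_ (ℤ.*-assoc a b c) (∙-assoc s t u)

  shift-* : ∀ m (h f : Poly l) → shift m h *ᴾ f ≡ shift m (h *ᴾ f)
  shift-* m [] f = refl
  shift-* m (m′ ∷ h) f = trans
    (cong₂ _++_ (trans (List.map-cong (·-assoc m m′) f) (List.map-∘ f)) (shift-* m h f))
    (sym (List.map-++ (m ·_) (shift m′ f) (h *ᴾ f)))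

  ++-* : ∀ (h k f : Poly l) → (h ++ k) *ᴾ f ≡ h *ᴾ f ++ k *ᴾ f
  ++-* [] k f = refl
  ++-* (m ∷ h) k f = trans (cong (shift m f ++_) (++-* h k f)) (sym (List.++-assoc (shift m f) (h *ᴾ f) (k *ᴾ f)))

  coeff-sumᴾ : ∀ {k} (F : Fin k → Poly l) t → coeff (sumᴾ F) t ≡ sumℤ (λ i → coeff (F i) t)
  coeff-sumᴾ {zero}  F t = refl
  coeff-sumᴾ {suc k} F t = trans (coeff-++ (F zero) _ t) (cong₂ _+_ {x = coeff (F zero) t} refl (coeff-sumᴾ (F ∘ suc) t))

  record IsIdeal (I : Pred (Poly l) 0ℓ) : Set where
    field
      ≈-resp : ∀ f g → f ≈ g → I f → I g
      0∈ : I 0ᴾ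
      +∈ : ∀ f g → I f → I g → I (f +ᴾ g)
      shift∈ : ∀ m f → I f → I (shift m f)

    *∈ : ∀ h f → I f → I (h *ᴾ f)
    *∈ []      f f∈ = 0∈
    *∈ (m ∷ h) f f∈ = +∈ (shift m f) (h *ᴾ f) (shift∈ m f f∈) (*∈ h f f∈)

    sumᴾ∈ : ∀ {k} (F : Fin k → Poly l) → (∀ i → I (F i)) → I (sumᴾ F)
    sumᴾ∈ {zero}  F F∈ = 0∈
    sumᴾ∈ {suc k} F F∈ = +∈ (F zero) (sumᴾ (F ∘ suc)) (F∈ zero) (sumᴾ∈ (F ∘ suc) (F∈ ∘ suc))

    generated⊆ : ∀ {k} {F : Fin k → Poly l} → (∀ i → I (F i)) → ∀ f → ⟨ F ⟩ f → I f
    generated⊆ {F = F} F∈ f (h , f≈) = ≈-resp (sumᴾ λ i → h i *ᴾ F i) f (λ t → sym (f≈ t)) (sumᴾ∈ (λ i → h i *ᴾ F i) λ i → *∈ (h i) (F i) (F∈ i))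

  ⟨⟩-ideal : ∀ {k} (F : Fin k → Poly l) → IsIdeal ⟨ F ⟩
  ⟨⟩-ideal F = record
    { ≈-resp = λ f g f≈g (h , f≈) → h , λ t → trans (sym (f≈g t)) (f≈ t)
    ; 0∈ = (λ _ → 0ᴾ) , λ t → sym (trans (coeff-sumᴾ (λ i → 0ᴾ *ᴾ F i) t) (sum-zero {f = λ i → coeff (0ᴾ *ᴾ F i) t} λ _ → refl))
    ; +∈ = λ f g (h , f≈) (k , g≈) → (λ i → h i ++ k i) , λ t → begin
        coeff (f ++ g) t                                                          ≡⟨ coeff-++ f g t ⟩
        coeff f t + coeff g t                                                     ≡⟨ cong₂ _+_ (trans (f≈ t) (coeff-sumᴾ (λ i → h i *ᴾ F i) t)) (trans (g≈ t) (coeff-sumᴾ (λ i → k i *ᴾ F i) t)) ⟩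
        sumℤ (λ i → coeff (h i *ᴾ F i) t) + sumℤ (λ i → coeff (k i *ᴾ F i) t)      ≡⟨ ∑-distrib-+ (λ i → coeff (h i *ᴾ F i) t) (λ i → coeff (k i *ᴾ F i) t) ⟨
        sumℤ (λ i → coeff (h i *ᴾ F i) t + coeff (k i *ᴾ F i) t)                  ≡⟨ sum-cong-≗ (λ i → trans (cong (λ f → coeff f t) (++-* (h i) (k i) (F i))) (coeff-++ (h i *ᴾ F i) (k i *ᴾ F i) t)) ⟨
        sumℤ (λ i → coeff ((h i ++ k i) *ᴾ F i) t)                                ≡⟨ coeff-sumᴾ (λ i → (h i ++ k i) *ᴾ F i) t ⟨
        coeff (sumᴾ (λ i → (h i ++ k i) *ᴾ F i)) t                                ∎
    ; shift∈ = λ m f (h , f≈) → (λ i → shift m (h i)) , λ t → trans (shift-cong m f (sumᴾ λ i → h i *ᴾ F i) f≈ t)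
        (cong (λ f → coeff f t) (trans (shift-sumᴾ m (λ i → h i *ᴾ F i)) (cong (List.foldr _++_ []) (List.tabulate-cong λ i → sym (shift-* m (h i) (F i))))))
    }
    where
    open ≡-Reasoning
    shift-sumᴾ : ∀ {k} m (F : Fin k → Poly l) → shift m (sumᴾ F) ≡ sumᴾ (λ i → shift m (F i))
    shift-sumᴾ {zero}  m F = refl
    shift-sumᴾ {suc k} m F = trans (List.map-++ (m ·_) (F zero) _) (cong (shift m (F zero) ++_) (shift-sumᴾ m (F ∘ suc)))

  generator∈ : ∀ {k} (F : Fin k → Poly l) i → ⟨ F ⟩ (F i)
  generator∈ F i = h , λ t → sym (trans (coeff-sumᴾ (λ j → h j *ᴾ F j) t) (trans
    (sum-single (λ j → coeff (h j *ᴾ F j) t) i λ j j≢i → cong (λ c → coeff (c *ᴾ F j) t) (h-other j≢i))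
    (trans (cong (λ c → coeff (c *ᴾ F i) t) h-self) (trans (cong (λ f → coeff f t) (List.++-identityʳ (shift (1ℤ , 𝟙) (F i)))) (trans (coeff-scale 1ℤ (F i) t) (ℤ.*-identityˡ (coeff (F i) t)))))))
    where
    select : ∀ {A : Set} → Dec A → Poly l
    select (yes _) = (1ℤ , 𝟙) ∷ []
    select (no _)  = []
    h : Fin _ → Poly l
    h j = select (j Fin.≟ i)
    h-self : h i ≡ (1ℤ , 𝟙) ∷ []
    h-self with i Fin.≟ i
    ... | yes _ = refl
    ... | no i≢i = contradiction refl i≢i
    h-other : ∀ {j} → j ≢ i → h j ≡ []
    h-other {j} j≢i with j Fin.≟ i
    ... | yes j≡i = contradiction j≡i j≢i
    ... | no _ = refl

  infix 4 _∣ᴹ?_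

  _∣ᴹ?_ : ∀ (m m′ : Monomial l) → Dec (m ∣ᴹ m′)
  (a , s) ∣ᴹ? (b , t) with a ℤ.∣? b | divisor? s t
  ... | yes (divides q b≡qa) | yes (u , t≡su) = yes ((q , u) , cong₂ _,_ b≡qa (trans t≡su (∙-comm s u)))
  ... | no a∤b | _ = no λ { ((q , u) , refl) → a∤b (divides q refl) }
  ... | yes _ | no s∤t = no λ { ((q , u) , refl) → s∤t (u , ∙-comm u s) }

  ∣ᴹ-trans : ∀ {m m′ m″ : Monomial l} → m ∣ᴹ m′ → m′ ∣ᴹ m″ → m ∣ᴹ m″
  ∣ᴹ-trans {m} (q , refl) (q′ , refl) = q′ · q , sym (·-assoc q′ q m)

-- Term orderings and existence of minimal strong Gröbner bases.

module _ {l : ℕ} (σ : TermOrdering l) where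

  open TermOrdering σ
  open IsTotalOrder isTotalOrder using (antisym; total) renaming (refl to ≤-refl; trans to ≤-trans)

  -- Totality and decidable equality of power products make the ordering stable, although it is not
  -- assumed decidable.
  ≤-stable : ∀ {s t} → Stable (s ≤ t)
  ≤-stable {s} {t} ¬¬s≤t with total s t | s ≟ᴾᴾ t
  ... | inj₁ s≤t | _ = s≤t
  ... | inj₂ t≤s | yes refl = t≤s
  ... | inj₂ t≤s | no s≢t = contradiction (λ s≤t → s≢t (antisym s≤t t≤s)) ¬¬s≤t

  ∙-monoʳ : ∀ u {s t} → s ≤ t → u ∙ s ≤ u ∙ t
  ∙-monoʳ u {s} {t} s≤t = subst₂ _≤_ (∙-comm s u) (∙-comm t u) (∙-mono s t u s≤t)

  ≼⇒≤ : ∀ {s t} → s ≼ t → s ≤ t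
  ≼⇒≤ {s} s≼t with ≼⇒∙ s≼t
  ... | u , refl = subst (_≤ u ∙ s) (∙-identityˡ s) (∙-mono 𝟙 u s (𝟙-minimum u))

  -- Term orderings are well-founded by Dickson's lemma: `σ` extends divisibility, so the least
  -- member of a finite basis of `P` is least in all of `P`.
  ¬¬-σ-least : ∀ (P : Pred (PP l) 0ℓ) → ∃ P → ¬ ¬ (∃[ t ] P t × (∀ s → P s → t ≤ s))
  ¬¬-σ-least P (s , Ps) = do
    (ss , P-ss , cover) ← ¬¬-finite-basis P
    ≼s ← cover s Ps
    let (t , Pt , t≤ss) = list-min P-ss ≼s
    return (t , Pt , λ u Pu → ≤-stable do
      ≼u ← cover u Pu
      return (below t≤ss ≼u))
    where
    below : ∀ {t u ss} → All (t ≤_) ss → Any (_≼ u) ss → t ≤ u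
    below (t≤s ∷ _) (here s≼u) = ≤-trans t≤s (≼⇒≤ s≼u)
    below (_ ∷ t≤ss) (there ≼u) = below t≤ss ≼u

    list-min⁺ : ∀ {s ss} → P s → All P ss → ∃[ t ] P t × All (t ≤_) (s ∷ ss)
    list-min⁺ {s} Ps [] = s , Ps , ≤-refl ∷ []
    list-min⁺ {s} Ps (Ps′ ∷ P-ss) with list-min⁺ Ps′ P-ss
    ... | t , Pt , t≤ss with total s t
    ...   | inj₁ s≤t = s , Ps , ≤-refl ∷ All.map (≤-trans s≤t) t≤ss
    ...   | inj₂ t≤s = t , Pt , t≤s ∷ t≤ss

    list-min : ∀ {ss} → All P ss → Any (_≼ s) ss → ∃[ t ] P t × All (t ≤_) ss
    list-min (Ps′ ∷ P-ss) _ = list-min⁺ Ps′ P-ss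

  -- An upper bound that need not be attained, and so survives the cancellation of leading terms in
  -- sums.
  Bounded : Poly l → PP l → Set
  Bounded f t = ∀ s → coeff f s ≢ 0ℤ → s ≤ t

  coeff≢0⇒∈ : ∀ (f : Poly l) {t} → coeff f t ≢ 0ℤ → t ∈ List.map proj₂ f
  coeff≢0⇒∈ [] 0≢0 = contradiction refl 0≢0
  coeff≢0⇒∈ ((c , s) ∷ f) {t} c≢0 with s ≟ᴾᴾ t
  ... | yes s≡t = here (sym s≡t)
  ... | no _ = there (coeff≢0⇒∈ f λ eq → c≢0 (trans (ℤ.+-identityˡ _) eq))

  LT-bound : ∀ f → Bounded f (LT σ f)
  LT-bound f s c≢0 = All.lookup (xs≤max 𝟙 (support σ f)) (∈-filter⁺ (λ t → ¬? (coeff f t ℤ.≟ 0ℤ)) (coeff≢0⇒∈ f c≢0) c≢0)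
    where open Extrema totalOrder using (xs≤max)

  LC≢0 : ∀ f → ¬ (f ≈ 0ᴾ) → LC σ f ≢ 0ℤ
  LC≢0 f f≉0 with argmax-sel id 𝟙 (support σ f)
    where open Extrema totalOrder using (argmax-sel)
  ... | inj₂ LT∈ = proj₂ (∈-filter⁻ (λ t → ¬? (coeff f t ℤ.≟ 0ℤ)) {xs = List.map proj₂ f} LT∈)
  -- Here the maximum is the default value `𝟙`. Any power product in the support lies below it and,
  -- by minimality of `𝟙`, above it, hence equals `LT`.
  ... | inj₁ LT≡𝟙 = λ LC≡0 → f≉0 λ t → decidable-stable (coeff f t ℤ.≟ 0ℤ) λ c≢0 →
    c≢0 (trans (cong (coeff f) (antisym (LT-bound f t c≢0) (subst (_≤ t) (sym LT≡𝟙) (𝟙-minimum t)))) LC≡0)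

  LT-unique : ∀ f {t} → coeff f t ≢ 0ℤ → Bounded f t → LT σ f ≡ t
  LT-unique f {t} c≢0 f≤t = antisym (f≤t (LT σ f) (LC≢0 f λ f≈0 → c≢0 (f≈0 t))) (LT-bound f t c≢0)

  LM-unique : ∀ f {c t} → coeff f t ≡ c → c ≢ 0ℤ → Bounded f t → LM σ f ≡ (c , t)
  LM-unique f refl c≢0 f≤t = cong (λ t → coeff f t , t) (LT-unique f c≢0 f≤t)

  Bounded-+ : ∀ f g {t} → Bounded f t → Bounded g t → Bounded (f +ᴾ g) t
  Bounded-+ f g f≤t g≤t s c≢0 with coeff f s ℤ.≟ 0ℤ
  ... | no fs≢0 = f≤t s fs≢0
  ... | yes fs≡0 = g≤t s λ gs≡0 → c≢0 (trans (coeff-++ f g s) (cong₂ _+_ fs≡0 gs≡0))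

  Bounded-shift : ∀ q u f {t} → Bounded f t → Bounded (shift (q , u) f) (u ∙ t)
  Bounded-shift q u f f≤t s c≢0 with divisor? u s
  ... | yes (v , refl) = ∙-monoʳ u (f≤t v λ fv≡0 → c≢0 (trans (coeff-shift q u f v) (trans (cong (q *_) fv≡0) (ℤ.*-zeroʳ q))))
  ... | no u∤s = contradiction (coeff-shift-zero q u f s u∤s) c≢0

  module _ {I : Pred (Poly l) 0ℓ} (I-ideal : IsIdeal I) where
    open IsIdeal I-ideal

    -- For fixed `t` these `c` are closed under sums and integer multiples, because `c` may be 0 and
    -- `t` is only a bound.
    Leads : ℤ → PP l → Set
    Leads c t = ∃[ f ] I f × coeff f t ≡ c × Bounded f t

    leads-shift : ∀ {c t} q u → Leads c t → Leads (q * c) (u ∙ t)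
    leads-shift q u (f , f∈ , refl , f≤t) = shift (q , u) f , shift∈ (q , u) f f∈ , coeff-shift q u f _ , Bounded-shift q u f f≤t

    leads-+ : ∀ {c d t} → Leads c t → Leads d t → Leads (c + d) t
    leads-+ {t = t} (f , f∈ , refl , f≤t) (g , g∈ , refl , g≤t) = f +ᴾ g , +∈ f g f∈ g∈ , coeff-++ f g t , Bounded-+ f g f≤t g≤t

    leads-* : ∀ {c t} q → Leads c t → Leads (q * c) t
    leads-* {t = t} q L = subst (Leads _) (∙-identityˡ t) (leads-shift q 𝟙 L)

    -- The leading coefficients at `t` form an ideal of ℤ; an element of least nonzero absolute
    -- value generates it, by division with remainder.
    ¬¬-least-leading-coefficient : ∀ {c t} → Leads c t → c ≢ 0ℤ → ¬ ¬ (∃[ d ] Leads d t × d ≢ 0ℤ × (∀ a → Leads a t → d ℤ.∣ a))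
    ¬¬-least-leading-coefficient {c} {t} c-leads c≢0 = do
      (k , (d , ∣d∣≡1+k , d-leads) , least) ← ¬¬-least (λ k → ∃[ d ] ∣ d ∣ ≡ suc k × Leads d t) (ℕ.pred ∣ c ∣)
        (c , sym (ℕ.suc-pred ∣ c ∣ {{ℕ.≢-nonZero (c≢0 ∘ ℤ.∣i∣≡0⇒i≡0)}}) , c-leads)
      return (d , d-leads , (λ { refl → contradiction ∣d∣≡1+k λ () }) , least⇒∣ ∣d∣≡1+k d-leads least)
      where
      least⇒∣ : ∀ {k d} → ∣ d ∣ ≡ suc k → Leads d t → (∀ j → j ℕ.< k → ¬ (∃[ d ] ∣ d ∣ ≡ suc j × Leads d t)) → ∀ a → Leads a t → d ℤ.∣ a
      least⇒∣ {k} {d} ∣d∣≡1+k d-leads least a a-leads = helper (a ℤ.% d) refl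
        where
        instance
          d-nonZero : ℤ.NonZero d
          d-nonZero = ℕ.≢-nonZero λ ∣d∣≡0 → contradiction (trans (sym ∣d∣≡1+k) ∣d∣≡0) λ ()
        q = a ℤ./ d
        remainder : ∀ r q d → (r + q * d) + - q * d ≡ r
        remainder = solve-∀
        r-leads : Leads (+ (a ℤ.% d)) t
        r-leads = subst (λ c → Leads c t) (trans (cong (λ a → a + - q * d) (a≡a%n+[a/n]*n a d)) (remainder (+ (a ℤ.% d)) q d)) (leads-+ a-leads (leads-* (- q) d-leads))
        helper : ∀ r → a ℤ.% d ≡ r → d ℤ.∣ a
        helper zero r≡0 = divides q (trans (a≡a%n+[a/n]*n a d) (trans (cong (λ r → + r + q * d) r≡0) (ℤ.+-identityˡ (q * d))))
        helper (suc r) r≡ = contradiction (+ (a ℤ.% d) , r≡ , r-leads) (least r (ℕ.s≤s⁻¹ (subst₂ ℕ._<_ r≡ ∣d∣≡1+k (n%d<d a d))))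

    IsStrong : ∀ {m} → (Fin m → Poly l) → Set
    IsStrong G = ∀ f → I f → ¬ (f ≈ 0ᴾ) → ∃[ i ] LM σ (G i) ∣ᴹ LM σ f

    StrongBasis : ℕ → Set
    StrongBasis m = ∃ λ (G : Fin m → Poly l) → (∀ i → I (G i)) × (∀ i → ¬ (G i ≈ 0ᴾ)) × IsStrong G

    -- The size of a leading coefficient is treated as one more exponent, so that Dickson's lemma
    -- with `suc l` coordinates gives finiteness.
    ¬¬-strongBasis : ¬ ¬ ∃ StrongBasis
    ¬¬-strongBasis = do
      (ss , P-ss , cover) ← ¬¬-finite-basis P
      return (List.length ss , G P-ss , G∈ P-ss , G≉0 P-ss , λ f f∈ f≉0 →
        -- Divisibility by one of finitely many monomials is decidable, so strongness holds outright
        -- even though the least coefficient is found only up to double negation.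
        decidable-stable (Fin.any? λ i → LM σ (G P-ss i) ∣ᴹ? LM σ f) do
          (d , d-leads , d≢0 , d∣) ← ¬¬-least-leading-coefficient (f , f∈ , refl , LT-bound f) (LC≢0 f f≉0)
          ≼ ← cover (ℕ.pred ∣ d ∣ ∷ LT σ f) (d , sym (ℕ.suc-pred ∣ d ∣ {{ℕ.≢-nonZero (d≢0 ∘ ℤ.∣i∣≡0⇒i≡0)}}) , d-leads)
          return (divisor P-ss d∣ (d∣ (LC σ f) (f , f∈ , refl , LT-bound f)) d≢0 ≼))
      where
      -- A basis element lying below (∣d∣ - 1 , t), where d is the least leading coefficient at t,
      -- has leading coefficient ±d: its multiple at t is divisible by d and not larger.
      P : Pred (Vec ℕ (suc l)) 0ℓ
      P (k ∷ t) = ∃[ c ] ∣ c ∣ ≡ suc k × Leads c t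

      poly : ∀ {s} → P s → Poly l
      poly {_ ∷ _} (_ , _ , f , _) = f

      poly∈ : ∀ {s} (Ps : P s) → I (poly Ps)
      poly∈ {_ ∷ _} (_ , _ , _ , f∈ , _) = f∈

      abs-suc⇒≢0 : ∀ {c k} → ∣ c ∣ ≡ suc k → c ≢ 0ℤ
      abs-suc⇒≢0 () refl

      poly≉0 : ∀ {s} (Ps : P s) → ¬ (poly Ps ≈ 0ᴾ)
      poly≉0 {_ ∷ t} (_ , ∣c∣≡1+k , _ , _ , ft≡c , _) f≈0 = abs-suc⇒≢0 ∣c∣≡1+k (trans (sym ft≡c) (f≈0 t))

      G : ∀ {ss} → All P ss → Fin (List.length ss) → Poly l
      G (Ps ∷ _) zero = poly Ps
      G (_ ∷ P-ss) (suc i) = G P-ss i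

      G∈ : ∀ {ss} (P-ss : All P ss) i → I (G P-ss i)
      G∈ (Ps ∷ _) zero = poly∈ Ps
      G∈ (_ ∷ P-ss) (suc i) = G∈ P-ss i

      G≉0 : ∀ {ss} (P-ss : All P ss) i → ¬ (G P-ss i ≈ 0ᴾ)
      G≉0 (Ps ∷ _) zero = poly≉0 Ps
      G≉0 (_ ∷ P-ss) (suc i) = G≉0 P-ss i

      poly-divides : ∀ {s d a t} (Ps : P s) → (∀ a → Leads a t → d ℤ.∣ a) → d ℤ.∣ a → d ≢ 0ℤ → s ≼ ℕ.pred ∣ d ∣ ∷ t → LM σ (poly Ps) ∣ᴹ (a , t)
      poly-divides {k ∷ s} {d} {a} {t} (c , ∣c∣≡1+k , f , f∈ , ft≡c , f≤) d∣ d∣a d≢0 (k≤∣d∣-1 ∷ s≼t) with ≼⇒∙ s≼t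
      ... | u , refl = subst (_∣ᴹ (a , u ∙ s)) (sym (LM-unique f ft≡c (abs-suc⇒≢0 ∣c∣≡1+k) f≤))
        ((ℤ._∣_.quotient c∣a , u) , cong (_, u ∙ s) (ℤ._∣_.equality c∣a))
        where
        d∣c : d ℤ.∣ c
        d∣c = d∣ c (subst (λ c → Leads c (u ∙ s)) (ℤ.*-identityˡ c) (leads-shift 1ℤ u (f , f∈ , ft≡c , f≤)))
        ∣c∣≤∣d∣ : ∣ c ∣ ℕ.≤ ∣ d ∣
        ∣c∣≤∣d∣ = subst₂ ℕ._≤_ (sym ∣c∣≡1+k) (ℕ.suc-pred ∣ d ∣ {{ℕ.≢-nonZero (d≢0 ∘ ℤ.∣i∣≡0⇒i≡0)}}) (s≤s k≤∣d∣-1)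
        ∣d∣≤∣c∣ : ∣ d ∣ ℕ.≤ ∣ c ∣
        ∣d∣≤∣c∣ = ℕ.∣⇒≤ {{ℕ.≢-nonZero (abs-suc⇒≢0 {c} ∣c∣≡1+k ∘ ℤ.∣i∣≡0⇒i≡0)}} (∣⇒∣ᵤ d∣c)
        c∣a : c ℤ.∣ a
        c∣a = ∣-trans (∣ᵤ⇒∣ {c} {d} (ℕ.∣-reflexive (ℕ.≤-antisym ∣c∣≤∣d∣ ∣d∣≤∣c∣))) d∣a

      divisor : ∀ {ss d a t} (P-ss : All P ss) → (∀ a → Leads a t → d ℤ.∣ a) → d ℤ.∣ a → d ≢ 0ℤ → Any (_≼ ℕ.pred ∣ d ∣ ∷ t) ss → ∃[ i ] LM σ (G P-ss i) ∣ᴹ (a , t)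
      divisor (Ps ∷ _) d∣ d∣a d≢0 (here s≼) = zero , poly-divides Ps d∣ d∣a d≢0 s≼
      divisor (_ ∷ P-ss) d∣ d∣a d≢0 (there ≼) with divisor P-ss d∣ d∣a d≢0 ≼
      ... | i , G∣ = suc i , G∣

    strong-without : ∀ {m} ((G , _) : StrongBasis (suc m)) {i j} → i ≢ j → LM σ (G i) ∣ᴹ LM σ (G j) → StrongBasis m
    strong-without (G , G∈ , G≉0 , G-strong) {i} {j} i≢j Gi∣Gj =
      G ∘ punchIn j , G∈ ∘ punchIn j , G≉0 ∘ punchIn j , strong
      where
      other : ∀ {f k} → k ≢ j → LM σ (G k) ∣ᴹ LM σ f → ∃[ k ] LM σ (G (punchIn j k)) ∣ᴹ LM σ f
      other {f} k≢j Gk∣f = punchOut (k≢j ∘ sym) , subst (λ k → LM σ (G k) ∣ᴹ LM σ f) (sym (Fin.punchIn-punchOut (k≢j ∘ sym))) Gk∣f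
      strong : IsStrong (G ∘ punchIn j)
      strong f f∈ f≉0 with G-strong f f∈ f≉0
      ... | k , Gk∣f with k Fin.≟ j
      ...   | no k≢j = other {f} k≢j Gk∣f
      ...   | yes refl = other {f} i≢j (∣ᴹ-trans Gi∣Gj Gk∣f)

    -- A strong basis with the fewest elements is irredundant: an element whose leading monomial is
    -- divisible by that of another could be omitted.
    ¬¬-minimal-strongBasis : ¬ ¬ (∃[ m ] ∃ λ ((G , _) : StrongBasis m) → ∀ i j → i ≢ j → ¬ (LM σ (G i) ∣ᴹ LM σ (G j)))
    ¬¬-minimal-strongBasis = do
      (m , B) ← ¬¬-strongBasis
      (m , B , least) ← ¬¬-least StrongBasis m B
      return (m , B , irredundant B least)
      where
      irredundant : ∀ {m} (B : StrongBasis m) → (∀ k → k ℕ.< m → ¬ StrongBasis k) → ∀ i j → i ≢ j → ¬ (LM σ (proj₁ B i) ∣ᴹ LM σ (proj₁ B j))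
      irredundant {suc m} B least i j i≢j Gi∣Gj = least m ℕ.≤-refl (strong-without B i≢j Gi∣Gj)

    -- Top reduction of a counterexample `f` whose bound `t` is σ-least: subtracting a monomial
    -- multiple of a basis element cancels the coefficient at `t` and stays outside `⟨ G ⟩`. By
    -- minimality the new leading term would still be `t`, where the coefficient is now 0.
    strong-generates : ∀ {m} {G : Fin m → Poly l} → (∀ i → I (G i)) → IsStrong G → ∀ f → I f → ¬ ¬ ⟨ G ⟩ f
    strong-generates {G = G} G∈ G-strong f f∈ f∉ = ¬¬-σ-least P (LT σ f , f , f∈ , f∉ , f-nonzero f f∉ , LT-bound f) λ
      (t , (f , f∈ , f∉ , ft≢0 , f≤t) , least) → irreducible t f f∈ f∉ ft≢0 f≤t least (G-strong f f∈ λ f≈0 → ft≢0 (f≈0 t))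
      where
      open IsIdeal (⟨⟩-ideal G) using () renaming (≈-resp to ⟨G⟩-resp; 0∈ to 0∈⟨G⟩; +∈ to +∈⟨G⟩; shift∈ to shift∈⟨G⟩)
      P : Pred (PP l) 0ℓ
      P t = ∃[ f ] I f × ¬ ⟨ G ⟩ f × coeff f t ≢ 0ℤ × Bounded f t

      f-nonzero : ∀ f → ¬ ⟨ G ⟩ f → LC σ f ≢ 0ℤ
      f-nonzero f f∉ = LC≢0 f λ f≈0 → f∉ (⟨G⟩-resp 0ᴾ f (λ t → sym (f≈0 t)) 0∈⟨G⟩)

      irreducible : ∀ t f → I f → ¬ ⟨ G ⟩ f → coeff f t ≢ 0ℤ → Bounded f t → (∀ s → P s → t ≤ s) → ¬ (∃[ i ] LM σ (G i) ∣ᴹ LM σ f)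
      irreducible t f f∈ f∉ ft≢0 f≤t least (i , (q , u) , LMf≡) = f′-nonzero (trans (cong (coeff f′) LT≡t) f′t≡0)
        where
        g = G i
        LMf : (coeff f t , t) ≡ (q * LC σ g , u ∙ LT σ g)
        LMf = trans (sym (LM-unique f refl ft≢0 f≤t)) LMf≡
        t≡ : u ∙ LT σ g ≡ t
        t≡ = sym (cong proj₂ LMf)
        f′ = f +ᴾ shift (- q , u) g
        cancel : ∀ q a → q * a + - q * a ≡ 0ℤ
        cancel = solve-∀
        f′t≡0 : coeff f′ t ≡ 0ℤ
        f′t≡0 = trans (coeff-++ f (shift (- q , u) g) t) (trans
          (cong₂ _+_ (cong proj₁ LMf) (trans (cong (coeff (shift (- q , u) g)) (sym t≡)) (coeff-shift (- q) u g (LT σ g))))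
          (cancel q (LC σ g)))
        f′≤t : Bounded f′ t
        f′≤t = Bounded-+ f (shift (- q , u) g) f≤t (subst (Bounded (shift (- q , u) g)) t≡ (Bounded-shift (- q) u g (LT-bound g)))
        cancel-shift : ∀ s → coeff (shift (- q , u) g) s + coeff (shift (q , u) g) s ≡ 0ℤ
        cancel-shift s with divisor? u s
        ... | yes (v , refl) = trans (cong₂ _+_ (coeff-shift (- q) u g v) (coeff-shift q u g v)) (cancel′ q (coeff g v))
          where
          cancel′ : ∀ q a → - q * a + q * a ≡ 0ℤ
          cancel′ = solve-∀
        ... | no u∤s = cong₂ _+_ (coeff-shift-zero (- q) u g s u∤s) (coeff-shift-zero q u g s u∤s)
        f′∉ : ¬ ⟨ G ⟩ f′
        f′∉ f′∈ = f∉ (⟨G⟩-resp (f′ +ᴾ shift (q , u) g) f restore (+∈⟨G⟩ f′ (shift (q , u) g) f′∈ (shift∈⟨G⟩ (q , u) g (generator∈ G i))))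
          where
          restore : f′ +ᴾ shift (q , u) g ≈ f
          restore s = trans (coeff-++ f′ (shift (q , u) g) s) (trans
            (cong (_+ coeff (shift (q , u) g) s) (coeff-++ f (shift (- q , u) g) s))
            (trans (ℤ.+-assoc (coeff f s) _ _) (trans (cong₂ _+_ {x = coeff f s} refl (cancel-shift s)) (ℤ.+-identityʳ (coeff f s)))))
        f′-nonzero : LC σ f′ ≢ 0ℤ
        f′-nonzero = f-nonzero f′ f′∉
        LT≡t : LT σ f′ ≡ t
        LT≡t = antisym (f′≤t (LT σ f′) f′-nonzero) (least (LT σ f′) (f′ , +∈ f (shift (- q , u) g) f∈ (shift∈ (- q , u) g (G∈ i)) , f′∉ , f′-nonzero , LT-bound f′))

  ¬¬-minimalStrongGröbnerBasis : ∀ {k} (F : Fin k → Poly l) → ¬ ¬ (∃[ m ] ∃ λ (G : Fin m → Poly l) → IsMinimalStrongGröbnerBasis σ ⟨ F ⟩ G)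
  ¬¬-minimalStrongGröbnerBasis F = do
    (m , (G , G∈ , G≉0 , G-strong) , irredundant) ← ¬¬-minimal-strongBasis (⟨⟩-ideal F)
    F∈ ← ¬¬-choice λ i → strong-generates (⟨⟩-ideal F) G∈ G-strong (F i) (generator∈ F i)
    return (m , G , record
      { nonzero = G≉0
      ; generates = (λ {f} → IsIdeal.generated⊆ (⟨⟩-ideal G) F∈ f) , λ {f} → IsIdeal.generated⊆ (⟨⟩-ideal F) G∈ f
      ; strong = G-strong
      ; minimal = irredundant
      })

-- Ideals generated by linear forms

lookup-var : ∀ {l} (k i : Fin l) → Vec.lookup (var k) i ≡ (if does (i Fin.≟ k) then 1 else 0)
lookup-var k = Vec.lookup∘tabulate λ i → if does (i Fin.≟ k) then 1 else 0

lookup-var-self : ∀ {l} (k : Fin l) → Vec.lookup (var k) k ≡ 1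
lookup-var-self k = trans (lookup-var k k) (cong (if_then 1 else 0) (dec-true (k Fin.≟ k) refl))

var-injective : ∀ {l} {k j : Fin l} → var k ≡ var j → k ≡ j
var-injective {k = k} {j} eq with k Fin.≟ j | trans (sym (lookup-var-self k)) (trans (cong (λ v → Vec.lookup v k) eq) (lookup-var j k))
... | yes k≡j | _ = k≡j
... | no _ | ()

var≢𝟙 : ∀ {l} (k : Fin l) → var k ≢ 𝟙
var≢𝟙 k eq with trans (sym (lookup-var-self k)) (trans (cong (λ v → Vec.lookup v k) eq) (Vec.lookup-replicate k 0))
... | ()

tabulate-0 : ∀ {l} → Vec.tabulate {n = l} (λ _ → 0) ≡ 𝟙
tabulate-0 {zero}  = refl
tabulate-0 {suc l} = cong (0 ∷_) tabulate-0

∙≡𝟙 : ∀ {l} (s u : PP l) → s ∙ u ≡ 𝟙 → s ≡ 𝟙 × u ≡ 𝟙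
∙≡𝟙 [] [] _ = refl , refl
∙≡𝟙 (zero ∷ s) (zero ∷ u) eq with ∙≡𝟙 s u (proj₂ (Vec.∷-injective eq))
... | refl , refl = refl , refl

∙≡var : ∀ {l} (s u : PP l) k → s ∙ u ≡ var k → s ≡ 𝟙 ⊎ u ≡ 𝟙
∙≡var (zero ∷ s) (suc zero ∷ u) zero eq with ∙≡𝟙 s u (trans (proj₂ (Vec.∷-injective eq)) tabulate-0)
... | refl , _ = inj₁ refl
∙≡var (suc zero ∷ s) (zero ∷ u) zero eq with ∙≡𝟙 s u (trans (proj₂ (Vec.∷-injective eq)) tabulate-0)
... | _ , refl = inj₂ refl
∙≡var (zero ∷ s) (zero ∷ u) (suc k) eq with ∙≡var s u k (proj₂ (Vec.∷-injective eq))
... | inj₁ refl = inj₁ refl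
... | inj₂ refl = inj₂ refl
∙≡var (zero ∷ s) (zero ∷ u) zero ()
∙≡var (zero ∷ s) (suc (suc _) ∷ u) zero ()
∙≡var (suc (suc _) ∷ s) (_ ∷ u) zero ()
∙≡var (suc zero ∷ s) (suc _ ∷ u) zero ()
∙≡var (zero ∷ s) (suc _ ∷ u) (suc k) ()
∙≡var (suc _ ∷ s) (_ ∷ u) (suc k) ()

var-factor : ∀ {l} (t : PP l) → t ≢ 𝟙 → ∃[ k ] ∃[ u ] t ≡ u ∙ var k
var-factor [] []≢𝟙 = contradiction refl []≢𝟙
var-factor (zero ∷ t) t≢𝟙 with var-factor t (t≢𝟙 ∘ cong (0 ∷_))
... | k , u , refl = suc k , 0 ∷ u , refl
var-factor (suc a ∷ t) _ = zero , a ∷ t , cong₂ _∷_ (ℕ.+-comm 1 a)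
  (sym (trans (cong (t ∙_) tabulate-0) (trans (∙-comm t 𝟙) (∙-identityˡ t))))

module _ {l : ℕ} where

  linear : Vector ℤ l → Poly l
  linear w = List.tabulate λ k → w k , var k

  linearPart : Poly l → Vector ℤ l
  linearPart f k = coeff f (var k)

  coeff-linear : ∀ w t → coeff (linear w) t ≡ sumℤ (λ k → if does (var k ≟ᴾᴾ t) then w k else 0ℤ)
  coeff-linear w t = coeff-tabulate w var
    where
    coeff-tabulate : ∀ {m} (w : Vector ℤ m) (v : Fin m → PP l) →
      coeff (List.tabulate λ k → w k , v k) t ≡ sumℤ (λ k → if does (v k ≟ᴾᴾ t) then w k else 0ℤ)
    coeff-tabulate {zero}  w v = refl
    coeff-tabulate {suc m} w v = cong₂ _+_ {x = if does (v zero ≟ᴾᴾ t) then w zero else 0ℤ} refl (coeff-tabulate (w ∘ suc) (v ∘ suc))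

  linearPart-linear : ∀ w → linearPart (linear w) ≗ w
  linearPart-linear w k = trans (coeff-linear w (var k)) (trans (sum-single (λ j → if does (var j ≟ᴾᴾ var k) then w j else 0ℤ) k other) self)
    where
    other : ∀ j → j ≢ k → (if does (var j ≟ᴾᴾ var k) then w j else 0ℤ) ≡ 0ℤ
    other j j≢k with var j ≟ᴾᴾ var k
    ... | yes eq = contradiction (var-injective eq) j≢k
    ... | no _ = refl
    self : (if does (var k ≟ᴾᴾ var k) then w k else 0ℤ) ≡ w k
    self = cong (if_then w k else 0ℤ) (dec-true (var k ≟ᴾᴾ var k) refl)

  coeff-linear-zero : ∀ w t → (∀ k → t ≢ var k) → coeff (linear w) t ≡ 0ℤ
  coeff-linear-zero w t t≢var = trans (coeff-linear w t) (sum-zero zero-term)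
    where
    zero-term : ∀ k → (if does (var k ≟ᴾᴾ t) then w k else 0ℤ) ≡ 0ℤ
    zero-term k with var k ≟ᴾᴾ t
    ... | yes eq = contradiction (sym eq) (t≢var k)
    ... | no _ = refl

  linear-⊕ : ∀ w v → linear w +ᴾ linear v ≈ linear (w ⊕ v)
  linear-⊕ w v t = trans (coeff-++ (linear w) (linear v) t) (trans (cong₂ _+_ (coeff-linear w t) (coeff-linear v t))
    (trans (sym (∑-distrib-+ (λ k → if does (var k ≟ᴾᴾ t) then w k else 0ℤ) (λ k → if does (var k ≟ᴾᴾ t) then v k else 0ℤ)))
      (trans (sum-cong-≗ λ k → if-+ (does (var k ≟ᴾᴾ t)) (w k) (v k)) (sym (coeff-linear (w ⊕ v) t)))))
    where
    if-+ : ∀ b x y → (if b then x else 0ℤ) + (if b then y else 0ℤ) ≡ (if b then x + y else 0ℤ)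
    if-+ true  x y = refl
    if-+ false x y = refl

  linear-⊙ : ∀ c w → shift (c , 𝟙) (linear w) ≈ linear (c ⊙ w)
  linear-⊙ c w t = trans (coeff-scale c (linear w) t) (trans (cong (c *_) (coeff-linear w t))
    (trans (*-distribˡ-sum c (λ k → if does (var k ≟ᴾᴾ t) then w k else 0ℤ))
      (trans (sum-cong-≗ λ k → if-* (does (var k ≟ᴾᴾ t)) (w k)) (sym (coeff-linear (c ⊙ w) t)))))
    where
    if-* : ∀ b x → c * (if b then x else 0ℤ) ≡ (if b then c * x else 0ℤ)
    if-* true  x = refl
    if-* false x = ℤ.*-zeroʳ c

  linear-submodule : ∀ {I} → IsIdeal I → IsSubmodule (I ∘ linear)
  linear-submodule {I} I-ideal = record
    { ≗-resp = λ x≗y → subst I (List.tabulate-cong λ k → cong (_, var k) (x≗y k))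
    ; zero∈ = ≈-resp 0ᴾ (linear 0ⱽ) (λ t → sym (trans (coeff-linear 0ⱽ t) (sum-zero λ k → if-0 (does (var k ≟ᴾᴾ t))))) 0∈
    ; ⊕∈ = λ {x} {y} hx hy → ≈-resp (linear x +ᴾ linear y) (linear (x ⊕ y)) (linear-⊕ x y) (+∈ (linear x) (linear y) hx hy)
    ; ⊙∈ = λ c {x} hx → ≈-resp (shift (c , 𝟙) (linear x)) (linear (c ⊙ x)) (linear-⊙ c x) (shift∈ (c , 𝟙) (linear x) hx)
    }
    where
    open IsIdeal I-ideal
    if-0 : ∀ b → (if b then 0ℤ else 0ℤ) ≡ 0ℤ
    if-0 true  = refl
    if-0 false = refl

  linearForms : ∀ {k} → Matrix l k → Fin k → Poly l
  linearForms A j = linear λ i → A i j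

  linear∈⟨⟩ : ∀ {k} {A : Matrix l k} {y} → Image A y → ⟨ linearForms A ⟩ (linear y)
  linear∈⟨⟩ {A = A} (x , Ax≗y) = ≗-resp Ax≗y (⋆∈ (generator∈ (linearForms A)) x)
    where open IsSubmodule (linear-submodule (⟨⟩-ideal (linearForms A)))

  VanishingWithLinearPartIn : Pred (Vector ℤ l) 0ℓ → Pred (Poly l) 0ℓ
  VanishingWithLinearPartIn M f = coeff f 𝟙 ≡ 0ℤ × M (linearPart f)

  -- Without constant terms, multiplication by a power product other than `𝟙` destroys the linear
  -- part, and multiplication by a constant only scales it. With `M` the column span, this ideal
  -- confines the linear parts of all elements of `⟨ linearForms A ⟩`.
  vanishing-ideal : ∀ {M} → IsSubmodule M → IsIdeal (VanishingWithLinearPartIn M)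
  vanishing-ideal {M} M-submodule = record
    { ≈-resp = λ f g f≈g (f𝟙≡0 , f∈) → trans (sym (f≈g 𝟙)) f𝟙≡0 , ≗-resp (λ k → f≈g (var k)) f∈
    ; 0∈ = refl , zero∈
    ; +∈ = λ f g (f𝟙≡0 , f∈) (g𝟙≡0 , g∈) → trans (coeff-++ f g 𝟙) (cong₂ _+_ f𝟙≡0 g𝟙≡0) , ≗-resp (λ k → sym (coeff-++ f g (var k))) (⊕∈ f∈ g∈)
    ; shift∈ = λ (a , s) f (f𝟙≡0 , f∈) → shift∈ a s f f𝟙≡0 f∈ (s ≟ᴾᴾ 𝟙)
    }
    where
    open IsSubmodule M-submodule
    shift∈ : ∀ a s f → coeff f 𝟙 ≡ 0ℤ → M (linearPart f) → Dec (s ≡ 𝟙) → VanishingWithLinearPartIn M (shift (a , s) f)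
    shift∈ a s f f𝟙≡0 f∈ (yes refl) =
      trans (coeff-scale a f 𝟙) (trans (cong (a *_) f𝟙≡0) (ℤ.*-zeroʳ a)) , ≗-resp (λ k → sym (coeff-scale a f (var k))) (⊙∈ a f∈)
    shift∈ a s f f𝟙≡0 f∈ (no s≢𝟙) =
      coeff-shift-zero a s f 𝟙 (λ (u , 𝟙≡su) → s≢𝟙 (proj₁ (∙≡𝟙 s u (sym 𝟙≡su)))) , ≗-resp (sym ∘ vanish) zero∈
      where
      vanish : ∀ k → coeff (shift (a , s) f) (var k) ≡ 0ℤ
      vanish k with divisor? s (var k)
      ... | no s∤ = coeff-shift-zero a s f (var k) s∤
      ... | yes (u , eq) with ∙≡var s u k (sym eq)
      ...   | inj₁ s≡𝟙 = contradiction s≡𝟙 s≢𝟙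
      ...   | inj₂ refl = trans (cong (coeff (shift (a , s) f)) eq) (trans (coeff-shift a s f 𝟙) (trans (cong (a *_) f𝟙≡0) (ℤ.*-zeroʳ a)))

  ⟨⟩⊆vanishing : ∀ {k} (A : Matrix l k) f → ⟨ linearForms A ⟩ f → VanishingWithLinearPartIn (Image A) f
  ⟨⟩⊆vanishing A = IsIdeal.generated⊆ (vanishing-ideal (Image-submodule A)) λ j →
    coeff-linear-zero (λ i → A i j) 𝟙 (λ k 𝟙≡var → var≢𝟙 k (sym 𝟙≡var)) ,
    IsSubmodule.≗-resp (Image-submodule A) (λ i → sym (linearPart-linear (λ i → A i j) i)) (δ j , ⋆-δ A j)

  module _ (N : ℤ) (k : Fin l) where

    coeff-multiple-var : coeff (linear (N ⊙ δ k)) (var k) ≡ N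
    coeff-multiple-var = trans (linearPart-linear (N ⊙ δ k) k) (trans (cong (N *_) (1ᴹ-diagonal k)) (ℤ.*-identityʳ N))

    multiple-var-support : ∀ s → coeff (linear (N ⊙ δ k)) s ≢ 0ℤ → s ≡ var k
    multiple-var-support s c≢0 with s ≟ᴾᴾ var k
    ... | yes s≡var = s≡var
    ... | no s≢var = contradiction zero-coeff c≢0
      where
      zero-coeff : coeff (linear (N ⊙ δ k)) s ≡ 0ℤ
      zero-coeff = trans (coeff-linear (N ⊙ δ k) s) (sum-zero term)
        where
        term : ∀ j → (if does (var j ≟ᴾᴾ s) then N * δ k j else 0ℤ) ≡ 0ℤ
        term j with var j ≟ᴾᴾ s
        ... | no _ = refl
        ... | yes refl = trans (cong (N *_) (1ᴹ-off-diagonal {i = j} {k} λ { refl → s≢var refl })) (ℤ.*-zeroʳ N)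

-- Saturation of a submodule at a multiplicative set.

record IsMultiplicative (S : Pred ℤ 0ℓ) : Set where
  field
    1∈ : S 1ℤ
    *∈ : ∀ {a b} → S a → S b → S (a * b)

-- The integral vectors of the localization of `M` at `S`. The double negation makes membership
-- stable, so it may be proved by refuting a least counterexample.
Localized : ∀ {l} → Pred ℤ 0ℓ → Pred (Vector ℤ l) 0ℓ → Pred (Vector ℤ l) 0ℓ
Localized S M y = ¬ ¬ (∃[ D ] S D × M (D ⊙ y))

module _ {l} {S : Pred ℤ 0ℓ} (S-mult : IsMultiplicative S) {M : Pred (Vector ℤ l) 0ℓ} (M-submodule : IsSubmodule M) where
  open IsMultiplicative S-mult
  open IsSubmodule M-submodule

  ⊆Localized : ∀ {y} → M y → Localized S M y
  ⊆Localized {y} y∈ = return (1ℤ , 1∈ , ≗-resp (λ i → sym (ℤ.*-identityˡ (y i))) y∈)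

  Localized-submodule : IsSubmodule (Localized S M)
  Localized-submodule = record
    { ≗-resp = λ x≗y x∈ → do
        (D , D∈ , Dx∈) ← x∈
        return (D , D∈ , ≗-resp (λ i → cong (D *_) (x≗y i)) Dx∈)
    ; zero∈ = ⊆Localized zero∈
    ; ⊕∈ = λ {x} {y} x∈ y∈ → do
        (D , D∈ , Dx∈) ← x∈
        (E , E∈ , Ey∈) ← y∈
        return (D * E , *∈ D∈ E∈ , ≗-resp (λ i → common D E (x i) (y i)) (⊕∈ (⊙∈ E Dx∈) (⊙∈ D Ey∈)))
    ; ⊙∈ = λ c {x} x∈ → do
        (D , D∈ , Dx∈) ← x∈
        return (D , D∈ , ≗-resp (λ i → swap c D (x i)) (⊙∈ c Dx∈))
    }
    where
    common : ∀ D E x y → E * (D * x) + D * (E * y) ≡ D * E * (x + y)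
    common = solve-∀
    swap : ∀ c D x → c * (D * x) ≡ D * (c * x)
    swap = solve-∀

  Localized-saturated : ∀ {c y} → S c → Localized S M (c ⊙ y) → Localized S M y
  Localized-saturated {c} {y} c∈ cy∈ = do
    (D , D∈ , Dcy∈) ← cy∈
    return (D * c , *∈ D∈ c∈ , ≗-resp (λ i → sym (ℤ.*-assoc D c (y i))) Dcy∈)

≢0-multiplicative : IsMultiplicative (_≢ 0ℤ)
≢0-multiplicative = record { 1∈ = λ () ; *∈ = λ a≢0 b≢0 ab≡0 → b≢0 (*-cancelˡ-0 a≢0 ab≡0) }

∤-multiplicative : ∀ {p} → Prime p → IsMultiplicative (λ D → ¬ (+ p ℤ.∣ D))
∤-multiplicative {p} p-prime = record { 1∈ = p∤1 ; *∈ = λ {a} p∤a p∤b p∣ab → both a p∤a p∤b (prime-∣-* p-prime a p∣ab) }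
  where
  p∤1 : ¬ (+ p ℤ.∣ 1ℤ)
  p∤1 p∣1 = ℕ.nonTrivial⇒≢1 {{prime⇒nonTrivial p-prime}} (ℕ.∣1⇒≡1 (∣⇒∣ᵤ p∣1))
  both : ∀ a {b} → ¬ (+ p ℤ.∣ a) → ¬ (+ p ℤ.∣ b) → ¬ ((+ p ℤ.∣ a) ⊎ (+ p ℤ.∣ b))
  both a p∤a p∤b (inj₁ p∣a) = p∤a p∣a
  both a p∤a p∤b (inj₂ p∣b) = p∤b p∣b

-- Luckiness of an ideal of linear forms and torsion modulo their span.

module _ {l k} (σ : TermOrdering l) {p} (p-prime : Prime p) (A : Matrix l k) where
  open TermOrdering σ

  private
    I : Pred (Poly l) 0ℓ
    I = ⟨ linearForms A ⟩

    I-ideal : IsIdeal I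
    I-ideal = ⟨⟩-ideal (linearForms A)

  module _ {m} {G : Fin m → Poly l} (basis : IsMinimalStrongGröbnerBasis σ I G) where
    open IsMinimalStrongGröbnerBasis basis

    basis∈ : ∀ i → I (G i)
    basis∈ i = proj₂ generates {G i} (generator∈ G i)

    LT≢𝟙 : ∀ i → LT σ (G i) ≢ 𝟙
    LT≢𝟙 i LT≡𝟙 = LC≢0 σ (G i) (nonzero i) (trans (cong (coeff (G i)) LT≡𝟙) (proj₁ (⟨⟩⊆vanishing A (G i) (basis∈ i))))

  multiple-var-leads : ∀ {N} k → Image A (N ⊙ δ k) → Leads σ I-ideal N (var k)
  multiple-var-leads {N} k Nδ∈ = linear (N ⊙ δ k) , linear∈⟨⟩ Nδ∈ , coeff-multiple-var N k , λ s c≢0 →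
    subst (_≤ var k) (sym (multiple-var-support N k s c≢0)) (IsTotalOrder.refl isTotalOrder)

  -- The leading term `t` of a basis element is not `𝟙`, so it is a multiple of some variable and
  -- `d` is a leading coefficient at `t`. The least leading coefficient `a` at `t` divides both `d`
  -- and the coefficient `c` of the basis element. Some basis element's leading monomial divides
  -- that of `f`, which is (a , t), and hence (c , t); by minimality of the basis it is the given
  -- one. Thus `c` divides `a`, which divides `d`, and `p` does not divide `c`.
  exponent⇒lucky : ∀ {d} → ¬ (+ p ℤ.∣ d) → (∀ k → Image A (d ⊙ δ k)) → Lucky σ p I
  exponent⇒lucky {d} p∤d d-kills G basis i p∣LC with var-factor (LT σ (G i)) (LT≢𝟙 basis i)
  ... | k , u , t≡uk = ¬¬-least-leading-coefficient σ I-ideal c-leads (LC≢0 σ (G i) (nonzero i)) λ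
    (a , (f , f∈ , ft≡a , f≤t) , a≢0 , a∣) → clash f f∈ ft≡a a≢0 f≤t (a∣ c c-leads) (a∣ (1ℤ * d) d-leads)
      (strong f f∈ λ f≈0 → a≢0 (trans (sym ft≡a) (f≈0 t)))
    where
    open IsMinimalStrongGröbnerBasis basis
    c = LC σ (G i)
    t = LT σ (G i)
    c-leads : Leads σ I-ideal c t
    c-leads = G i , basis∈ basis i , refl , LT-bound σ (G i)
    d-leads : Leads σ I-ideal (1ℤ * d) t
    d-leads = subst (Leads σ I-ideal (1ℤ * d)) (sym t≡uk) (leads-shift σ I-ideal 1ℤ u (multiple-var-leads k (d-kills k)))
    clash : ∀ {a} f → I f → coeff f t ≡ a → a ≢ 0ℤ → Bounded σ f t → a ℤ.∣ c → a ℤ.∣ 1ℤ * d → ¬ (∃[ j ] LM σ (G j) ∣ᴹ LM σ f)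
    clash {a} f f∈ ft≡a a≢0 f≤t a∣c a∣d (j , Gj∣f) with j Fin.≟ i
    ... | no j≢i = minimal j i j≢i (∣ᴹ-trans Gj∣at ((ℤ._∣_.quotient a∣c , 𝟙) , cong₂ _,_ (ℤ._∣_.equality a∣c) (sym (∙-identityˡ t))))
      where Gj∣at = subst (LM σ (G j) ∣ᴹ_) (LM-unique σ f ft≡a a≢0 f≤t) Gj∣f
    ... | yes refl with subst (LM σ (G i) ∣ᴹ_) (LM-unique σ f ft≡a a≢0 f≤t) Gj∣f
    ...   | (q , _) , at≡ = p∤d (∣-trans (∣ᵤ⇒∣ p∣LC) (∣-trans (divides q (cong proj₁ at≡)) (subst (a ℤ.∣_) (ℤ.*-identityˡ d) a∣d)))

  lucky⇒saturated : Lucky σ p I → (∀ y → Localized (_≢ 0ℤ) (Image A) y) → ∀ y → Localized (λ D → ¬ (+ p ℤ.∣ D)) (Image A) y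
  lucky⇒saturated lucky torsion y = do
    (_ , G , basis) ← ¬¬-minimalStrongGröbnerBasis σ (linearForms A)
    δ-generate (δ∈ G basis) y
    where
    p-local : IsMultiplicative (λ D → ¬ (+ p ℤ.∣ D))
    p-local = ∤-multiplicative p-prime
    Sat : Pred (Vector ℤ l) 0ℓ
    Sat = Localized (λ D → ¬ (+ p ℤ.∣ D)) (Image A)
    open IsSubmodule (Localized-submodule p-local (Image-submodule A))

    -- The σ-least variable x_k that is not in Sat is, up to a unit mod p and smaller variables,
    -- the linear part of the basis element whose leading monomial divides a multiple of x_k.
    module _ {m} (G : Fin m → Poly l) (basis : IsMinimalStrongGröbnerBasis σ I G) where
      open IsMinimalStrongGröbnerBasis basis

      P : Pred (PP l) 0ℓ
      P t = ∃[ k ] t ≡ var k × ¬ Sat (δ k)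

      ruled-out : ∀ k → (∀ s → P s → var k ≤ s) → ∀ i → LT σ (G i) ≡ var k → Sat (δ k)
      ruled-out k least i LT≡var = Localized-saturated p-local (Image-submodule A) {c = c} (λ p∣c → lucky G basis i (∣⇒∣ᵤ p∣c))
        (≗-resp split (⊕∈ w∈ (⊙∈ -1ℤ rest∈)))
        where
        c = LC σ (G i)
        w = linearPart (G i)
        w∈ : Sat w
        w∈ = ⊆Localized p-local (Image-submodule A) (proj₂ (⟨⟩⊆vanishing A (G i) (basis∈ basis i)))
        wk≡c : w k ≡ c
        wk≡c = cong (coeff (G i)) (sym LT≡var)
        off : ∀ {j} → Dec (j ≡ k) → ℤ
        off (yes _) = 0ℤ
        off {j} (no _) = w j
        rest : Vector ℤ l
        rest j = off (j Fin.≟ k)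
        -- A variable of the linear part lies below the leading one, `var k`. Were it outside `Sat`,
        -- leastness of `var k` would give the reverse inequality.
        smaller∈ : ∀ {j} → j ≢ k → w j ≢ 0ℤ → Sat (δ j)
        smaller∈ {j} j≢k wj≢0 = negated-stable λ δj∉ → j≢k (var-injective (IsTotalOrder.antisym isTotalOrder
          (subst (var j ≤_) LT≡var (LT-bound σ (G i) (var j) wj≢0)) (least (var j) (j , refl , δj∉))))
        rest-δ∈ : ∀ j → Sat (rest j ⊙ δ j)
        rest-δ∈ j with j Fin.≟ k
        ... | yes _ = ≗-resp (λ i → sym (ℤ.*-zeroˡ (δ j i))) zero∈
        ... | no j≢k with w j ℤ.≟ 0ℤ
        ...   | yes wj≡0 = ≗-resp (λ i → sym (trans (cong (_* δ j i) wj≡0) (ℤ.*-zeroˡ (δ j i)))) zero∈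
        ...   | no wj≢0 = ⊙∈ (w j) (smaller∈ j≢k wj≢0)
        rest∈ : Sat rest
        rest∈ = ≗-resp (λ i → sum-1ᴹʳ′ i) (sum∈ (λ j → rest j ⊙ δ j) rest-δ∈)
          where
          sum-1ᴹʳ′ : ∀ i → sumℤ (λ j → rest j * 1ᴹ i j) ≡ rest i
          sum-1ᴹʳ′ i = trans (sum-cong-≗ λ j → ℤ.*-comm (rest j) (1ᴹ i j)) (sum-1ᴹˡ rest i)
        cancel : ∀ a → a + -1ℤ * a ≡ 0ℤ
        cancel = solve-∀
        split : w ⊕ -1ℤ ⊙ rest ≗ c ⊙ δ k
        split j with j Fin.≟ k
        ... | yes refl = trans (ℤ.+-identityʳ (w j)) (trans wk≡c (sym (ℤ.*-identityʳ c)))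
        ... | no j≢k = trans (cancel (w j)) (sym (ℤ.*-zeroʳ c))

      -- By `torsion`, some nonzero multiple of the variable is in the ideal. The basis element
      -- whose leading monomial divides it has leading term `𝟙` or the variable itself, and `𝟙` is
      -- excluded because the ideal has no constant terms.
      no-least : ¬ (∃[ t ] P t × (∀ s → P s → t ≤ s))
      no-least (_ , (k , refl , δk∉) , least) = torsion (δ k) λ (N , N≢0 , Nδ∈) → N-case N≢0 Nδ∈
        where
        N-case : ∀ {N} → N ≢ 0ℤ → ¬ Image A (N ⊙ δ k)
        N-case {N} N≢0 Nδ∈ with multiple-var-leads k Nδ∈
        ... | f , f∈ , fk≡N , f≤ with strong f f∈ (λ f≈0 → N≢0 (trans (sym fk≡N) (f≈0 (var k))))
        ...   | i , Gi∣f with subst (LM σ (G i) ∣ᴹ_) (LM-unique σ f fk≡N N≢0 f≤) Gi∣f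
        ...     | (q , u) , eq with ∙≡var u (LT σ (G i)) k (sym (cong proj₂ eq))
        ...       | inj₂ LT≡𝟙 = LT≢𝟙 basis i LT≡𝟙
        ...       | inj₁ refl = δk∉ (ruled-out k least i (trans (sym (∙-identityˡ (LT σ (G i)))) (sym (cong proj₂ eq))))

      δ∈ : ∀ k → Sat (δ k)
      δ∈ k = negated-stable λ δk∉ → ¬¬-σ-least σ P (var k , k , refl , δk∉) no-least

-- Rational subspaces

module Sumℚ = Sum (CommutativeRing.semiring ℚ.+-*-commutativeRing)

ι : ℤ → ℚ
ι a = a ℚ./ 1

toℚᵘ-ι : ∀ a → toℚᵘ (ι a) ℚᵘ.≃ mkℚᵘ a 0
toℚᵘ-ι a = ℚ.toℚᵘ-fromℚᵘ (mkℚᵘ a 0)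

ι-+ : ∀ a b → ι (a + b) ≡ ι a ℚ.+ ι b
ι-+ a b = ℚ.toℚᵘ-injective (begin
  toℚᵘ (ι (a + b))                  ≈⟨ toℚᵘ-ι (a + b) ⟩
  mkℚᵘ (a + b) 0                    ≈⟨ *≡* (unit a b) ⟩
  mkℚᵘ a 0 ℚᵘ.+ mkℚᵘ b 0            ≈⟨ ℚᵘ.+-cong (toℚᵘ-ι a) (toℚᵘ-ι b) ⟨
  toℚᵘ (ι a) ℚᵘ.+ toℚᵘ (ι b)        ≈⟨ ℚ.toℚᵘ-homo-+ (ι a) (ι b) ⟨
  toℚᵘ (ι a ℚ.+ ι b)                ∎)
  where
  open import Relation.Binary.Reasoning.Setoid ℚᵘ.≃-setoid
  unit : ∀ a b → (a + b) * 1ℤ ≡ (a * 1ℤ + b * 1ℤ) * 1ℤ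
  unit = solve-∀

ι-* : ∀ a b → ι (a * b) ≡ ι a ℚ.* ι b
ι-* a b = ℚ.toℚᵘ-injective (begin
  toℚᵘ (ι (a * b))                  ≈⟨ toℚᵘ-ι (a * b) ⟩
  mkℚᵘ (a * b) 0                    ≈⟨ ℚᵘ.≃-refl ⟩
  mkℚᵘ a 0 ℚᵘ.* mkℚᵘ b 0            ≈⟨ ℚᵘ.*-cong (toℚᵘ-ι a) (toℚᵘ-ι b) ⟨
  toℚᵘ (ι a) ℚᵘ.* toℚᵘ (ι b)        ≈⟨ ℚ.toℚᵘ-homo-* (ι a) (ι b) ⟨
  toℚᵘ (ι a ℚ.* ι b)                ∎)
  where open import Relation.Binary.Reasoning.Setoid ℚᵘ.≃-setoid

ι≡0⇒≡0 : ∀ {a} → ι a ≡ 0ℚ → a ≡ 0ℤ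
ι≡0⇒≡0 {a} ιa≡0 with ℚ.fromℚᵘ-injective {mkℚᵘ a 0} {mkℚᵘ 0ℤ 0} ιa≡0
... | *≡* a*1≡0 = trans (sym (ℤ.*-identityʳ a)) a*1≡0

ι-sum : ∀ {n} (f : Vector ℤ n) → ι (sumℤ f) ≡ sumℚ (ι ∘ f)
ι-sum {zero}  f = refl
ι-sum {suc n} f = trans (ι-+ (f zero) (sumℤ (f ∘ suc))) (cong (ι (f zero) ℚ.+_) (ι-sum (f ∘ suc)))

ℚ-*-cancelˡ-0 : ∀ {p q} → p ≢ 0ℚ → p ℚ.* q ≡ 0ℚ → q ≡ 0ℚ
ℚ-*-cancelˡ-0 {p} {q} p≢0 pq≡0 = begin
  q                          ≡⟨ ℚ.*-identityˡ q ⟨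
  ℚ.1ℚ ℚ.* q                 ≡⟨ cong (ℚ._* q) (ℚ.*-inverseˡ p) ⟨
  ℚ.1/ p ℚ.* p ℚ.* q         ≡⟨ ℚ.*-assoc (ℚ.1/ p) p q ⟩
  ℚ.1/ p ℚ.* (p ℚ.* q)       ≡⟨ cong (ℚ.1/ p ℚ.*_) pq≡0 ⟩
  ℚ.1/ p ℚ.* 0ℚ              ≡⟨ ℚ.*-zeroʳ (ℚ.1/ p) ⟩
  0ℚ                         ∎
  where
  open ≡-Reasoning
  instance
    p-nonZero : ℚ.NonZero p
    p-nonZero = ℚ.≢-nonZero p≢0

module _ {l} (x : Vector ℚ l) where

  eval-⊙ : ∀ N (c : Vector ℤ l) → eval (N ⊙ c) x ≡ ι N ℚ.* eval c x
  eval-⊙ N c = trans (Sumℚ.sum-cong-≗ λ k → trans (cong (ℚ._* x k) (ι-* N (c k))) (ℚ.*-assoc (ι N) (ι (c k)) (x k)))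
    (sym (Sumℚ.*-distribˡ-sum (ι N) (λ k → ι (c k) ℚ.* x k)))

  annihilator-submodule : IsSubmodule (λ c → eval c x ≡ 0ℚ)
  annihilator-submodule = record
    { ≗-resp = λ {c} {d} c≗d → trans (sym (Sumℚ.sum-cong-≗ λ k → cong (λ a → ι a ℚ.* x k) (c≗d k)))
    ; zero∈ = trans (Sumℚ.sum-cong-≗ λ k → ℚ.*-zeroˡ (x k)) (Sumℚ.sum-replicate-zero l)
    ; ⊕∈ = λ {c} {d} c∈ d∈ → trans (Sumℚ.sum-cong-≗ λ k → trans (cong (ℚ._* x k) (ι-+ (c k) (d k))) (ℚ.*-distribʳ-+ (x k) (ι (c k)) (ι (d k))))
        (trans (Sumℚ.∑-distrib-+ (λ k → ι (c k) ℚ.* x k) (λ k → ι (d k) ℚ.* x k)) (cong₂ ℚ._+_ c∈ d∈))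
    ; ⊙∈ = λ N {c} c∈ → trans (eval-⊙ N c) (trans (cong (ι N ℚ.*_) c∈) (ℚ.*-zeroʳ (ι N)))
    }

  annihilator-saturated : ∀ {N c} → N ≢ 0ℤ → eval (N ⊙ c) x ≡ 0ℚ → eval c x ≡ 0ℚ
  annihilator-saturated {N} {c} N≢0 Nc∈ = ℚ-*-cancelˡ-0 (N≢0 ∘ ι≡0⇒≡0) (trans (sym (eval-⊙ N c)) Nc∈)

  -- Vanishing at `x` is a decidable equation in ℚ, so the double negation inside `Localized` can be
  -- removed.
  annihilator-localized : ∀ {M} → (∀ {c} → M c → eval c x ≡ 0ℚ) → ∀ {c} → Localized (_≢ 0ℤ) M c → eval c x ≡ 0ℚ
  annihilator-localized M⊆ {c} c∈ = decidable-stable (eval c x ℚ.≟ 0ℚ) do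
    (N , N≢0 , Nc∈) ← c∈
    return (annihilator-saturated {N} {c} N≢0 (M⊆ Nc∈))

eval-ι : ∀ {l} (c u : Vector ℤ l) → eval c (ι ∘ u) ≡ ι (sumℤ λ k → c k * u k)
eval-ι c u = trans (Sumℚ.sum-cong-≗ λ k → sym (ι-* (c k) (u k))) (sym (ι-sum λ k → c k * u k))

codim-l⇒zero : ∀ {l} {W : Pred (Vector ℚ l) 0ℓ} → Codim W l → ∀ x → W x → ∀ k → x k ≡ 0ℚ
codim-l⇒zero {l} (d , (v , _ , _ , span) , d+l≡l) with ℕ.+-cancelʳ-≡ l d 0 d+l≡l
... | refl = λ x x∈W k → proj₂ (span x x∈W) k

zero⇒codim-l : ∀ {l} {W : Pred (Vector ℚ l) 0ℓ} → (∀ x → W x → ∀ k → x k ≡ 0ℚ) → Codim W l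
zero⇒codim-l W≡0 = 0 , ((λ ()) , (λ ()) , (λ _ _ ()) , λ x x∈W → (λ ()) , W≡0 x x∈W) , refl

-- Subsets of columns and independent subsets.

increasing⇒injective : ∀ {k n} {J : Fin k → Fin n} → StrictlyIncreasing J → ∀ {a b} → J a ≡ J b → a ≡ b
increasing⇒injective {J = J} inc {a} {b} Ja≡Jb with Fin.<-cmp a b
... | tri< a<b _ _ = contradiction Ja≡Jb (Fin.<⇒≢ (inc a b a<b))
... | tri≈ _ a≡b _ = a≡b
... | tri> _ _ b<a = contradiction (sym Ja≡Jb) (Fin.<⇒≢ (inc b a b<a))

enumerate : ∀ {n} (b : Fin n → Bool) → ∃[ m ] ∃ λ (J : Fin m → Fin n) →
  StrictlyIncreasing J × (∀ a → b (J a) ≡ true) × (∀ i → b i ≡ true → ∃[ a ] J a ≡ i)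
enumerate {zero} b = 0 , (λ ()) , (λ ()) , (λ ()) , λ ()
enumerate {suc n} b with enumerate (b ∘ suc) | b zero in b0
... | m , J , inc , J⊆b , b⊆J | false = m , suc ∘ J , (λ a c a<c → s≤s (inc a c a<c)) , J⊆b , surj
  where
  surj : ∀ i → b i ≡ true → ∃[ a ] suc (J a) ≡ i
  surj zero b0≡true = contradiction (trans (sym b0) b0≡true) λ ()
  surj (suc i) bi with b⊆J i bi
  ... | a , refl = a , refl
... | m , J , inc , J⊆b , b⊆J | true = suc m , J′ , inc′ , J′⊆b , surj
  where
  J′ : Fin (suc m) → Fin (suc n)
  J′ zero = zero
  J′ (suc a) = suc (J a)
  inc′ : StrictlyIncreasing J′
  inc′ zero (suc c) _ = s≤s z≤n
  inc′ (suc a) (suc c) (s≤s a<c) = s≤s (inc a c a<c)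
  J′⊆b : ∀ a → b (J′ a) ≡ true
  J′⊆b zero = b0
  J′⊆b (suc a) = J⊆b a
  surj : ∀ i → b i ≡ true → ∃[ a ] J′ a ≡ i
  surj zero _ = zero , refl
  surj (suc i) bi with b⊆J i bi
  ... | a , refl = suc a , refl

-- Subsets of the columns are Boolean functions, and combinations of a subset of the columns
-- are combinations of all columns with vanishing coefficients outside the subset.
module _ {l n} (C : Matrix l n) where

  column : Fin n → Vector ℤ l
  column i k = C k i

  Supported : (Fin n → Bool) → Pred (Vector ℤ n) 0ℓ
  Supported b x = ∀ i → b i ≡ false → x i ≡ 0ℤ

  Independent : (Fin n → Bool) → Set
  Independent b = ∀ x → Supported b x → C ⋆ x ≗ 0ⱽ → x ≗ 0ⱽ

  Span : (Fin n → Bool) → Pred (Vector ℤ l) 0ℓ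
  Span b y = ∃[ x ] Supported b x × C ⋆ x ≗ y

  -- The integral vectors in the rational span of the chosen columns, up to double negation.
  ℚSpan : (Fin n → Bool) → Pred (Vector ℤ l) 0ℓ
  ℚSpan b = Localized (_≢ 0ℤ) (Span b)

  Span-submodule : ∀ b → IsSubmodule (Span b)
  Span-submodule b = record
    { ≗-resp = λ y≗z (x , supp , Cx≗y) → x , supp , λ i → trans (Cx≗y i) (y≗z i)
    ; zero∈ = 0ⱽ , (λ _ _ → refl) , ⋆-0 C
    ; ⊕∈ = λ (x , suppx , hx) (y , suppy , hy) → x ⊕ y , (λ i bi → cong₂ _+_ (suppx i bi) (suppy i bi)) ,
        λ i → trans (⋆-⊕ C x y i) (cong₂ _+_ (hx i) (hy i))
    ; ⊙∈ = λ c (x , supp , hx) → c ⊙ x , (λ i bi → trans (cong (c *_) (supp i bi)) (ℤ.*-zeroʳ c)) ,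
        λ i → trans (⋆-⊙ C c x i) (cong (c *_) (hx i))
    }

  ℚSpan-submodule : ∀ b → IsSubmodule (ℚSpan b)
  ℚSpan-submodule b = Localized-submodule ≢0-multiplicative (Span-submodule b)

  column∈Span : ∀ b {i} → b i ≡ true → Span b (column i)
  column∈Span b {i} bi = δ i , (λ j bj → 1ᴹ-off-diagonal {i = j} {i} λ { refl → contradiction (trans (sym bi) bj) λ () }) , ⋆-δ C i

  Span-least : ∀ b {M} → IsSubmodule M → (∀ i → b i ≡ true → M (column i)) → ∀ {y} → Span b y → M y
  Span-least b {M} M-submodule columns∈ (x , supp , Cx≗y) = ≗-resp (λ k → trans (sum-cong-≗ λ i → ℤ.*-comm (x i) (C k i)) (Cx≗y k))
    (sum∈ (λ i → x i ⊙ column i) term∈)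
    where
    open IsSubmodule M-submodule
    term∈ : ∀ i → M (x i ⊙ column i)
    term∈ i with b i in bi
    ... | true = ⊙∈ (x i) (columns∈ i bi)
    ... | false = ≗-resp (λ k → sym (trans (cong (_* C k i) (supp i bi)) (ℤ.*-zeroˡ (C k i)))) zero∈

  _⊆_ : (Fin n → Bool) → (Fin n → Bool) → Set
  b ⊆ b′ = ∀ i → b i ≡ true → b′ i ≡ true

  ⊆-supported : ∀ {b b′} → b ⊆ b′ → ∀ {x} → Supported b x → Supported b′ x
  ⊆-supported {b} b⊆b′ supp i b′i with b i in bi
  ... | true = contradiction (trans (sym (b⊆b′ i bi)) b′i) λ ()
  ... | false = supp i bi

  ⊆-ℚSpan : ∀ {b b′} → b ⊆ b′ → ∀ {y} → ℚSpan b y → ℚSpan b′ y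
  ⊆-ℚSpan b⊆b′ y∈ = do
    (N , N≢0 , x , supp , Cx≗Ny) ← y∈
    return (N , N≢0 , x , ⊆-supported b⊆b′ supp , Cx≗Ny)

  insert : Fin n → (Fin n → Bool) → Fin n → Bool
  insert j b i = if does (i Fin.≟ j) then true else b i

  ⊆-insert : ∀ j b → b ⊆ insert j b
  ⊆-insert j b i bi with i Fin.≟ j
  ... | yes _ = refl
  ... | no _ = bi

  insert-self : ∀ j b → insert j b j ≡ true
  insert-self j b with j Fin.≟ j
  ... | yes _ = refl
  ... | no j≢j = contradiction refl j≢j

  insert-true : ∀ j b i → insert j b i ≡ true → j ≡ i ⊎ b i ≡ true
  insert-true j b i eq with i Fin.≟ j
  ... | yes i≡j = inj₁ (sym i≡j)
  ... | no _ = inj₂ eq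

  -- A relation that involves column `j` with nonzero coefficient can be solved for a nonzero
  -- multiple of that column, which puts it into the rational span of `b`.
  insert-independent : ∀ {j b} → Independent b → ¬ ℚSpan b (column j) → Independent (insert j b)
  insert-independent {j} {b} b-indep j∉ x supp Cx≗0 with x j ℤ.≟ 0ℤ
  ... | no xj≢0 = contradiction (return (- x j , (λ -xj≡0 → xj≢0 (ℤ.neg-injective -xj≡0)) , x ⊕ (- x j) ⊙ δ j , rest-supp , rest-sum)) j∉
    where
    rest-supp : Supported b (x ⊕ (- x j) ⊙ δ j)
    rest-supp i bi with i Fin.≟ j | supp i
    ... | yes refl | _ = cancel (x i)
      where
      cancel : ∀ a → a + - a * 1ℤ ≡ 0ℤ
      cancel = solve-∀
    ... | no _ | supp-i = cong₂ _+_ (supp-i bi) (ℤ.*-zeroʳ (- x j))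
    rest-sum : C ⋆ (x ⊕ (- x j) ⊙ δ j) ≗ (- x j) ⊙ column j
    rest-sum k = trans (⋆-⊕ C x ((- x j) ⊙ δ j) k) (trans
      (cong₂ _+_ (Cx≗0 k) (trans (⋆-⊙ C (- x j) (δ j) k) (cong (- x j *_) (⋆-δ C j k))))
      (ℤ.+-identityˡ (- x j * C k j)))
  ... | yes xj≡0 = b-indep x supp-b Cx≗0
    where
    supp-b : Supported b x
    supp-b i bi with i Fin.≟ j | supp i
    ... | yes refl | _ = xj≡0
    ... | no _ | supp-i = supp-i bi

  -- Greedy basis extension. Starting from the empty set it selects a maximal independent part of J;
  -- starting from that part and running over all columns, it completes it to a basis.
  ¬¬-extend : ∀ {k} (J : Fin k → Fin n) b → Independent b → ¬ ¬ (∃[ b′ ] b ⊆ b′ × Independent b′ ×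
    (∀ a → ℚSpan b′ (column (J a))) × (∀ i → b′ i ≡ true → b i ≡ true ⊎ ∃[ a ] J a ≡ i))
  ¬¬-extend {zero} J b b-indep = return (b , (λ _ bi → bi) , b-indep , (λ ()) , λ _ → inj₁)
  ¬¬-extend {suc k} J b b-indep = do
    (b′ , b⊆b′ , b′-indep , spans , b′⊆) ← ¬¬-extend (J ∘ suc) b b-indep
    spanned? ← ¬¬-excluded-middle {A = ℚSpan b′ (column (J zero))}
    return (add b′ b⊆b′ b′-indep spans b′⊆ spanned?)
    where
    add : ∀ b′ → b ⊆ b′ → Independent b′ → (∀ a → ℚSpan b′ (column (J (suc a)))) →
      (∀ i → b′ i ≡ true → b i ≡ true ⊎ ∃[ a ] J (suc a) ≡ i) → Dec (ℚSpan b′ (column (J zero))) →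
      ∃[ b″ ] b ⊆ b″ × Independent b″ × (∀ a → ℚSpan b″ (column (J a))) × (∀ i → b″ i ≡ true → b i ≡ true ⊎ ∃[ a ] J a ≡ i)
    add b′ b⊆b′ b′-indep spans b′⊆ (yes spanned) = b′ , b⊆b′ , b′-indep , (λ { zero → spanned ; (suc a) → spans a }) , from
      where
      from : ∀ i → b′ i ≡ true → b i ≡ true ⊎ ∃[ a ] J a ≡ i
      from i b′i with b′⊆ i b′i
      ... | inj₁ bi = inj₁ bi
      ... | inj₂ (a , eq) = inj₂ (suc a , eq)
    add b′ b⊆b′ b′-indep spans b′⊆ (no ¬spanned) = insert (J zero) b′ , (λ i bi → ⊆-insert (J zero) b′ i (b⊆b′ i bi)) ,
      insert-independent b′-indep ¬spanned ,
      (λ { zero → ⊆Localized ≢0-multiplicative (Span-submodule _) (column∈Span (insert (J zero) b′) (insert-self (J zero) b′))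
         ; (suc a) → ⊆-ℚSpan (⊆-insert (J zero) b′) (spans a) }) , from
      where
      from : ∀ i → insert (J zero) b′ i ≡ true → b i ≡ true ⊎ ∃[ a ] J a ≡ i
      from i eq with insert-true (J zero) b′ i eq
      ... | inj₁ J0≡i = inj₂ (zero , J0≡i)
      ... | inj₂ b′i with b′⊆ i b′i
      ...   | inj₁ bi = inj₁ bi
      ...   | inj₂ (a , Ja≡i) = inj₂ (suc a , Ja≡i)

  subcolumns : ∀ {k} → (Fin k → Fin n) → Matrix l k
  subcolumns J i a = C i (J a)

  subcolumns-kernel : ∀ {m b} {J : Fin m → Fin n} → StrictlyIncreasing J → (∀ a → b (J a) ≡ true) → Independent b →
    ∀ x → subcolumns J ⋆ x ≗ 0ⱽ → x ≗ 0ⱽ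
  subcolumns-kernel {m} {b} {J} inc J⊆b b-indep x Jx≗0 a = begin
    x a               ≡⟨ ℤ.*-identityˡ (x a) ⟨
    1ℤ * x a          ≡⟨ cong (_* x a) (1ᴹ-diagonal (J a)) ⟨
    E (J a) a * x a   ≡⟨ sum-single (λ c → E (J a) c * x c) a (λ c c≢a → trans (cong (_* x c) (1ᴹ-off-diagonal λ Ja≡Jc → c≢a (sym (increasing⇒injective inc Ja≡Jc)))) (ℤ.*-zeroˡ (x c))) ⟨
    (E ⋆ x) (J a)     ≡⟨ b-indep (E ⋆ x) supp CEx≗0 (J a) ⟩
    0ℤ                ∎
    where
    open ≡-Reasoning
    -- Extension by zero from the enumerated columns to all columns; C times `E` is the submatrix.
    E : Matrix n m
    E i a = 1ᴹ i (J a)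
    supp : Supported b (E ⋆ x)
    supp i bi = sum-zero λ c → trans (cong (_* x c) (1ᴹ-off-diagonal {i = i} {J c} λ { refl → contradiction (trans (sym (J⊆b c)) bi) λ () })) (ℤ.*-zeroˡ (x c))
    CEx≗0 : C ⋆ E ⋆ x ≗ 0ⱽ
    CEx≗0 k = trans (sym (⊗-⋆ C E x k)) (trans (⋆-congˡ (λ i a → sum-1ᴹʳ (C i) (J a)) x k) (Jx≗0 k))

-- Arrangements

Bound : ∀ {A : Set} → (A → ℕ → Set) → Set
Bound B = ∃[ N ] N ≢ 0 × (∀ a → B a N)

Monotone : ∀ {A : Set} → (A → ℕ → Set) → Set
Monotone B = ∀ a {N M} → N ∣ M → B a N → B a M

*≢0 : ∀ {N M} → N ≢ 0 → M ≢ 0 → N ℕ.* M ≢ 0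
*≢0 {N} {M} N≢0 M≢0 NM≡0 with ℕ.m*n≡0⇒m≡0∨n≡0 N NM≡0
... | inj₁ N≡0 = N≢0 N≡0
... | inj₂ M≡0 = M≢0 M≡0

¬¬-bound-Fin : ∀ {n} {B : Fin n → ℕ → Set} → Monotone B → (∀ i → ¬ ¬ (∃[ N ] N ≢ 0 × B i N)) → ¬ ¬ Bound B
¬¬-bound-Fin {zero} mono bounds = return (1 , (λ ()) , λ ())
¬¬-bound-Fin {suc n} mono bounds = do
  (N , N≢0 , BN) ← bounds zero
  (M , M≢0 , BM) ← ¬¬-bound-Fin (mono ∘ suc) (bounds ∘ suc)
  return (N ℕ.* M , *≢0 N≢0 M≢0 , λ { zero → mono zero (ℕ.m∣m*n M) BN ; (suc i) → mono (suc i) (ℕ.n∣m*n N) (BM i) })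

-- Functions between finite sets are finitely many only up to pointwise equality, which is why `B`
-- has to respect it.
¬¬-bound-functions : ∀ {k n} {B : (Fin k → Fin n) → ℕ → Set} → (∀ {J J′ N} → J ≗ J′ → B J N → B J′ N) → Monotone B →
  (∀ J → ¬ ¬ (∃[ N ] N ≢ 0 × B J N)) → ¬ ¬ Bound B
¬¬-bound-functions {zero} resp′ mono bounds = do
  (N , N≢0 , BN) ← bounds λ ()
  return (N , N≢0 , λ J → resp′ (λ ()) BN)
¬¬-bound-functions {suc k} resp′ mono bounds = do
  (N , N≢0 , BN) ← ¬¬-bound-Fin (λ a N∣M B-a J → mono (a ∷ⱽ J) N∣M (B-a J))
    λ a → ¬¬-bound-functions (λ J≗J′ → resp′ λ { zero → refl ; (suc i) → J≗J′ i }) (λ J → mono (a ∷ⱽ J)) λ J → bounds (a ∷ⱽ J)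
  return (N , N≢0 , λ J → resp′ (λ { zero → refl ; (suc i) → refl }) (BN (J zero) (J ∘ suc)))

last-cong : ∀ {m n d} {A B : Matrix m n} → (∀ i j → A i j ≡ B i j) → IsLastInvariantFactor A d → IsLastInvariantFactor B d
last-cong {A = A} {B} A≡B (S , s , s-last , es≡d) = S′ , s , s-last , es≡d
  where
  open SmithNormalForm S
  same : ∀ i j → (U ⊗ B ⊗ V) i j ≡ (U ⊗ A ⊗ V) i j
  same i j = sum-cong-≗ λ t → cong (_* V t j) (sum-cong-≗ λ r → cong (U i r *_) (sym (A≡B r t)))
  S′ : SmithNormalForm B
  S′ = record
    { U = U ; V = V ; U-unimodular = U-unimodular ; V-unimodular = V-unimodular
    ; rank = rank ; rank≤m = rank≤m ; rank≤n = rank≤n ; e = e ; e-positive = e-positive ; e-chain = e-chain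
    ; diagonal-entry = λ i j s i≡s j≡s → trans (same i j) (diagonal-entry i j s i≡s j≡s)
    ; zero-entry = λ i j ≢s → trans (same i j) (zero-entry i j ≢s)
    }

¬¬-last-bound : ∀ {m n} (A : Matrix m n) → ¬ ¬ (∃[ N ] N ≢ 0 × (∀ d → IsLastInvariantFactor A d → d ∣ N))
¬¬-last-bound A = do
  last? ← ¬¬-excluded-middle {A = ∃ (IsLastInvariantFactor A)}
  return (bound last?)
  where
  bound : Dec (∃ (IsLastInvariantFactor A)) → ∃[ N ] N ≢ 0 × (∀ d → IsLastInvariantFactor A d → d ∣ N)
  bound (yes (N , last@(S , s , _ , es≡N))) = N , (λ N≡0 → ℕ.<⇒≢ (SmithNormalForm.e-positive S s) (sym (trans es≡N N≡0))) , λ d d-last → last-unique d-last last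
  -- A matrix of rank 0 has no last invariant factor, and then any nonzero number will do.
  bound (no none) = 1 , (λ ()) , λ d d-last → contradiction (d , d-last) none

last-index : ∀ {r} → Fin r → ∃ λ (s : Fin r) → suc (toℕ s) ≡ r
last-index {suc r} _ = Fin.fromℕ r , cong suc (Fin.toℕ-fromℕ r)

module _ {l n} (𝒜 : Arrangement l n) where
  open Arrangement 𝒜

  -- An integral vector orthogonal to the chosen columns is a rational point of the intersection of
  -- their hyperplanes, which is the origin.
  left-kernel : ∀ {k} {J : Fin k → Fin n} → Codim (⋂ (Fin k) (λ a → H (J a))) l →
    ∀ u → (∀ a → sumℤ (λ i → u i * columns J i a) ≡ 0ℤ) → u ≗ 0ⱽ
  left-kernel {J = J} codim u uJ≡0 k = ι≡0⇒≡0 (codim-l⇒zero codim (ι ∘ u) u∈ k)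
    where
    u∈ : ∀ a → H (J a) (ι ∘ u)
    u∈ a = trans (eval-ι (column C (J a)) u) (cong ι (trans (sum-cong-≗ λ i → ℤ.*-comm (C i (J a)) (u i)) (uJ≡0 a)))

  -- The linear forms vanishing at a point are closed under rational combinations, so a point on the
  -- chosen hyperplanes lies on all of them and essentiality applies.
  spanning⇒codim : ∀ {m b} {J : Fin m → Fin n} → (∀ i → b i ≡ true → ∃[ a ] J a ≡ i) → (∀ i → ℚSpan C b (column C i)) →
    Codim (⋂ (Fin m) (λ a → H (J a))) l
  spanning⇒codim {b = b} {J} b⊆J spans = zero⇒codim-l λ x x∈ → essential x λ i →
    annihilator-localized x (λ {c} → Span-least C b (annihilator-submodule x) (λ i bi → on-J x x∈ (b⊆J i bi)) {c}) {column C i} (spans i)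
    where
    on-J : ∀ x → (∀ a → H (J a) x) → ∀ {i} → ∃[ a ] J a ≡ i → H i x
    on-J x x∈ (a , refl) = x∈ a

  full-rank⇒torsion : ∀ {k} {J : Fin k → Fin n} (S : SmithNormalForm (columns J)) → SmithNormalForm.rank S ≡ l →
    ∀ y → Localized (_≢ 0ℤ) (Image (columns J)) y
  full-rank⇒torsion S rank≡l y = do
    (N , N≢0 , e∣N) ← ¬¬-bound-Fin {B = λ s N → e s ∣ N} (λ _ N∣M e∣N → ℕ.∣-trans e∣N N∣M)
      λ s → return (e s , (λ es≡0 → ℕ.<⇒≢ (e-positive s) (sym es≡0)) , ℕ.∣-refl)
    return (+ N , (λ { refl → N≢0 refl }) , full-rank-exponent rank≡l (+ N) (λ s → ∣ᵤ⇒∣ (e∣N s)) y)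
    where open SNF S

  module _ {σ : TermOrdering l} {p} (p-prime : Prime p) (lucky : LuckyFor σ p) where

    -- The torsion vector y of the columns J satisfies D y ∈ ℤ-span of a basis b₁ ⊇ b₀ with p ∤ D, where b₀
    -- is a maximal independent part of J; by independence D y is already in the span of b₀ ⊆ J, so e s ∣ D.
    lucky⇒∤invariant-factors : ∀ {k} (J : Fin k → Fin n) (S : SmithNormalForm (columns J)) s → ¬ p ∣ SmithNormalForm.e S s
    lucky⇒∤invariant-factors J S s p∣e = ¬¬-extend C J (λ _ → false) (λ x supp _ i → supp i refl)
      λ (b₀ , _ , b₀-indep , b₀-spans , b₀⊆) → ¬¬-extend C id b₀ b₀-indep
      λ (b₁ , b₀⊆b₁ , b₁-indep , b₁-spans , _) →
      in-basis b₀ b₀-spans (λ i b₀i → from-J (b₀⊆ i b₀i)) b₁ b₀⊆b₁ b₁-indep b₁-spans (enumerate b₁)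
      where
      open SNF S using (e; e-positive; torsion; torsion-multiple∈; torsion-order)
      y = torsion s

      from-J : ∀ {i} → false ≡ true ⊎ ∃[ a ] J a ≡ i → ∃[ a ] J a ≡ i
      from-J (inj₂ Ja≡i) = Ja≡i

      e≢0 : + e s ≢ 0ℤ
      e≢0 es≡0 = ℕ.<⇒≢ (e-positive s) (sym (ℤ.+-injective es≡0))

      in-basis : ∀ b₀ → (∀ a → ℚSpan C b₀ (column C (J a))) → (∀ i → b₀ i ≡ true → ∃[ a ] J a ≡ i) →
        ∀ b₁ → _⊆_ C b₀ b₁ → Independent C b₁ → (∀ i → ℚSpan C b₁ (column C i)) →
        ¬ (∃[ m ] ∃ λ (J₁ : Fin m → Fin n) → StrictlyIncreasing J₁ × (∀ a → b₁ (J₁ a) ≡ true) × (∀ i → b₁ i ≡ true → ∃[ a ] J₁ a ≡ i))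
      in-basis b₀ b₀-spans b₀⊆J b₁ b₀⊆b₁ b₁-indep b₁-spans (m , J₁ , inc , J₁⊆b₁ , b₁⊆J₁) =
        ¬¬-smithNormalForm (columns J₁) λ S₁ →
          let module S₁ = SNF S₁
              rank≡l = S₁.left-kernel⇒rank≡m (left-kernel {J = J₁} codim)
              rank≡m = S₁.right-kernel⇒rank≡n (subcolumns-kernel C inc J₁⊆b₁ b₁-indep)
          -- The rank equals both the number of columns and the number of rows, so the basis has
          -- exactly `l` elements, as luckiness for the arrangement requires.
          in saturated (trans (sym rank≡m) rank≡l) inc codim (full-rank⇒torsion S₁ rank≡l)
               λ (D , p∤D , Dy∈) → Dy∈⟨J⟩ {D} Dy∈ λ Dy∈J → p∤D (∣-trans (∣ᵤ⇒∣ p∣e) (torsion-order s D Dy∈J))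
        where
        codim : Codim (⋂ (Fin m) (λ a → H (J₁ a))) l
        codim = spanning⇒codim b₁⊆J₁ b₁-spans

        saturated : ∀ {m} {J₁ : Fin m → Fin n} → m ≡ l → StrictlyIncreasing J₁ → Codim (⋂ (Fin m) (λ a → H (J₁ a))) l →
          (∀ y → Localized (_≢ 0ℤ) (Image (columns J₁)) y) → Localized (λ D → ¬ (+ p ℤ.∣ D)) (Image (columns J₁)) y
        saturated {J₁ = J₁} refl inc codim torsion = lucky⇒saturated σ p-prime (columns J₁) (lucky J₁ inc codim) torsion y

        column∈Image : ∀ i → b₀ i ≡ true → Image (columns J) (column C i)
        column∈Image i b₀i with b₀⊆J i b₀i
        ... | a , refl = δ a , ⋆-δ (columns J) a

        e-y∈ : ℚSpan C b₀ (+ e s ⊙ y)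
        e-y∈ = ≗-resp (proj₂ (torsion-multiple∈ s)) (⋆∈ b₀-spans (proj₁ (torsion-multiple∈ s)))
          where open IsSubmodule (ℚSpan-submodule C b₀)

        Dy∈⟨J⟩ : ∀ {D} → Image (columns J₁) (D ⊙ y) → ¬ ¬ Image (columns J) (D ⊙ y)
        Dy∈⟨J⟩ {D} (z , J₁z≗Dy) = do
          (N , N≢0 , x₀ , supp₀ , Cx₀≗) ← e-y∈
          return (Span-least C b₀ (Image-submodule (columns J)) column∈Image (x , supp₀⇒supp N≢0 supp₀ Cx₀≗ , Cx≗Dy))
          where
          Dy∈₁ : Span C b₁ (D ⊙ y)
          Dy∈₁ = ≗-resp J₁z≗Dy (⋆∈ (λ a → column∈Span C b₁ (J₁⊆b₁ a)) z)
            where open IsSubmodule (Span-submodule C b₁)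
          x = proj₁ Dy∈₁
          supp₁ = proj₁ (proj₂ Dy∈₁)
          Cx≗Dy = proj₂ (proj₂ Dy∈₁)

          -- N e D y has two expansions, with coefficients N e x on `b₁` and D x₀ on `b₀`. Their
          -- difference `v` is a relation among the columns of `b₁`, hence zero; outside `b₀` this
          -- says N e x = 0.
          supp₀⇒supp : ∀ {N x₀} → N ≢ 0ℤ → Supported C b₀ x₀ → C ⋆ x₀ ≗ N ⊙ + e s ⊙ y → Supported C b₀ x
          supp₀⇒supp {N} {x₀} N≢0 supp₀ Cx₀≗ i b₀i = *-cancelˡ-0 (λ Ne≡0 → e≢0 (*-cancelˡ-0 N≢0 Ne≡0)) (begin
            N * + e s * x i                ≡⟨ ℤ.+-identityʳ (N * + e s * x i) ⟨
            N * + e s * x i + 0ℤ           ≡⟨ cong₂ _+_ {x = N * + e s * x i} refl (trans (cong (- D *_) (supp₀ i b₀i)) (ℤ.*-zeroʳ (- D))) ⟨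
            v i                            ≡⟨ b₁-indep v v-supp Cv≗0 i ⟩
            0ℤ                             ∎)
            where
            open ≡-Reasoning
            v : Vector ℤ n
            v = (N * + e s) ⊙ x ⊕ (- D) ⊙ x₀
            v-supp : Supported C b₁ v
            v-supp i b₁i = cong₂ _+_ (trans (cong (N * + e s *_) (supp₁ i b₁i)) (ℤ.*-zeroʳ (N * + e s)))
              (trans (cong (- D *_) (⊆-supported C b₀⊆b₁ supp₀ i b₁i)) (ℤ.*-zeroʳ (- D)))
            cancel : ∀ N e D y → N * e * (D * y) + - D * (N * (e * y)) ≡ 0ℤ
            cancel = solve-∀
            Cv≗0 : C ⋆ v ≗ 0ⱽ
            Cv≗0 k = trans (⋆-⊕ C ((N * + e s) ⊙ x) ((- D) ⊙ x₀) k) (trans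
              (cong₂ _+_ (trans (⋆-⊙ C (N * + e s) x k) (cong (N * + e s *_) (Cx≗Dy k)))
                (trans (⋆-⊙ C (- D) x₀ k) (cong (- D *_) (Cx₀≗ k))))
              (cancel N (+ e s) D (y k)))

  -- A nontrivial relation between two columns would make the two linear forms proportional, and so
  -- the two hyperplanes equal.
  right-kernel-pair : ∀ {J : Fin 2 → Fin n} → J zero ≢ J (suc zero) → ∀ x → columns J ⋆ x ≗ 0ⱽ → x ≗ 0ⱽ
  right-kernel-pair {J} i≢j x Jx≗0 = λ { zero → x₀≡0 ; (suc zero) → x₁≡0 }
    where
    i = J zero
    j = J (suc zero)
    x₀ = x zero
    x₁ = x (suc zero)

    x₀i≡-x₁j : x₀ ⊙ column C i ≗ (- x₁) ⊙ column C j
    x₀i≡-x₁j k = ℤ.i-j≡0⇒i≡j (x₀ * C k i) (- x₁ * C k j) (trans (rearrange (C k i) (C k j) x₀ x₁) (Jx≗0 k))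
      where
      rearrange : ∀ a b x y → x * a - - y * b ≡ a * x + (b * y + 0ℤ)
      rearrange = solve-∀

    column≢0 : ∀ i {c} → c ⊙ column C i ≗ 0ⱽ → c ≡ 0ℤ
    -- A zero column would be divisible by every prime; 2 is merely a concrete one.
    column≢0 i {c} ci≗0 = decidable-stable (c ℤ.≟ 0ℤ) λ c≢0 → content-1 i 2 prime[2] λ k →
      ∣⇒∣ᵤ {+ 2} (divides 0ℤ (*-cancelˡ-0 c≢0 (ci≗0 k)))

    x₀≡0 : x₀ ≡ 0ℤ
    x₀≡0 = decidable-stable (x₀ ℤ.≟ 0ℤ) λ x₀≢0 → distinct i j i≢j
      ( (λ {x} x∈Hi → annihilator-saturated x { - x₁} {column C j} (-x₁≢0 x₀≢0)
          (IsSubmodule.≗-resp (annihilator-submodule x) x₀i≡-x₁j (IsSubmodule.⊙∈ (annihilator-submodule x) x₀ {column C i} x∈Hi)))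
      , (λ {x} x∈Hj → annihilator-saturated x {x₀} {column C i} x₀≢0
          (IsSubmodule.≗-resp (annihilator-submodule x) (λ k → sym (x₀i≡-x₁j k)) (IsSubmodule.⊙∈ (annihilator-submodule x) (- x₁) {column C j} x∈Hj))))
      where
      -x₁≢0 : x₀ ≢ 0ℤ → - x₁ ≢ 0ℤ
      -x₁≢0 x₀≢0 -x₁≡0 = x₀≢0 (column≢0 i λ k → trans (x₀i≡-x₁j k) (cong (_* C k j) -x₁≡0))

    x₁≡0 : x₁ ≡ 0ℤ
    x₁≡0 = ℤ.neg-injective (column≢0 j λ k → trans (sym (x₀i≡-x₁j k)) (cong (_* C k i) x₀≡0))

  module _ {ρ₀ : ℕ} (ρ₀-period : IsLcmPeriod ρ₀) where

    e∣period : ∀ {k} {J : Fin k → Fin n} → k ℕ.≤ l → StrictlyIncreasing J → (S : SmithNormalForm (columns J)) →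
      ∀ s → SmithNormalForm.e S s ∣ ρ₀
    e∣period k≤l inc S s = ℕ.∣-trans (e∣last (proj₂ last) s)
      -- The existence of the index `s` makes the rank positive, which gives 1 ≤ k.
      (proj₁ ρ₀-period _ (_ , ℕ.≤-trans (ℕ.≤-trans (s≤s z≤n) (Fin.toℕ<n s)) rank≤n , k≤l , _ , inc , S , proj₁ last , proj₂ last , refl))
      where
      open SNF S
      last : ∃ λ (t : Fin rank) → suc (toℕ t) ≡ rank
      last = last-index s

    -- A congruence between the two columns puts (1 , -a) into the kernel mod `p`. Injectivity mod
    -- `p` would then make `p` divide 1.
    ∤period⇒good : ∀ {p} → Prime p → ¬ p ∣ ρ₀ → Good p
    ∤period⇒good {p} p-prime p∤ρ₀ i j i<j (a , p∣i-aj) = ¬¬-smithNormalForm (columns J) λ S →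
      let open SNF S
          rank≡2 = right-kernel⇒rank≡n (right-kernel-pair {J} λ i≡j → Fin.<⇒≢ i<j i≡j)
      in IsMultiplicative.1∈ (∤-multiplicative p-prime) (mod-p-kernel p-prime rank≡2
           -- The pair counts for the period because its rank 2 is at most the number `l` of rows.
           (λ s p∣e → p∤ρ₀ (ℕ.∣-trans p∣e (e∣period (subst (ℕ._≤ l) rank≡2 rank≤m) inc S s)))
           x (λ k → subst (+ p ℤ.∣_) (sym (combination (C k i) (C k j) a)) (∣ᵤ⇒∣ (p∣i-aj k))) zero)
      where
      J : Fin 2 → Fin n
      J = i ∷ⱽ (j ∷ⱽ λ ())
      inc : StrictlyIncreasing J
      inc zero (suc zero) _ = i<j
      inc (suc zero) (suc zero) (s≤s ())
      x : Vector ℤ 2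
      x = 1ℤ ∷ⱽ (- a ∷ⱽ λ ())
      combination : ∀ c d a → c * 1ℤ + (d * - a + 0ℤ) ≡ c - a * d
      combination = solve-∀

    -- The period itself serves as the exponent `d`: all invariant factors of the nonsingular matrix
    -- divide it.
    ∤period⇒lucky : ∀ σ {p} → Prime p → ¬ p ∣ ρ₀ → LuckyFor σ p
    ∤period⇒lucky σ {p} p-prime p∤ρ₀ J inc codim G basis i p∣LC = ¬¬-smithNormalForm (columns J) λ S →
      let open SNF S
          rank≡l = left-kernel⇒rank≡m (left-kernel {J = J} codim)
      in exponent⇒lucky σ p-prime (columns J) {+ ρ₀} (λ p∣ρ₀ → p∤ρ₀ (∣⇒∣ᵤ p∣ρ₀))
           (λ k → full-rank-exponent rank≡l (+ ρ₀) (λ s → ∣ᵤ⇒∣ (e∣period ℕ.≤-refl inc S s)) (δ k)) G basis i p∣LC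

    -- There are finitely many J, and for each one all admissible last factors divide a single
    -- nonzero number. The product bound is a nonzero common multiple, which 0 cannot divide.
    period≢0 : ρ₀ ≢ 0
    period≢0 refl = ¬¬-bound-Fin {B = λ (k : Fin (suc l)) N → ∀ J → Divides (toℕ k) J N} (λ k N∣M B J → divides-mono (toℕ k) J N∣M (B J))
      (λ k → ¬¬-bound-functions {B = Divides (toℕ k)} (λ J≗J′ N-divides d d-last → N-divides d (last-cong (λ i a → cong (C i) (sym (J≗J′ a))) d-last))
        (λ J → divides-mono (toℕ k) J) λ J → ¬¬-last-bound (columns J))
      λ (N , N≢0 , BN) → N≢0 (ℕ.0∣⇒≡0 (proj₂ ρ₀-period N λ d (k , _ , k≤l , J , _ , d-last) →
        bounded N BN (s≤s k≤l) J d d-last))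
      where
      Divides : ∀ k → (Fin k → Fin n) → ℕ → Set
      Divides k J N = ∀ d → IsLastInvariantFactor (columns J) d → d ∣ N
      divides-mono : ∀ k (J : Fin k → Fin n) {N M} → N ∣ M → Divides k J N → Divides k J M
      divides-mono k J N∣M B d d-last = ℕ.∣-trans (B d d-last) N∣M
      bounded : ∀ N → (∀ (k : Fin (suc l)) J → Divides (toℕ k) J N) → ∀ {k} → k ℕ.< suc l → ∀ J → Divides k J N
      bounded N BN k<1+l = subst (λ k → ∀ J → Divides k J N) (Fin.toℕ-fromℕ< k<1+l) (BN (fromℕ< k<1+l))

    -- If the period were q p with every admissible `d` prime to `p`, then `q` would already be a
    -- common multiple, and the period would divide the smaller nonzero number `q`.
    ∤invariant-factors⇒∤period : ∀ {p} → Prime p → (∀ {k} (J : Fin k → Fin n) (S : SmithNormalForm (columns J)) s → ¬ p ∣ SmithNormalForm.e S s) → ¬ p ∣ ρ₀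
    ∤invariant-factors⇒∤period {p} p-prime p∤e (ℕ.divides q ρ₀≡qp) = ℕ.<⇒≱ q<ρ₀ (ℕ.∣⇒≤ {{q-nonZero}} (proj₂ ρ₀-period q d∣q))
      where
      instance
        p-nonZero : ℕ.NonZero p
        p-nonZero = prime⇒nonZero p-prime
      q-nonZero : ℕ.NonZero q
      q-nonZero = ℕ.≢-nonZero λ { refl → period≢0 ρ₀≡qp }
      q<ρ₀ : q ℕ.< ρ₀
      q<ρ₀ = subst (q ℕ.<_) (sym ρ₀≡qp) (ℕ.m<m*n q p {{q-nonZero}} (ℕ.nonTrivial⇒n>1 p {{prime⇒nonTrivial p-prime}}))
      d∣q : ∀ d → _ → d ∣ q
      d∣q d d-factor@(_ , _ , _ , J , _ , S , s , _ , refl) with proj₁ ρ₀-period d d-factor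
      ... | ℕ.divides r ρ₀≡rd with euclidsLemma r d p-prime (ℕ.divides q (trans (sym ρ₀≡rd) ρ₀≡qp))
      ...   | inj₂ p∣d = contradiction p∣d (p∤e J S s)
      ...   | inj₁ (ℕ.divides t refl) = ℕ.divides t (ℕ.*-cancelʳ-≡ q (t ℕ.* d) p (begin
        q ℕ.* p              ≡⟨ ρ₀≡qp ⟨
        ρ₀                   ≡⟨ ρ₀≡rd ⟩
        t ℕ.* p ℕ.* d        ≡⟨ ℕ.*-assoc t p d ⟩
        t ℕ.* (p ℕ.* d)      ≡⟨ cong (t ℕ.*_) (ℕ.*-comm p d) ⟩
        t ℕ.* (d ℕ.* p)      ≡⟨ ℕ.*-assoc t d p ⟨
        t ℕ.* d ℕ.* p        ∎))
        where open ≡-Reasoning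

open Arrangement using (Good; LuckyFor; IsLcmPeriod)

theorem7p6 : (l n : ℕ) (𝒜 : Arrangement l n) (ρ₀ : ℕ) → IsLcmPeriod 𝒜 ρ₀ →
    (σ : TermOrdering l) (p : ℕ) → Prime p →
    (¬ Good 𝒜 p ⊎ ¬ LuckyFor 𝒜 σ p) ⇔ (p ∣ ρ₀)
theorem7p6 l n 𝒜 ρ₀ ρ₀-period σ p p-prime = mk⇔ divides-period not-lucky
  where
  divides-period : ¬ Good 𝒜 p ⊎ ¬ LuckyFor 𝒜 σ p → p ∣ ρ₀
  divides-period (inj₁ ¬good) = decidable-stable (p ℕ.∣? ρ₀) λ p∤ρ₀ → ¬good (∤period⇒good 𝒜 ρ₀-period p-prime p∤ρ₀)
  divides-period (inj₂ ¬lucky) = decidable-stable (p ℕ.∣? ρ₀) λ p∤ρ₀ → ¬lucky (∤period⇒lucky 𝒜 ρ₀-period σ p-prime p∤ρ₀)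

  not-lucky : p ∣ ρ₀ → ¬ Good 𝒜 p ⊎ ¬ LuckyFor 𝒜 σ p
  not-lucky p∣ρ₀ = inj₂ λ lucky → ∤invariant-factors⇒∤period 𝒜 ρ₀-period p-prime (lucky⇒∤invariant-factors 𝒜 {σ} p-prime lucky) p∣ρ₀
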